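{- Let $r\ge 2$ and $d\ge 3$ be integers. Let $0<\beta\le 1$ and $C>0$, and assume that the property $\mathcal G_r^{(d)}(\beta,C)$ holds. Let $t,m$ be positive integers, let $0<p\le 1$, and let $\delta,\lambda_0>0$. Set $$L=\log(1/\delta),\qquad L_p=\log(1/p),\qquad \rho=\log(r/\beta),$$ and suppose that $$0<\delta\le\min\{p/4,1/4\},\qquad \lambda_0\ge\max\{2,6L\},\qquad t\ge\lambda_0\,\delta^{ -1/(d-1)}.$$ Define $$\Pi=\frac{3\delta}{p}+\frac{6LL_p}{\lambda_0},\qquad \Xi=2\rho+4C\lambda_0^{1/d}+\frac{12CL}{\lambda_0^{(d-1)/d}}.$$ Let $X,Y_1,\ldots,Y_r$ be nonempty vertex sets (not required to be disjoint) in a finite $r$-edge-colored complete graph. Suppose that $$|N_i(x)\cap Y_i|\ge p|Y_i|\quad (x\in X,\ i\in[r]),\qquad |Y_i|\ge p^{ -t}e^{\Pi t}m\quad(i\in[r]),$$ and $$|X|\ge 2rt\,e^{rt\Xi}.$$ Then there exist an index $i\in[r]$, a color-$i$ clique $T\subseteq X$ with $|T|=t$, and a set $P\subseteq Y_i\setminus T$ with $|P|=m$ such that every edge between $T$ and $P$ has color $i$. In particular, $(T,P)$ is a color-$i$ $(t,m)$-book.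
   Context: $[r]=\{1,\dots,r\}$ and $\log$ is the natural logarithm. In an $r$-edge-colored complete graph with colors $1,\dots,r$, $N_i(v)=\{w: vw \text{ has color } i\}$ is the color-$i$ neighborhood of $v$ (graphs are simple, so $v\notin N_i(v)$). A color-$i$ clique is a vertex set all of whose internal edges have color $i$. A color-$i$ book is an ordered pair $(T,P)$ of disjoint vertex sets such that $T$ is a color-$i$ clique and every edge between $T$ and $P$ has color $i$; it is a $(t,m)$-book if $|T|=t$ and $|P|\ge m$. Property $\mathcal G_r^{(d)}(\beta,C)$ (for integers $r\ge2$, $d\ge3$ and reals $0<\beta\le1$, $C>0$): for every finite set $\mathcal X$, every pair $U,U'$ of independent copies of a random variable taking values in $\mathcal X$, and every collection of maps $\sigma_i:\mathcal X\to\mathcal H_i$ ($i\in[r]$) into real Hilbert spaces $\mathcal H_i$, setting $Z_i=\langle\sigma_i(U),\sigma_i(U')\rangle$, there exist $i\in[r]$ and a real $\lambda\ge-1$ such that $$\mathbb P\bigl(Z_i\ge\lambda,\ Z_j\ge-1\text{ for every }j\ne i\bigr)\ge\beta\exp\!\left(-C(\lambda+1)^{1/d}\right).$$ -}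

module Defs where

open import Algebra.Bundles using (CommutativeRing; Semiring)
open import Algebra.Core using (Op₁; Op₂)
open import Algebra.Module.Bundles using (LeftModule)
import Algebra.Properties.Semiring.Mult as SemiringMult
open import Data.Bool.Base using (if_then_else_)
open import Data.Empty using (⊥-elim)
open import Data.Fin.Base using (Fin; zero; suc; toℕ)
open import Data.Fin.Properties using (all?; _≟_)
open import Data.Fin.Subset using (Subset; _∈_; _∩_; ∣_∣; Empty)
open import Data.Nat.Base as ℕ using (ℕ; zero; suc; _!)
import Data.Nat.Properties as ℕₚ
open import Data.Product.Base using (∃; ∃-syntax; Σ-syntax; _×_; _,_; proj₁; proj₂)
open import Data.Sum.Base using (inj₁; inj₂)
open import Data.Vec.Base using (tabulate)
open import Function.Base using (_∘_)
open import Level using (0ℓ)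
import Relation.Binary.Construct.NonStrictToStrict as NonStrictToStrict
open import Relation.Binary.Core using (Rel)
open import Relation.Binary.PropositionalEquality as ≡ using (_≡_; _≢_)
open import Relation.Binary.Structures using (IsDecTotalOrder)
open import Relation.Nullary using (¬_; Dec; yes; no; does; ¬?; _×-dec_; _→-dec_)

------------------------------------------------------------------------
-- The real numbers, axiomatised up to isomorphism as the Dedekind complete
-- ordered field. These are the classical reals: the order is decidable.

record RealNumbers : Set₁ where
  field
    commutativeRing : CommutativeRing 0ℓ 0ℓ

  open CommutativeRing commutativeRing public renaming (Carrier to ℝ)

  open SemiringMult semiring public using () renaming (_×_ to _·_)

  fromℕ : ℕ → ℝ
  fromℕ n = n · 1#

  infix 4 _≤_

  field
    _≤_             : Rel ℝ 0ℓ
    isDecTotalOrder : IsDecTotalOrder _≈_ _≤_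
    1≉0             : ¬ 1# ≈ 0#
    inverse         : ∀ x → ¬ x ≈ 0# → ∃[ y ] x * y ≈ 1#
    +-monoʳ-≤       : ∀ z {x y} → x ≤ y → z + x ≤ z + y
    *-nonneg        : ∀ {x y} → 0# ≤ x → 0# ≤ y → 0# ≤ x * y

  open IsDecTotalOrder isDecTotalOrder public
    using (_≤?_; total; antisym)
    renaming (_≟_ to _≈?_; refl to ≤-refl; trans to ≤-trans; reflexive to ≤-reflexive)

  open NonStrictToStrict _≈_ _≤_ public using (_<_)

  IsUpperBound : (ℝ → Set) → ℝ → Set
  IsUpperBound S b = ∀ {x} → S x → x ≤ b

  IsSupremum : (ℝ → Set) → ℝ → Set
  IsSupremum S s = IsUpperBound S s × (∀ {b} → IsUpperBound S b → s ≤ b)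

  field
    supremum    : ∀ (S : ℝ → Set) → ∃ S → ∃ (IsUpperBound S) → ∃ (IsSupremum S)
    -- Classically a consequence of the other axioms, but the witness cannot be
    -- extracted constructively.
    archimedean : ∀ x → ∃[ n ] x ≤ fromℕ n

------------------------------------------------------------------------
-- Real analysis

module Real (𝓡 : RealNumbers) where
  open RealNumbers 𝓡 public

  open import Algebra.Definitions.RawSemiring (Semiring.rawSemiring semiring) public
    using (sum; _^_)
  private
    module Mult where
      open import Algebra.Properties.Semiring.Mult semiring public
    module RP where
      open import Algebra.Properties.Ring ring public
    module AG where
      open import Algebra.Properties.Group +-group public
  open import Relation.Binary.Reasoning.Setoid setoid

  -- Inverses and quotients are total, with the junk value 0⁻¹ = 0.
  infix 9 _⁻¹
  infixl 7 _/_

  _⁻¹ : Op₁ ℝ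
  x ⁻¹ with x ≈? 0#
  ... | yes _   = 0#
  ... | no  x≉0 = proj₁ (inverse x x≉0)

  _/_ : Op₂ ℝ
  x / y = x * y ⁻¹

  ⁻¹-inverse : ∀ {x} → ¬ x ≈ 0# → x * x ⁻¹ ≈ 1#
  ⁻¹-inverse {x} x≉0 with x ≈? 0#
  ... | yes x≈0 = ⊥-elim (x≉0 x≈0)
  ... | no  x≉0′ = proj₂ (inverse x x≉0′)

  neg-nonneg : ∀ {x} → x ≤ 0# → 0# ≤ - x
  neg-nonneg {x} x≤0 = ≤-trans (≤-reflexive (sym (-‿inverseˡ x)))
    (≤-trans (+-monoʳ-≤ (- x) x≤0) (≤-reflexive (+-identityʳ (- x))))

  ≰⇒≥ : ∀ {x y} → ¬ x ≤ y → y ≤ x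
  ≰⇒≥ {x} {y} x≰y with total x y
  ... | inj₁ x≤y = ⊥-elim (x≰y x≤y)
  ... | inj₂ y≤x = y≤x

  0≤1 : 0# ≤ 1#
  0≤1 with total 0# 1#
  ... | inj₁ 0≤1 = 0≤1
  ... | inj₂ 1≤0 = ≤-trans (*-nonneg (neg-nonneg 1≤0) (neg-nonneg 1≤0))
    (≤-reflexive (trans (RP.-1*x≈-x (- 1#)) (AG.⁻¹-involutive 1#)))

  +-nonneg : ∀ {x y} → 0# ≤ x → 0# ≤ y → 0# ≤ x + y
  +-nonneg {x} 0≤x 0≤y = ≤-trans 0≤x
    (≤-trans (≤-reflexive (sym (+-identityʳ x))) (+-monoʳ-≤ x 0≤y))

  +-monoˡ-≤ : ∀ z {x y} → x ≤ y → x + z ≤ y + z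
  +-monoˡ-≤ z {x} {y} x≤y = ≤-trans (≤-reflexive (+-comm x z))
    (≤-trans (+-monoʳ-≤ z x≤y) (≤-reflexive (+-comm z y)))

  +-mono-≤ : ∀ {x y u v} → x ≤ y → u ≤ v → x + u ≤ y + v
  +-mono-≤ {y = y} {u} x≤y u≤v = ≤-trans (+-monoˡ-≤ u x≤y) (+-monoʳ-≤ y u≤v)

  *-monoʳ-≤ : ∀ {z x y} → 0# ≤ z → x ≤ y → z * x ≤ z * y
  *-monoʳ-≤ {z} {x} {y} 0≤z x≤y =
    ≤-trans (≤-reflexive (sym (+-identityʳ (z * x))))
      (≤-trans (+-monoʳ-≤ (z * x) (*-nonneg 0≤z 0≤y-x)) (≤-reflexive eq))
    where
    0≤y-x : 0# ≤ - x + y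
    0≤y-x = ≤-trans (≤-reflexive (sym (-‿inverseˡ x))) (+-monoʳ-≤ (- x) x≤y)
    eq : z * x + z * (- x + y) ≈ z * y
    eq = begin
      z * x + z * (- x + y)   ≈⟨ distribˡ z x (- x + y) ⟨
      z * (x + (- x + y))     ≈⟨ *-congˡ (+-assoc x (- x) y) ⟨
      z * (x + - x + y)       ≈⟨ *-congˡ (+-congʳ (-‿inverseʳ x)) ⟩
      z * (0# + y)            ≈⟨ *-congˡ (+-identityˡ y) ⟩
      z * y                   ∎

  *-monoˡ-≤ : ∀ {z x y} → 0# ≤ z → x ≤ y → x * z ≤ y * z
  *-monoˡ-≤ {z} {x} {y} 0≤z x≤y = ≤-trans (≤-reflexive (*-comm x z))
    (≤-trans (*-monoʳ-≤ 0≤z x≤y) (≤-reflexive (*-comm z y)))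

  ⁻¹-nonneg : ∀ {x} → 0# ≤ x → ¬ x ≈ 0# → 0# ≤ x ⁻¹
  ⁻¹-nonneg {x} 0≤x x≉0 with total 0# (x ⁻¹)
  ... | inj₁ 0≤x⁻¹ = 0≤x⁻¹
  ... | inj₂ x⁻¹≤0 = ⊥-elim (1≉0 (antisym 1≤0 0≤1))
    where
    1≤0 : 1# ≤ 0#
    1≤0 = ≤-trans (≤-reflexive (sym (⁻¹-inverse x≉0)))
      (≤-trans (*-monoʳ-≤ 0≤x x⁻¹≤0) (≤-reflexive (zeroʳ x)))

  fromℕ-nonneg : ∀ n → 0# ≤ fromℕ n
  fromℕ-nonneg zero    = ≤-refl
  fromℕ-nonneg (suc n) = +-nonneg 0≤1 (fromℕ-nonneg n)

  fromℕ-mono : ∀ {m n} → m ℕ.≤ n → fromℕ m ≤ fromℕ n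
  fromℕ-mono {n = n} ℕ.z≤n = fromℕ-nonneg n
  fromℕ-mono (ℕ.s≤s m≤n)   = +-monoʳ-≤ 1# (fromℕ-mono m≤n)

  fromℕ≉0 : ∀ n → 1 ℕ.≤ n → ¬ fromℕ n ≈ 0#
  fromℕ≉0 (suc n) _ n≈0 = 1≉0 (antisym 1≤0 0≤1)
    where
    1≤0 : 1# ≤ 0#
    1≤0 = ≤-trans (≤-reflexive (sym (+-identityʳ 1#)))
      (≤-trans (+-monoʳ-≤ 1# (fromℕ-nonneg n)) (≤-reflexive n≈0))

  ^-nonneg : ∀ {x} n → 0# ≤ x → 0# ≤ x ^ n
  ^-nonneg zero    0≤x = 0≤1
  ^-nonneg (suc n) 0≤x = *-nonneg 0≤x (^-nonneg n 0≤x)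

  ----------------------------------------------------------------------
  -- The exponential function

  expTerm : ℝ → ℕ → ℝ
  expTerm x k = x ^ k / fromℕ (k !)

  expPartialSum : ℝ → ℕ → ℝ
  expPartialSum x n = sum {n} (expTerm x ∘ toℕ)

  IsExpPartialSum : ℝ → ℝ → Set
  IsExpPartialSum x y = ∃[ n ] y ≈ expPartialSum x n

  ∑< : ℕ → (ℕ → ℝ) → ℝ
  ∑< n f = sum {n} (f ∘ toℕ)

  halving-bound : ∀ f → (∀ k → 0# ≤ f k) → (∀ k → f (suc k) + f (suc k) ≤ f k) →
                  ∀ n → ∑< n f ≤ f 0 + f 0
  halving-bound f 0≤f halve zero    = +-nonneg (0≤f 0) (0≤f 0)
  halving-bound f 0≤f halve (suc n) = +-monoʳ-≤ (f 0)
    (≤-trans (halving-bound (f ∘ suc) (0≤f ∘ suc) (halve ∘ suc) n) (halve 0))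

  eventually-halving-bound : ∀ N f → (∀ k → 0# ≤ f k) →
    (∀ k → N ℕ.≤ k → f (suc k) + f (suc k) ≤ f k) →
    ∃[ b ] (∀ n → ∑< n f ≤ b)
  eventually-halving-bound zero f 0≤f halve =
    f 0 + f 0 , halving-bound f 0≤f (λ k → halve k ℕ.z≤n)
  eventually-halving-bound (suc N) f 0≤f halve
    with b , bound ← eventually-halving-bound N (f ∘ suc) (0≤f ∘ suc)
                       (λ k N≤k → halve (suc k) (ℕ.s≤s N≤k))
    = f 0 + b , λ where
        zero    → +-nonneg (0≤f 0) (bound 0)
        (suc n) → +-monoʳ-≤ (f 0) (bound n)

  factorial≉0 : ∀ k → ¬ fromℕ (k !) ≈ 0#
  factorial≉0 k = fromℕ≉0 (k !) (ℕₚ.1≤n! k)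

  factorial⁻¹-nonneg : ∀ k → 0# ≤ fromℕ (k !) ⁻¹
  factorial⁻¹-nonneg k = ⁻¹-nonneg (fromℕ-nonneg (k !)) (factorial≉0 k)

  expTerm-nonneg : ∀ {x} → 0# ≤ x → ∀ k → 0# ≤ expTerm x k
  expTerm-nonneg 0≤x k = *-nonneg (^-nonneg k 0≤x) (factorial⁻¹-nonneg k)

  factorial⁻¹-suc : ∀ k → fromℕ (k !) ⁻¹ ≈ fromℕ (suc k) * fromℕ (suc k !) ⁻¹
  factorial⁻¹-suc k = begin
    A                   ≈⟨ *-identityʳ A ⟨
    A * 1#              ≈⟨ *-congˡ (⁻¹-inverse (factorial≉0 (suc k))) ⟨
    A * (F′ * A′)       ≈⟨ *-congˡ (*-congʳ (Mult.×1-homo-* (suc k) (k !))) ⟩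
    A * ((S * F) * A′)  ≈⟨ *-congˡ (*-congʳ (*-comm S F)) ⟩
    A * ((F * S) * A′)  ≈⟨ *-congˡ (*-assoc F S A′) ⟩
    A * (F * (S * A′))  ≈⟨ *-assoc A F (S * A′) ⟨
    (A * F) * (S * A′)  ≈⟨ *-congʳ (*-comm A F) ⟩
    (F * A) * (S * A′)  ≈⟨ *-congʳ (⁻¹-inverse (factorial≉0 k)) ⟩
    1# * (S * A′)       ≈⟨ *-identityˡ (S * A′) ⟩
    S * A′              ∎
    where
    S = fromℕ (suc k)
    F = fromℕ (k !)
    F′ = fromℕ (suc k !)
    A = F ⁻¹
    A′ = F′ ⁻¹

  expTerm-halving : ∀ {x} → 0# ≤ x → ∀ k → x + x ≤ fromℕ (suc k) →
                    expTerm x (suc k) + expTerm x (suc k) ≤ expTerm x k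
  expTerm-halving {x} 0≤x k 2x≤k+1 = ≤-trans (≤-reflexive eq)
    (≤-trans (*-monoʳ-≤ (^-nonneg k 0≤x)
               (*-monoˡ-≤ (factorial⁻¹-nonneg (suc k)) 2x≤k+1))
      (≤-reflexive (*-congˡ (sym (factorial⁻¹-suc k)))))
    where
    A′ = fromℕ (suc k !) ⁻¹
    eq : (x * x ^ k) * A′ + (x * x ^ k) * A′ ≈ x ^ k * ((x + x) * A′)
    eq = begin
      (x * x ^ k) * A′ + (x * x ^ k) * A′  ≈⟨ distribʳ A′ (x * x ^ k) (x * x ^ k) ⟨
      (x * x ^ k + x * x ^ k) * A′         ≈⟨ *-congʳ (distribʳ (x ^ k) x x) ⟨
      ((x + x) * x ^ k) * A′               ≈⟨ *-congʳ (*-comm (x + x) (x ^ k)) ⟩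
      (x ^ k * (x + x)) * A′               ≈⟨ *-assoc (x ^ k) (x + x) A′ ⟩
      x ^ k * ((x + x) * A′)               ∎

  expPartialSum-bounded : ∀ {x} → 0# ≤ x → ∃ (IsUpperBound (IsExpPartialSum x))
  expPartialSum-bounded {x} 0≤x
    with N , 2x≤N ← archimedean (x + x)
    with b , bound ← eventually-halving-bound N (expTerm x) (expTerm-nonneg 0≤x)
           (λ k N≤k → expTerm-halving 0≤x k
             (≤-trans 2x≤N (fromℕ-mono (ℕₚ.m≤n⇒m≤1+n N≤k))))
    = b , λ (n , y≈Sn) → ≤-trans (≤-reflexive y≈Sn) (bound n)

  -- For x ≥ 0 the partial sums increase, so their supremum is the sum ∑ xᵏ/k!.
  expNonneg : ∀ x → 0# ≤ x → ∃ (IsSupremum (IsExpPartialSum x))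
  expNonneg x 0≤x = supremum (IsExpPartialSum x) (_ , 0 , refl) (expPartialSum-bounded 0≤x)

  exp : ℝ → ℝ
  exp x with 0# ≤? x
  ... | yes 0≤x = proj₁ (expNonneg x 0≤x)
  ... | no  0≰x = proj₁ (expNonneg (- x) (neg-nonneg (≰⇒≥ 0≰x))) ⁻¹

  ----------------------------------------------------------------------
  -- Natural logarithm and real powers

  ≤-expNonneg : ∀ {x} (0≤x : 0# ≤ x) → x ≤ proj₁ (expNonneg x 0≤x)
  ≤-expNonneg {x} 0≤x = ≤-trans x≤S₂ (proj₁ (proj₂ (expNonneg x 0≤x)) (2 , refl))
    where
    1⁻¹≈1 : fromℕ (1 !) ⁻¹ ≈ 1#
    1⁻¹≈1 = trans (sym (*-identityˡ _))
      (trans (*-congʳ (sym (+-identityʳ 1#))) (⁻¹-inverse (factorial≉0 1)))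
    x≈a₁ : x ≈ expTerm x 1
    x≈a₁ = trans (sym (*-identityʳ x))
      (*-cong (sym (*-identityʳ x)) (sym 1⁻¹≈1))
    x≤S₂ : x ≤ expPartialSum x 2
    x≤S₂ = ≤-trans (≤-reflexive (trans x≈a₁
        (trans (sym (+-identityʳ _)) (sym (+-identityˡ _)))))
      (+-monoˡ-≤ (expTerm x 1 + 0#) (expTerm-nonneg 0≤x 0))

  BelowLog : ℝ → ℝ → Set
  BelowLog x y = exp y ≤ x

  BelowLog-bounded : ∀ {x} → 0# ≤ x → IsUpperBound (BelowLog x) x
  BelowLog-bounded 0≤x {y} expy≤x with 0# ≤? y
  ... | yes 0≤y = ≤-trans (≤-expNonneg 0≤y) expy≤x
  ... | no  0≰y = ≤-trans (≰⇒≥ 0≰y) 0≤x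

  BelowLog-nonempty : ∀ {x} → 0# < x → BelowLog x (- x ⁻¹)
  BelowLog-nonempty {x} (0≤x , 0≉x) with 0# ≤? (- x ⁻¹)
  ... | yes 0≤-x⁻¹ = ⊥-elim (1≉0 (antisym 1≤0 0≤1))
    where
    0≤-1 : 0# ≤ - 1#
    0≤-1 = ≤-trans (*-nonneg 0≤x 0≤-x⁻¹) (≤-reflexive
      (trans (sym (RP.-‿distribʳ-* x (x ⁻¹))) (-‿cong (⁻¹-inverse (0≉x ∘ sym)))))
    1≤0 : 1# ≤ 0#
    1≤0 = ≤-trans (≤-reflexive (sym (+-identityʳ 1#)))
      (≤-trans (+-monoʳ-≤ 1# 0≤-1) (≤-reflexive (-‿inverseʳ 1#)))
  ... | no  0≰-x⁻¹ = E⁻¹≤x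
    where
    x≉0 = 0≉x ∘ sym
    0≤y = neg-nonneg (≰⇒≥ 0≰-x⁻¹)
    E = proj₁ (expNonneg (- (- x ⁻¹)) 0≤y)
    x⁻¹≤E : x ⁻¹ ≤ E
    x⁻¹≤E = ≤-trans (≤-reflexive (sym (AG.⁻¹-involutive (x ⁻¹)))) (≤-expNonneg 0≤y)
    1≤xE : 1# ≤ x * E
    1≤xE = ≤-trans (≤-reflexive (sym (⁻¹-inverse x≉0))) (*-monoʳ-≤ 0≤x x⁻¹≤E)
    E≉0 : ¬ E ≈ 0#
    E≉0 E≈0 = 1≉0 (antisym
      (≤-trans 1≤xE (≤-reflexive (trans (*-congˡ E≈0) (zeroʳ x)))) 0≤1)
    0≤E = ≤-trans (⁻¹-nonneg 0≤x x≉0) x⁻¹≤E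
    E⁻¹≤x : E ⁻¹ ≤ x
    E⁻¹≤x = ≤-trans (≤-reflexive (sym (*-identityˡ (E ⁻¹))))
      (≤-trans (*-monoˡ-≤ (⁻¹-nonneg 0≤E E≉0) 1≤xE) (≤-reflexive
        (trans (*-assoc x E (E ⁻¹)) (trans (*-congˡ (⁻¹-inverse E≉0)) (*-identityʳ x)))))

  0<?_ : ∀ x → Dec (0# < x)
  0<? x = (0# ≤? x) ×-dec ¬? (0# ≈? x)

  -- log x = sup { y : exp y ≤ x } for x > 0; junk value 0 otherwise.
  log : ℝ → ℝ
  log x with 0<? x
  ... | yes 0<x = proj₁ (supremum (BelowLog x) (_ , BelowLog-nonempty 0<x)
                                  (x , BelowLog-bounded (proj₁ 0<x)))
  ... | no  _   = 0#

  -- Real powers of a nonnegative base, with 0 ^ʳ a = 0 (used only for a > 0).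
  infixr 8 _^ʳ_

  _^ʳ_ : ℝ → ℝ → ℝ
  x ^ʳ a with 0<? x
  ... | yes _ = exp (a * log x)
  ... | no  _ = 0#

  ----------------------------------------------------------------------
  -- Real Hilbert spaces

  record HilbertSpace : Set₁ where
    field
      vectorSpace : LeftModule ring 0ℓ 0ℓ

    open LeftModule vectorSpace public

    field
      ⟨_,_⟩          : Carrierᴹ → Carrierᴹ → ℝ
      ⟨⟩-cong        : ∀ {u u′ v v′} → u ≈ᴹ u′ → v ≈ᴹ v′ → ⟨ u , v ⟩ ≈ ⟨ u′ , v′ ⟩
      ⟨⟩-sym         : ∀ u v → ⟨ u , v ⟩ ≈ ⟨ v , u ⟩
      ⟨⟩-additive    : ∀ u v w → ⟨ u +ᴹ v , w ⟩ ≈ ⟨ u , w ⟩ + ⟨ v , w ⟩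
      ⟨⟩-homogeneous : ∀ a u v → ⟨ a *ₗ u , v ⟩ ≈ a * ⟨ u , v ⟩
      ⟨⟩-nonneg      : ∀ u → 0# ≤ ⟨ u , u ⟩
      ⟨⟩-definite    : ∀ u → ⟨ u , u ⟩ ≈ 0# → u ≈ᴹ 0ᴹ

    -- Squared distances give the same Cauchy and convergent sequences as distances.
    dist² : Carrierᴹ → Carrierᴹ → ℝ
    dist² u v = ⟨ u +ᴹ -ᴹ v , u +ᴹ -ᴹ v ⟩

    IsCauchy : (ℕ → Carrierᴹ) → Set
    IsCauchy s = ∀ ε → 0# < ε → ∃[ N ] ∀ m n → N ℕ.≤ m → N ℕ.≤ n → dist² (s m) (s n) < ε

    ConvergesTo : (ℕ → Carrierᴹ) → Carrierᴹ → Set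
    ConvergesTo s v = ∀ ε → 0# < ε → ∃[ N ] ∀ n → N ℕ.≤ n → dist² (s n) v < ε

    field
      complete : ∀ s → IsCauchy s → ∃ (ConvergesTo s)

  ----------------------------------------------------------------------
  -- Finitely supported random variables

  -- The law of a random variable with values in Fin k.
  record Distribution (k : ℕ) : Set where
    field
      mass        : Fin k → ℝ
      mass-nonneg : ∀ u → 0# ≤ mass u
      mass-total  : sum mass ≈ 1#

  -- ℙ[ μ ] E? is the probability of E U U′ for independent U and U′ with law μ.
  ℙ[_] : ∀ {k} → Distribution k → {E : Fin k → Fin k → Set} →
         (∀ u u′ → Dec (E u u′)) → ℝ
  ℙ[ μ ] E? = sum λ u → sum λ u′ → if does (E? u u′) then mass u * mass u′ else 0#
    where open Distribution μ

  module _ {r k : ℕ} (Z : Fin r → Fin k → Fin k → ℝ) (i : Fin r) (ℓ : ℝ) where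

    GoodEvent : Fin k → Fin k → Set
    GoodEvent u u′ = ℓ ≤ Z i u u′ × (∀ j → j ≢ i → - 1# ≤ Z j u u′)

    goodEvent? : ∀ u u′ → Dec (GoodEvent u u′)
    goodEvent? u u′ =
      (ℓ ≤? Z i u u′) ×-dec all? λ j → ¬? (j ≟ i) →-dec (- 1# ≤? Z j u u′)

  𝒢 : (r d : ℕ) (β C : ℝ) → Set₁
  𝒢 r d β C =
    ∀ (k : ℕ) (μ : Distribution k) (H : Fin r → HilbertSpace)
      (σ : ∀ i → Fin k → HilbertSpace.Carrierᴹ (H i)) →
    let Z : Fin r → Fin k → Fin k → ℝ
        Z i u u′ = HilbertSpace.⟨_,_⟩ (H i) (σ i u) (σ i u′)
    in Σ[ i ∈ Fin r ] Σ[ ℓ ∈ ℝ ]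
       - 1# ≤ ℓ ×
       β * exp (- (C * (ℓ + 1#) ^ʳ (1# / fromℕ d))) ≤ ℙ[ μ ] (goodEvent? Z i ℓ)

------------------------------------------------------------------------
-- Edge-coloured complete graphs

-- An r-edge-colouring of the complete graph on Fin n. The values on the
-- diagonal are irrelevant: every notion below ignores them.
record EdgeColouring (r n : ℕ) : Set where
  field
    colour     : Fin n → Fin n → Fin r
    colour-sym : ∀ u v → colour u v ≡ colour v u

module _ {r n : ℕ} (G : EdgeColouring r n) where
  open EdgeColouring G

  neighbourhood : Fin r → Fin n → Subset n
  neighbourhood i v = tabulate λ w → does (¬? (v ≟ w) ×-dec (colour v w ≟ i))

  AllEdgesColoured : Fin r → Subset n → Subset n → Set
  AllEdgesColoured i S S′ = ∀ {u v} → u ∈ S → v ∈ S′ → u ≢ v → colour u v ≡ i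

  IsClique : Fin r → Subset n → Set
  IsClique i T = AllEdgesColoured i T T

  IsBook : Fin r → Subset n → Subset n → Set
  IsBook i T P = Empty (T ∩ P) × IsClique i T × AllEdgesColoured i T P

  IsSizedBook : Fin r → ℕ → ℕ → Subset n → Subset n → Set
  IsSizedBook i t m T P = IsBook i T P × ∣ T ∣ ≡ t × m ℕ.≤ ∣ P ∣

{-# OPTIONS --safe #-}

-- Greedy book algorithm. Keep X, the reservoirs Y_i and cliques T_i ⊆ X₀ of colour i completely joined
-- to X and to Y_i. Put p_i for the density of colour i between X and Y_i and α_i = (p_i - p + δ)/t.
-- Applying 𝒢 to U uniform on X and to the scaled vectors 1_{N_i(x) ∩ Y_i} - p_i 1_{Y_i} yields a vertex x,
-- a colour ℓ, a real λ ≥ -1 and a large X′ ⊆ X such that passing from Y_i to N_i(x) ∩ Y_i changes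
-- p_ℓ by at least λ α_ℓ and any other p_i by at least -α_i. If λ ≤ λ₀, add x to the T_j of its most
-- popular colour j in X′; otherwise replace Y_ℓ by N_ℓ(x) ∩ Y_ℓ, which multiplies p_ℓ - p + δ by
-- 1 + λ/t. Since p_ℓ ≤ 1, the logarithms of these factors sum to at most 2L in each colour, and the losses
-- in X and in Y_i are charged to this sum and to |T_i|. X therefore stays nonempty until some |T_i| = t.

module Submission where

open import Defs
import Algebra.Construct.Pointwise as Pointwise
open import Algebra.Module.Bundles using (LeftModule)
import Algebra.Properties.Ring
import Algebra.Properties.Semiring.Mult
import Algebra.Properties.Semiring.Sum
import Algebra.Solver.Ring
open import Algebra.Solver.Ring.AlmostCommutativeRing using (fromCommutativeRing; _-Raw-AlmostCommutative⟶_)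
open import Data.Bool.Base using (true; false; if_then_else_; _∧_)
open import Data.Empty using (⊥-elim)
open import Data.Fin using (Fin; zero; suc; toℕ)
open import Data.Fin.Properties using (any?; _≟_)
open import Data.Fin.Subset using (Subset; Nonempty; inside; outside; ⊥; ⁅_⁆; _∈_; _∉_; _⊆_; _∩_; _∪_; _─_; ∣_∣)
import Data.Fin.Subset.Properties as Sub
open import Data.Integer.Base as ℤ using (ℤ; +_; -[1+_])
import Data.Integer.Properties as ℤₚ
open import Data.Maybe.Base using (Maybe; just; nothing)
open import Data.Nat as ℕ using (ℕ; zero; suc; _∸_; _!)
import Data.Nat.Properties as ℕₚ
open import Data.Product using (_×_; _,_; proj₁; proj₂; Σ-syntax; ∃-syntax)
open import Data.Sign.Base as Sign using (Sign)
open import Data.Sum using (_⊎_; inj₁; inj₂)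
open import Data.Vec.Base using ([]; _∷_; here; there; lookup; tabulate)
open import Data.Vec.Functional using (updateAt)
open import Data.Vec.Functional.Properties using (updateAt-updates; updateAt-minimal)
import Data.Vec.Properties as Vecₚ
open import Function using (_∘_; case_of_)
open import Relation.Binary.Bundles using (Poset)
open import Relation.Binary.PropositionalEquality as ≡ using (_≡_; _≢_)
import Relation.Binary.Reasoning.PartialOrder
open import Relation.Binary.Structures using (IsDecTotalOrder)
open import Relation.Nullary using (¬_; Dec; yes; no; does; ¬?; _×-dec_)

-- Taking α_i proportional to the excess of p_i over p - δ makes all changes of that excess
-- multiplicative. Losses cost a factor 1 - 1/t each, and fewer than t of them cost at most a factor
-- e, which is why the gains are limited to 1/δ up to a constant. The threshold λ₀ separates two
-- ways of paying for the shrinking of X. A step with λ ≤ λ₀ adds a vertex, which happens at most rt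
-- times. A step with larger λ is paid for by log(1 + λ/t), so (λ + 1)^(1/d) must be at most a
-- constant times t log(1 + λ/t) / λ₀^((d-1)/d). For λ ≤ t this follows from log(1 + λ/t) ≥ λ/(2t).
-- For λ > t the logarithm is only bounded below by a constant, but a density is at most 1, so λ is
-- at most a constant times t/δ, and the assumption on t absorbs δ^(-1/d). True densities are not
-- tracked. The state keeps |T_i| and the total gain B_i, and lower bounds for the density and for
-- |Y_i| are functions of these two, hence survive every passage to a smaller X.

-- Ordered field arithmetic and a ring solver with integer coefficients.

module OrderedField (𝓡 : RealNumbers) where
  open Real 𝓡 hiding (zero)

  private
    module Mult = Algebra.Properties.Semiring.Mult semiring
    module RP = Algebra.Properties.Ring ring

  ≤-poset : Poset _ _ _
  ≤-poset = record { isPartialOrder = IsDecTotalOrder.isPartialOrder isDecTotalOrder }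

  module ≤-Reasoning = Relation.Binary.Reasoning.PartialOrder ≤-poset

  -- Integer coefficients give the ring solver an equality test that computes; equality of reals is
  -- decidable only by axiom.
  fromℤ : ℤ → ℝ
  fromℤ (+ n)    = fromℕ n
  fromℤ -[1+ n ] = - fromℕ (suc n)

  fromℕ-+ : ∀ m n → fromℕ (m ℕ.+ n) ≈ fromℕ m + fromℕ n
  fromℕ-+ m n = Mult.×-homo-+ 1# m n

  fromℕ-* : ∀ m n → fromℕ (m ℕ.* n) ≈ fromℕ m * fromℕ n
  fromℕ-* = Mult.×1-homo-*

  private
    -0≈0 : - 0# ≈ 0#
    -0≈0 = RP.-0#≈0#

    x≈x-0 : ∀ x → x ≈ x + - 0#
    x≈x-0 x = sym (trans (+-congˡ -0≈0) (+-identityʳ x))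

    fromℤ-⊖ : ∀ m n → fromℤ (m ℤ.⊖ n) ≈ fromℕ m + - fromℕ n
    fromℤ-⊖ m zero = x≈x-0 (fromℕ m)
    fromℤ-⊖ zero (suc n) = sym (+-identityˡ _)
    fromℤ-⊖ (suc m) (suc n) rewrite ℤₚ.[1+m]⊖[1+n]≡m⊖n m n = trans (fromℤ-⊖ m n) (sym eq)
      where
      open import Relation.Binary.Reasoning.Setoid setoid
      M = fromℕ m
      N = fromℕ n
      eq : (1# + M) + - (1# + N) ≈ M + - N
      eq = begin
        (1# + M) + - (1# + N)      ≈⟨ +-cong (+-comm 1# M) (sym (RP.-‿+-comm 1# N)) ⟩
        (M + 1#) + (- 1# + - N)    ≈⟨ +-assoc M 1# _ ⟩
        M + (1# + (- 1# + - N))    ≈⟨ +-congˡ (+-assoc 1# (- 1#) (- N)) ⟨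
        M + ((1# + - 1#) + - N)    ≈⟨ +-congˡ (+-congʳ (-‿inverseʳ 1#)) ⟩
        M + (0# + - N)             ≈⟨ +-congˡ (+-identityˡ (- N)) ⟩
        M + - N                    ∎

    fromℤ-neg : ∀ i → fromℤ (ℤ.- i) ≈ - fromℤ i
    fromℤ-neg (+ zero) = sym -0≈0
    fromℤ-neg (+ suc n) = refl
    fromℤ-neg -[1+ n ] = sym (RP.-‿involutive _)

    fromℤ-+ : ∀ i j → fromℤ (i ℤ.+ j) ≈ fromℤ i + fromℤ j
    fromℤ-+ (+ m) (+ n) = fromℕ-+ m n
    fromℤ-+ (+ m) -[1+ n ] = fromℤ-⊖ m (suc n)
    fromℤ-+ -[1+ m ] (+ n) = trans (fromℤ-⊖ n (suc m)) (+-comm _ _)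
    fromℤ-+ -[1+ m ] -[1+ n ] =
      trans (-‿cong (trans (reflexive (≡.cong fromℕ (≡.cong suc (≡.sym (ℕₚ.+-suc m n))))) (fromℕ-+ (suc m) (suc n))))
      (sym (RP.-‿+-comm _ _))

    fromℤ--◃ : ∀ n → fromℤ (Sign.- ℤ.◃ n) ≈ - fromℕ n
    fromℤ--◃ zero = sym -0≈0
    fromℤ--◃ (suc n) = refl

    fromℤ-+◃ : ∀ n → fromℤ (Sign.+ ℤ.◃ n) ≈ fromℕ n
    fromℤ-+◃ zero = refl
    fromℤ-+◃ (suc n) = refl

    fromℤ-* : ∀ i j → fromℤ (i ℤ.* j) ≈ fromℤ i * fromℤ j
    fromℤ-* (+ m) (+ n) = trans (fromℤ-+◃ (m ℕ.* n)) (fromℕ-* m n)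
    fromℤ-* (+ m) -[1+ n ] = trans (fromℤ--◃ (m ℕ.* suc n))
      (trans (-‿cong (fromℕ-* m (suc n))) (RP.-‿distribʳ-* _ _))
    fromℤ-* -[1+ m ] (+ n) = trans (fromℤ--◃ (suc m ℕ.* n))
      (trans (-‿cong (fromℕ-* (suc m) n)) (RP.-‿distribˡ-* _ _))
    fromℤ-* -[1+ m ] -[1+ n ] = trans (fromℤ-+◃ (suc m ℕ.* suc n))
      (trans (fromℕ-* (suc m) (suc n)) (sym (trans (sym (RP.-‿distribˡ-* _ _))
        (trans (-‿cong (sym (RP.-‿distribʳ-* _ _))) (RP.-‿involutive _)))))

    -- The solver's constant 1 has to denote 1# itself, not fromℕ 1 = 1# + 0#.
    ⟦_⟧ᶻ : ℤ → ℝ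
    ⟦ + 1 ⟧ᶻ = 1#
    ⟦ i   ⟧ᶻ = fromℤ i

    ⟦⟧ᶻ≈fromℤ : ∀ i → ⟦ i ⟧ᶻ ≈ fromℤ i
    ⟦⟧ᶻ≈fromℤ (+ zero) = refl
    ⟦⟧ᶻ≈fromℤ (+ suc zero) = sym (+-identityʳ 1#)
    ⟦⟧ᶻ≈fromℤ (+ suc (suc n)) = refl
    ⟦⟧ᶻ≈fromℤ -[1+ n ] = refl

    ℤ-morphism : ℤ.+-*-rawRing -Raw-AlmostCommutative⟶ fromCommutativeRing commutativeRing
    ℤ-morphism = record
      { ⟦_⟧    = ⟦_⟧ᶻ
      ; +-homo = λ i j → trans (⟦⟧ᶻ≈fromℤ (i ℤ.+ j)) (trans (fromℤ-+ i j)
                   (sym (+-cong (⟦⟧ᶻ≈fromℤ i) (⟦⟧ᶻ≈fromℤ j))))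
      ; *-homo = λ i j → trans (⟦⟧ᶻ≈fromℤ (i ℤ.* j)) (trans (fromℤ-* i j)
                   (sym (*-cong (⟦⟧ᶻ≈fromℤ i) (⟦⟧ᶻ≈fromℤ j))))
      ; -‿homo = λ i → trans (⟦⟧ᶻ≈fromℤ (ℤ.- i)) (trans (fromℤ-neg i)
                   (sym (-‿cong (⟦⟧ᶻ≈fromℤ i))))
      ; 0-homo = refl
      ; 1-homo = refl
      }

    ⟦⟧ᶻ-≟ : ∀ i j → Maybe (⟦ i ⟧ᶻ ≈ ⟦ j ⟧ᶻ)
    ⟦⟧ᶻ-≟ i j with i ℤₚ.≟ j
    ... | yes i≡j = just (reflexive (≡.cong ⟦_⟧ᶻ i≡j))
    ... | no  _   = nothing

  open Algebra.Solver.Ring ℤ.+-*-rawRing (fromCommutativeRing commutativeRing) ℤ-morphism ⟦⟧ᶻ-≟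
    public using (solve; _:=_; _:+_; _:*_; _:-_; :-_; con)

  2# 3# 4# 6# : ℝ
  2# = fromℕ 2
  3# = fromℕ 3
  4# = fromℕ 4
  6# = fromℕ 6

  abstract
    ≤-from-diff : ∀ {x y z} → 0# ≤ z → y ≈ x + z → x ≤ y
    ≤-from-diff {x} 0≤z y≈x+z = ≤-trans (≤-reflexive (sym (+-identityʳ x)))
      (≤-trans (+-monoʳ-≤ x 0≤z) (≤-reflexive (sym y≈x+z)))

    diff-nonneg : ∀ {x y} → x ≤ y → 0# ≤ y - x
    diff-nonneg {x} {y} x≤y = ≤-trans (≤-reflexive (sym (-‿inverseʳ x))) (+-monoˡ-≤ (- x) x≤y)

    -‿antimono-≤ : ∀ {x y} → x ≤ y → - y ≤ - x
    -‿antimono-≤ {x} {y} x≤y = ≤-from-diff (diff-nonneg x≤y)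
      (solve 2 (λ x y → :- x := :- y :+ (y :- x)) refl x y)

    ≤-resp : ∀ {x x′ y y′} → x ≈ x′ → y ≈ y′ → x ≤ y → x′ ≤ y′
    ≤-resp x≈x′ y≈y′ x≤y = ≤-trans (≤-reflexive (sym x≈x′)) (≤-trans x≤y (≤-reflexive y≈y′))

    square-nonneg : ∀ x → 0# ≤ x * x
    square-nonneg x with total 0# x
    ... | inj₁ 0≤x = *-nonneg 0≤x 0≤x
    ... | inj₂ x≤0 = ≤-resp refl (solve 1 (λ x → :- x :* :- x := x :* x) refl x)
      (*-nonneg (neg-nonneg x≤0) (neg-nonneg x≤0))

    ≰⇒> : ∀ {x y} → ¬ x ≤ y → y < x
    ≰⇒> x≰y = ≰⇒≥ x≰y , λ y≈x → x≰y (≤-reflexive (sym y≈x))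

    <⇒≱ : ∀ {x y} → x < y → ¬ y ≤ x
    <⇒≱ (x≤y , x≉y) y≤x = x≉y (antisym x≤y y≤x)

    ≤-<-trans : ∀ {x y z} → x ≤ y → y < z → x < z
    ≤-<-trans x≤y y<z = ≰⇒> λ z≤x → <⇒≱ y<z (≤-trans z≤x x≤y)

    <-≤-trans : ∀ {x y z} → x < y → y ≤ z → x < z
    <-≤-trans x<y y≤z = ≰⇒> λ z≤x → <⇒≱ x<y (≤-trans y≤z z≤x)

    0<1 : 0# < 1#
    0<1 = 0≤1 , λ 0≈1 → 1≉0 (sym 0≈1)

    pos≉0 : ∀ {x} → 0# < x → ¬ x ≈ 0#
    pos≉0 (_ , 0≉x) x≈0 = 0≉x (sym x≈0)

    *-⁻¹ : ∀ {x} → 0# < x → x * x ⁻¹ ≈ 1#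
    *-⁻¹ 0<x = ⁻¹-inverse (pos≉0 0<x)

    ⁻¹-pos : ∀ {x} → 0# < x → 0# < x ⁻¹
    ⁻¹-pos {x} 0<x = ⁻¹-nonneg (proj₁ 0<x) (pos≉0 0<x) ,
      λ 0≈x⁻¹ → 1≉0 (trans (sym (*-⁻¹ 0<x)) (trans (*-congˡ (sym 0≈x⁻¹)) (zeroʳ x)))

    *-cancelˡ-≤ : ∀ {x y z} → 0# < z → z * x ≤ z * y → x ≤ y
    *-cancelˡ-≤ {x} {y} {z} 0<z zx≤zy = ≤-resp (cancel x) (cancel y)
      (*-monoʳ-≤ (proj₁ (⁻¹-pos 0<z)) zx≤zy)
      where
      cancel : ∀ u → z ⁻¹ * (z * u) ≈ u
      cancel u = trans (solve 3 (λ z i u → i :* (z :* u) := z :* i :* u) refl z (z ⁻¹) u)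
        (trans (*-congʳ (*-⁻¹ 0<z)) (*-identityˡ u))

    *-pos : ∀ {x y} → 0# < x → 0# < y → 0# < x * y
    *-pos {x} {y} 0<x 0<y = ≰⇒> λ xy≤0 →
      <⇒≱ 0<y (*-cancelˡ-≤ 0<x (≤-trans xy≤0 (≤-reflexive (sym (zeroʳ x)))))

    +-pos-nonneg : ∀ {x y} → 0# < x → 0# ≤ y → 0# < x + y
    +-pos-nonneg {x} 0<x 0≤y = <-≤-trans 0<x (≤-from-diff 0≤y refl)

    *-cancelʳ-≤ : ∀ {x y z} → 0# < z → x * z ≤ y * z → x ≤ y
    *-cancelʳ-≤ 0<z xz≤yz = *-cancelˡ-≤ 0<z (≤-resp (*-comm _ _) (*-comm _ _) xz≤yz)

    *-mono-≤ : ∀ {x y u v} → 0# ≤ y → 0# ≤ u → x ≤ y → u ≤ v → x * u ≤ y * v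
    *-mono-≤ 0≤y 0≤u x≤y u≤v = ≤-trans (*-monoˡ-≤ 0≤u x≤y) (*-monoʳ-≤ 0≤y u≤v)

    /-cancel : ∀ x {y} → 0# < y → x / y * y ≈ x
    /-cancel x {y} 0<y = trans (solve 3 (λ x y i → x :* i :* y := x :* (y :* i)) refl x y (y ⁻¹))
      (trans (*-congˡ (*-⁻¹ 0<y)) (*-identityʳ x))

    ≤-/ : ∀ {x y z} → 0# < z → x * z ≤ y → x ≤ y / z
    ≤-/ 0<z xz≤y = *-cancelʳ-≤ 0<z (≤-trans xz≤y (≤-reflexive (sym (/-cancel _ 0<z))))

    /-≤ : ∀ {x y z} → 0# < z → x ≤ y * z → x / z ≤ y
    /-≤ 0<z x≤yz = *-cancelʳ-≤ 0<z (≤-trans (≤-reflexive (/-cancel _ 0<z)) x≤yz)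

    ≤-/⁻¹ : ∀ {x y z} → 0# < z → x ≤ y / z → x * z ≤ y
    ≤-/⁻¹ 0<z x≤y/z = ≤-trans (*-monoˡ-≤ (proj₁ 0<z) x≤y/z) (≤-reflexive (/-cancel _ 0<z))

    /-pos : ∀ {x y} → 0# < x → 0# < y → 0# < x / y
    /-pos 0<x 0<y = *-pos 0<x (⁻¹-pos 0<y)

    ⁻¹-unique : ∀ {x y} → 0# < x → x * y ≈ 1# → x ⁻¹ ≈ y
    ⁻¹-unique {x} {y} 0<x xy≈1 = trans (sym (*-identityʳ _)) (trans (*-congˡ (sym xy≈1))
      (trans (solve 3 (λ x y i → i :* (x :* y) := x :* i :* y) refl x y (x ⁻¹))
      (trans (*-congʳ (*-⁻¹ 0<x)) (*-identityˡ y))))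

    fromℕ-pos : ∀ {n} → 1 ℕ.≤ n → 0# < fromℕ n
    fromℕ-pos {n} 1≤n = fromℕ-nonneg n , λ 0≈n → fromℕ≉0 n 1≤n (sym 0≈n)

    fromℕ-reflects-≤ : ∀ {m n} → fromℕ m ≤ fromℕ n → m ℕ.≤ n
    fromℕ-reflects-≤ {m} {n} m≤n with m ℕₚ.≤? n
    ... | yes m≤n′ = m≤n′
    ... | no m≰n = ⊥-elim (1≉0 (antisym
        (≤-resp (solve 1 (λ n → con (+ 1) :+ n :- n := con (+ 1)) refl (fromℕ n)) (-‿inverseʳ _)
          (+-monoˡ-≤ (- fromℕ n) (≤-trans (fromℕ-mono (ℕₚ.≰⇒> m≰n)) m≤n))) 0≤1))

    fromℕ-reflects-< : ∀ {m n} → fromℕ m < fromℕ n → m ℕ.< n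
    fromℕ-reflects-< {m} {n} m<n = ℕₚ.≰⇒> λ n≤m → <⇒≱ m<n (fromℕ-mono n≤m)

    x<x+y : ∀ {x y} → 0# < y → x < x + y
    x<x+y {x} {y} 0<y = ≰⇒> λ x+y≤x → <⇒≱ 0<y (≤-resp
      (solve 2 (λ x y → :- x :+ (x :+ y) := y) refl x y) (-‿inverseˡ x) (+-monoʳ-≤ (- x) x+y≤x))

-- The exponential function: functional equation and monotonicity.

module Exponential (𝓡 : RealNumbers) where
  open Real 𝓡 hiding (zero)
  open OrderedField 𝓡

  private
    module Sum = Algebra.Properties.Semiring.Sum semiring

  -- Coefficients of the Cauchy product of two power series.
  conv : (ℕ → ℝ) → (ℕ → ℝ) → ℕ → ℝ
  conv a b zero    = a 0 * b 0
  conv a b (suc n) = a 0 * b (suc n) + conv (a ∘ suc) b n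

  -- Coefficients of the formal derivative.
  deriv : (ℕ → ℝ) → ℕ → ℝ
  deriv a k = fromℕ (suc k) * a (suc k)

  ∑<-nonneg : ∀ n {f} → (∀ k → 0# ≤ f k) → 0# ≤ ∑< n f
  ∑<-nonneg zero 0≤f = ≤-refl
  ∑<-nonneg (suc n) 0≤f = +-nonneg (0≤f 0) (∑<-nonneg n (0≤f ∘ suc))

  ∑<-mono : ∀ n {f g} → (∀ k → f k ≤ g k) → ∑< n f ≤ ∑< n g
  ∑<-mono zero f≤g = ≤-refl
  ∑<-mono (suc n) f≤g = +-mono-≤ (f≤g 0) (∑<-mono n (f≤g ∘ suc))

  ∑<-extend : ∀ {m n f} → (∀ k → 0# ≤ f k) → m ℕ.≤ n → ∑< m f ≤ ∑< n f
  ∑<-extend {n = n} 0≤f ℕ.z≤n = ∑<-nonneg n 0≤f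
  ∑<-extend 0≤f (ℕ.s≤s m≤n) = +-monoʳ-≤ _ (∑<-extend (0≤f ∘ suc) m≤n)

  conv-nonneg : ∀ {a b} → (∀ k → 0# ≤ a k) → (∀ k → 0# ≤ b k) → ∀ n → 0# ≤ conv a b n
  conv-nonneg 0≤a 0≤b zero = *-nonneg (0≤a 0) (0≤b 0)
  conv-nonneg 0≤a 0≤b (suc n) = +-nonneg (*-nonneg (0≤a 0) (0≤b (suc n))) (conv-nonneg (0≤a ∘ suc) 0≤b n)

  conv-cong : ∀ {a a′ b b′} → (∀ k → a k ≈ a′ k) → (∀ k → b k ≈ b′ k) → ∀ n → conv a b n ≈ conv a′ b′ n
  conv-cong a≈ b≈ zero = *-cong (a≈ 0) (b≈ 0)
  conv-cong a≈ b≈ (suc n) = +-cong (*-cong (a≈ 0) (b≈ (suc n))) (conv-cong (a≈ ∘ suc) b≈ n)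

  conv-+ˡ : ∀ a a′ b n → conv (λ k → a k + a′ k) b n ≈ conv a b n + conv a′ b n
  conv-+ˡ a a′ b zero = distribʳ (b 0) (a 0) (a′ 0)
  conv-+ˡ a a′ b (suc n) = trans (+-congˡ (conv-+ˡ (a ∘ suc) (a′ ∘ suc) b n))
    (solve 5 (λ a a′ b c c′ → (a :+ a′) :* b :+ (c :+ c′) := (a :* b :+ c) :+ (a′ :* b :+ c′)) refl
      (a 0) (a′ 0) (b (suc n)) _ _)

  conv-*ˡ : ∀ x a b n → conv (λ k → x * a k) b n ≈ x * conv a b n
  conv-*ˡ x a b zero = *-assoc x (a 0) (b 0)
  conv-*ˡ x a b (suc n) = trans (+-congˡ (conv-*ˡ x (a ∘ suc) b n))
    (solve 4 (λ x a b c → x :* a :* b :+ x :* c := x :* (a :* b :+ c)) refl x (a 0) (b (suc n)) _)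

  conv-*ʳ : ∀ x a b n → conv a (λ k → x * b k) n ≈ x * conv a b n
  conv-*ʳ x a b zero = solve 3 (λ x a b → a :* (x :* b) := x :* (a :* b)) refl x (a 0) (b 0)
  conv-*ʳ x a b (suc n) = trans (+-congˡ (conv-*ʳ x (a ∘ suc) b n))
    (solve 4 (λ x a b c → a :* (x :* b) :+ x :* c := x :* (a :* b :+ c)) refl x (a 0) (b (suc n)) _)

  ∑<-conv-suc : ∀ n a b →
    ∑< (suc n) (conv a b) ≈ a 0 * ∑< (suc n) b + ∑< n (conv (a ∘ suc) b)
  ∑<-conv-suc n a b = trans
    (+-congˡ (trans (Sum.∑-distrib-+ {n} (λ i → a 0 * b (suc (toℕ i))) (conv (a ∘ suc) b ∘ toℕ))
      (+-congʳ (sym (Sum.*-distribˡ-sum {n} (a 0) (b ∘ suc ∘ toℕ))))))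
    (solve 4 (λ a b s t → a :* b :+ (a :* s :+ t) := a :* (b :+ s) :+ t) refl (a 0) (b 0) _ _)

  -- The index pairs on the left form a triangle inside the n × n square on the right, and all terms
  -- are nonnegative.
  ∑<-conv-≤ : ∀ n {a b} → (∀ k → 0# ≤ a k) → (∀ k → 0# ≤ b k) →
              ∑< n (conv a b) ≤ ∑< n a * ∑< n b
  ∑<-conv-≤ zero 0≤a 0≤b = ≤-reflexive (sym (zeroˡ 0#))
  ∑<-conv-≤ (suc n) {a} {b} 0≤a 0≤b = begin
    ∑< (suc n) (conv a b)                                   ≈⟨ ∑<-conv-suc n a b ⟩
    a 0 * ∑< (suc n) b + ∑< n (conv (a ∘ suc) b)            ≤⟨ +-monoʳ-≤ _ (∑<-conv-≤ n (0≤a ∘ suc) 0≤b) ⟩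
    a 0 * ∑< (suc n) b + ∑< n (a ∘ suc) * ∑< n b
      ≤⟨ +-monoʳ-≤ _ (*-monoʳ-≤ (∑<-nonneg n (0≤a ∘ suc)) (∑<-extend 0≤b (ℕₚ.n≤1+n n))) ⟩
    a 0 * ∑< (suc n) b + ∑< n (a ∘ suc) * ∑< (suc n) b      ≈⟨ distribʳ _ _ _ ⟨
    ∑< (suc n) a * ∑< (suc n) b                             ∎
    where open ≤-Reasoning

  -- Conversely, the m × n rectangle lies inside the triangle of index pairs with sum below m + n.
  ∑<-conv-≥ : ∀ m n {a b} → (∀ k → 0# ≤ a k) → (∀ k → 0# ≤ b k) →
              ∑< m a * ∑< n b ≤ ∑< (m ℕ.+ n) (conv a b)
  ∑<-conv-≥ zero n 0≤a 0≤b = ≤-trans (≤-reflexive (zeroˡ _)) (∑<-nonneg n (conv-nonneg 0≤a 0≤b))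
  ∑<-conv-≥ (suc m) n {a} {b} 0≤a 0≤b = begin
    ∑< (suc m) a * ∑< n b                                     ≈⟨ distribʳ _ _ _ ⟩
    a 0 * ∑< n b + ∑< m (a ∘ suc) * ∑< n b
      ≤⟨ +-mono-≤ (*-monoʳ-≤ (0≤a 0) (∑<-extend 0≤b (ℕₚ.m≤n+m n (suc m)))) (∑<-conv-≥ m n (0≤a ∘ suc) 0≤b) ⟩
    a 0 * ∑< (suc m ℕ.+ n) b + ∑< (m ℕ.+ n) (conv (a ∘ suc) b) ≈⟨ ∑<-conv-suc (m ℕ.+ n) a b ⟨
    ∑< (suc m ℕ.+ n) (conv a b)                               ∎
    where open ≤-Reasoning

  -- The product rule (ab)′ = a′b + ab′ for formal power series.
  conv-leibniz : ∀ a b n →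
    fromℕ (suc n) * conv a b (suc n) ≈ conv (deriv a) b n + conv a (deriv b) n
  conv-leibniz a b zero =
    solve 5 (λ u a₀ a₁ b₀ b₁ → u :* (a₀ :* b₁ :+ a₁ :* b₀) := u :* a₁ :* b₀ :+ a₀ :* (u :* b₁))
    refl (fromℕ 1) (a 0) (a 1) (b 0) (b 1)
  conv-leibniz a b (suc n) = begin
    (1# + N) * (a 0 * b₂ + (a 1 * b₁ + r))
      ≈⟨ solve 6 (λ N a₀ b₂ a₁ b₁ r → (con (+ 1) :+ N) :* (a₀ :* b₂ :+ (a₁ :* b₁ :+ r)) :=
           N :* (a₁ :* b₁ :+ r) :+ (a₁ :* b₁ :+ r :+ (con (+ 1) :+ N) :* (a₀ :* b₂))) refl N (a 0) b₂ (a 1) b₁ r ⟩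
    N * (a 1 * b₁ + r) + (a 1 * b₁ + r + (1# + N) * (a 0 * b₂))
      ≈⟨ +-congʳ (conv-leibniz (a ∘ suc) b n) ⟩
    (conv (deriv (a ∘ suc)) b n + q) + (a 1 * b₁ + r + (1# + N) * (a 0 * b₂))
      ≈⟨ solve 8 (λ p q r N a₀ b₂ a₁ b₁ → (p :+ q) :+ (a₁ :* b₁ :+ r :+ (con (+ 1) :+ N) :* (a₀ :* b₂)) :=
           ((con (+ 1) :+ con (+ 0)) :* a₁ :* b₁ :+ (p :+ r)) :+ (a₀ :* ((con (+ 1) :+ N) :* b₂) :+ q)) refl _ q r N (a 0) b₂ (a 1) b₁ ⟩
    (deriv a 0 * b₁ + (conv (deriv (a ∘ suc)) b n + r)) + (a 0 * deriv b (suc n) + q)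
      ≈⟨ +-congʳ (+-congˡ (trans (sym (conv-+ˡ (deriv (a ∘ suc)) (λ k → a (suc (suc k))) b n))
           (conv-cong (λ k → solve 2 (λ N a → N :* a :+ a := (con (+ 1) :+ N) :* a) refl (fromℕ (suc k)) (a (suc (suc k)))) (λ _ → refl) n))) ⟩
    conv (deriv a) b (suc n) + conv a (deriv b) (suc n) ∎
    where
    open import Relation.Binary.Reasoning.Setoid setoid
    N = fromℕ (suc n)
    b₁ = b (suc n)
    b₂ = b (suc (suc n))
    r = conv (λ k → a (suc (suc k))) b n
    q = conv (a ∘ suc) (deriv b) n

  deriv-expTerm : ∀ x k → deriv (expTerm x) k ≈ x * expTerm x k
  deriv-expTerm x k = trans
    (solve 4 (λ s x p i → s :* (x :* p :* i) := x :* (p :* (s :* i))) refl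
      (fromℕ (suc k)) x (x ^ k) (fromℕ (suc k !) ⁻¹))
    (*-congˡ (*-congˡ (sym (factorial⁻¹-suc k))))

  expTerm-0 : ∀ x → expTerm x 0 ≈ 1#
  expTerm-0 x =
    trans (*-identityˡ _) (⁻¹-unique (fromℕ-pos ℕₚ.≤-refl) (trans (*-identityʳ _) (+-identityʳ 1#)))

  *-cancelˡ-≈ : ∀ {x y z} → 0# < z → z * x ≈ z * y → x ≈ y
  *-cancelˡ-≈ 0<z zx≈zy =
    antisym (*-cancelˡ-≤ 0<z (≤-reflexive zx≈zy)) (*-cancelˡ-≤ 0<z (≤-reflexive (sym zx≈zy)))

  *-cancelʳ-≈ : ∀ {x y z} → 0# < z → x * z ≈ y * z → x ≈ y
  *-cancelʳ-≈ 0<z xz≈yz = *-cancelˡ-≈ 0<z (trans (*-comm _ _) (trans xz≈yz (*-comm _ _)))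

  -- Both sides are power series with constant term 1 that satisfy f′ = (x + y) f, the right one by
  -- the product rule. This recurrence determines the coefficients, so no binomial coefficients are
  -- needed.
  expTerm-+ : ∀ x y n → expTerm (x + y) n ≈ conv (expTerm x) (expTerm y) n
  expTerm-+ x y zero = trans (expTerm-0 (x + y))
    (sym (trans (*-cong (expTerm-0 x) (expTerm-0 y)) (*-identityˡ 1#)))
  expTerm-+ x y (suc n) = *-cancelˡ-≈ (fromℕ-pos {suc n} (ℕ.s≤s ℕ.z≤n)) (begin
    deriv (expTerm (x + y)) n                            ≈⟨ deriv-expTerm (x + y) n ⟩
    (x + y) * expTerm (x + y) n                          ≈⟨ *-congˡ (expTerm-+ x y n) ⟩
    (x + y) * conv (expTerm x) (expTerm y) n             ≈⟨ distribʳ _ x y ⟩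
    x * conv (expTerm x) (expTerm y) n + y * conv (expTerm x) (expTerm y) n
      ≈⟨ +-cong (conv-*ˡ x _ _ n) (conv-*ʳ y _ _ n) ⟨
    conv (λ k → x * expTerm x k) (expTerm y) n + conv (expTerm x) (λ k → y * expTerm y k) n
      ≈⟨ +-cong (conv-cong (sym ∘ deriv-expTerm x) (λ _ → refl) n) (conv-cong (λ _ → refl) (sym ∘ deriv-expTerm y) n) ⟩
    conv (deriv (expTerm x)) (expTerm y) n + conv (expTerm x) (deriv (expTerm y)) n
      ≈⟨ conv-leibniz (expTerm x) (expTerm y) n ⟨
    fromℕ (suc n) * conv (expTerm x) (expTerm y) (suc n) ∎)
    where open import Relation.Binary.Reasoning.Setoid setoid

  ∑<-cong : ∀ n {f g} → (∀ k → f k ≈ g k) → ∑< n f ≈ ∑< n g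
  ∑<-cong n f≈g = Sum.sum-cong-≋ {n} (f≈g ∘ toℕ)

  -- The suprema behind `exp` and `log` are chosen along a proof about the sign of the argument; two
  -- choices agree only up to `≈`, by this uniqueness.
  supremum-unique : ∀ {S s s′} → IsSupremum S s → IsSupremum S s′ → s ≈ s′
  supremum-unique (ub , least) (ub′ , least′) = antisym (least ub′) (least′ ub)

  exp-supremum : ∀ {x} → 0# ≤ x → IsSupremum (IsExpPartialSum x) (exp x)
  exp-supremum {x} 0≤x with 0# ≤? x
  ... | yes 0≤x′ = proj₂ (expNonneg x 0≤x′)
  ... | no  0≰x  = ⊥-elim (0≰x 0≤x)

  expPartialSum-≤ : ∀ {x} → 0# ≤ x → ∀ n → expPartialSum x n ≤ exp x
  expPartialSum-≤ 0≤x n = proj₁ (exp-supremum 0≤x) (n , refl)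

  exp-least : ∀ {x b} → 0# ≤ x → (∀ n → expPartialSum x n ≤ b) → exp x ≤ b
  exp-least 0≤x S≤b = proj₂ (exp-supremum 0≤x) λ (n , y≈S) → ≤-trans (≤-reflexive y≈S) (S≤b n)

  -- Lets a supremum be taken inside a product, one factor at a time, in the lower bound of
  -- `exp-+⁺`. The argument divides by `c`, so `c ≈ 0#` is treated apart.
  exp-*-least : ∀ {x b c} → 0# ≤ x → 0# ≤ b → 0# ≤ c → (∀ n → expPartialSum x n * c ≤ b) → exp x * c ≤ b
  exp-*-least {x} {b} {c} 0≤x 0≤b 0≤c Sc≤b with 0# ≈? c
  ... | yes 0≈c = ≤-trans (≤-reflexive (trans (*-congˡ (sym 0≈c)) (zeroʳ _))) 0≤b
  ... | no  0≉c = ≤-/⁻¹ 0<c (exp-least 0≤x λ n → ≤-/ 0<c (Sc≤b n))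
    where
    0<c : 0# < c
    0<c = 0≤c , 0≉c

  private
    S-nonneg : ∀ {x} → 0# ≤ x → ∀ n → 0# ≤ expPartialSum x n
    S-nonneg 0≤x n = ∑<-nonneg n (expTerm-nonneg 0≤x)

    0≤exp⁺ : ∀ {x} → 0# ≤ x → 0# ≤ exp x
    0≤exp⁺ 0≤x = expPartialSum-≤ 0≤x 0

    exp-+⁺ : ∀ {x y} → 0# ≤ x → 0# ≤ y → exp (x + y) ≈ exp x * exp y
    exp-+⁺ {x} {y} 0≤x 0≤y = antisym
      (exp-least 0≤x+y λ n → ≤-trans (≤-reflexive (∑<-cong n (expTerm-+ x y)))
        (≤-trans (∑<-conv-≤ n (expTerm-nonneg 0≤x) (expTerm-nonneg 0≤y))
          (*-mono-≤ (0≤exp⁺ 0≤x) (S-nonneg 0≤y n) (expPartialSum-≤ 0≤x n) (expPartialSum-≤ 0≤y n))))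
      (exp-*-least 0≤x 0≤E (0≤exp⁺ 0≤y) λ m → ≤-trans (≤-reflexive (*-comm _ _))
        (exp-*-least 0≤y 0≤E (S-nonneg 0≤x m) λ n → ≤-trans (≤-reflexive (*-comm _ _))
          (≤-trans (∑<-conv-≥ m n (expTerm-nonneg 0≤x) (expTerm-nonneg 0≤y))
            (≤-trans (≤-reflexive (sym (∑<-cong (m ℕ.+ n) (expTerm-+ x y)))) (expPartialSum-≤ 0≤x+y (m ℕ.+ n))))))
      where
      0≤x+y = +-nonneg 0≤x 0≤y
      0≤E = 0≤exp⁺ 0≤x+y

    ^-cong : ∀ {x y} n → x ≈ y → x ^ n ≈ y ^ n
    ^-cong zero x≈y = refl
    ^-cong (suc n) x≈y = *-cong x≈y (^-cong n x≈y)

    exp-cong⁺ : ∀ {x y} → 0# ≤ x → x ≈ y → exp x ≈ exp y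
    exp-cong⁺ {x} {y} 0≤x x≈y = antisym
      (exp-least 0≤x λ n → ≤-trans (≤-reflexive (∑<-cong n λ k → *-congʳ {fromℕ (k !) ⁻¹} (^-cong k x≈y))) (expPartialSum-≤ 0≤y n))
      (exp-least 0≤y λ n → ≤-trans (≤-reflexive (∑<-cong n λ k → *-congʳ {fromℕ (k !) ⁻¹} (^-cong k (sym x≈y)))) (expPartialSum-≤ 0≤x n))
      where 0≤y = ≤-trans 0≤x (≤-reflexive x≈y)

    1+x≤exp⁺ : ∀ {x} → 0# ≤ x → 1# + x ≤ exp x
    1+x≤exp⁺ {x} 0≤x = ≤-trans (≤-reflexive (+-cong (sym (expTerm-0 x)) x≈)) (expPartialSum-≤ 0≤x 2)
      where
      x≈ : x ≈ expTerm x 1 + 0#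
      x≈ =
        trans (sym (*-identityʳ x)) (trans (*-cong (sym (*-identityʳ x)) (sym (trans (sym (*-identityˡ _)) (expTerm-0 x))))
        (sym (+-identityʳ _)))

    0<exp⁺ : ∀ {x} → 0# ≤ x → 0# < exp x
    0<exp⁺ 0≤x = <-≤-trans (+-pos-nonneg 0<1 0≤x) (1+x≤exp⁺ 0≤x)

    exp-neg′ : ∀ {x} → ¬ 0# ≤ x → exp x ≈ exp (- x) ⁻¹
    exp-neg′ {x} 0≰x with 0# ≤? x
    ... | yes 0≤x = ⊥-elim (0≰x 0≤x)
    ... | no  0≰x′ = sym (⁻¹-unique (0<exp⁺ 0≤-x) (trans (*-congʳ E≈E′)
        (*-⁻¹ (<-≤-trans (0<exp⁺ 0≤-x) (≤-reflexive E≈E′)))))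
      where
      0≤-x = neg-nonneg (≰⇒≥ 0≰x′)
      E≈E′ = supremum-unique (exp-supremum 0≤-x) (proj₂ (expNonneg (- x) 0≤-x))

    exp-neg : ∀ {x} → ¬ 0# ≤ x → exp x * exp (- x) ≈ 1#
    exp-neg 0≰x = trans (*-congʳ (exp-neg′ 0≰x)) (trans (*-comm _ _) (*-⁻¹ (0<exp⁺ (neg-nonneg (≰⇒≥ 0≰x)))))

    exp-shift : ∀ x {v} → 0# ≤ v → 0# ≤ x + v → exp x * exp v ≈ exp (x + v)
    exp-shift x {v} 0≤v 0≤x+v = case 0# ≤? x of λ where
        (yes 0≤x) → sym (exp-+⁺ 0≤x 0≤v)
        (no  0≰x) → negative 0≰x (neg-nonneg (≰⇒≥ 0≰x))
      where
      open import Relation.Binary.Reasoning.Setoid setoid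
      negative : ¬ 0# ≤ x → 0# ≤ - x → exp x * exp v ≈ exp (x + v)
      negative 0≰x 0≤-x = *-cancelʳ-≈ (0<exp⁺ 0≤-x) (begin
        exp x * exp v * exp (- x)    ≈⟨ solve 3 (λ a b c → a :* b :* c := a :* c :* b) refl _ _ _ ⟩
        exp x * exp (- x) * exp v    ≈⟨ *-congʳ (exp-neg 0≰x) ⟩
        1# * exp v                   ≈⟨ *-identityˡ _ ⟩
        exp v                        ≈⟨ exp-cong⁺ 0≤v (solve 2 (λ x v → v := x :+ v :+ :- x) refl x v) ⟩
        exp (x + v + - x)            ≈⟨ exp-+⁺ 0≤x+v 0≤-x ⟩
        exp (x + v) * exp (- x)      ∎)

    -- `exp` is defined by the sign of its argument. Multiplying an identity by `exp v` moves it
    -- into the nonnegative range, where the power series applies; the positive factor is cancelled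
    -- afterwards.
    shift : ∀ x → ∃[ v ] (0# ≤ v × 0# ≤ x + v)
    shift x with total 0# x
    ... | inj₁ 0≤x = 0# , ≤-refl , ≤-trans 0≤x (≤-reflexive (sym (+-identityʳ x)))
    ... | inj₂ x≤0 = - x , neg-nonneg x≤0 , ≤-reflexive (sym (-‿inverseʳ x))

  exp-cong : ∀ {x y} → x ≈ y → exp x ≈ exp y
  exp-cong {x} {y} x≈y with v , 0≤v , 0≤x+v ← shift x = *-cancelʳ-≈ (0<exp⁺ 0≤v)
    (trans (exp-shift x 0≤v 0≤x+v) (trans (exp-cong⁺ 0≤x+v (+-congʳ x≈y))
      (sym (exp-shift y 0≤v (≤-trans 0≤x+v (≤-reflexive (+-congʳ x≈y)))))))

  exp-+ : ∀ x y → exp (x + y) ≈ exp x * exp y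
  exp-+ x y with v , 0≤v , 0≤x+v ← shift x | w , 0≤w , 0≤y+w ← shift y =
    *-cancelʳ-≈ (0<exp⁺ (+-nonneg 0≤v 0≤w)) (begin
      exp (x + y) * exp (v + w)
        ≈⟨ exp-shift (x + y) (+-nonneg 0≤v 0≤w) (≤-resp refl perm (+-nonneg 0≤x+v 0≤y+w)) ⟩
      exp (x + y + (v + w))              ≈⟨ exp-cong perm ⟨
      exp ((x + v) + (y + w))            ≈⟨ exp-+⁺ 0≤x+v 0≤y+w ⟩
      exp (x + v) * exp (y + w)          ≈⟨ *-cong (exp-shift x 0≤v 0≤x+v) (exp-shift y 0≤w 0≤y+w) ⟨
      (exp x * exp v) * (exp y * exp w)
        ≈⟨ solve 4 (λ a b c d → (a :* b) :* (c :* d) := (a :* c) :* (b :* d)) refl _ _ _ _ ⟩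
      (exp x * exp y) * (exp v * exp w)  ≈⟨ *-congˡ (exp-+⁺ 0≤v 0≤w) ⟨
      (exp x * exp y) * exp (v + w)      ∎)
    where
    open import Relation.Binary.Reasoning.Setoid setoid
    perm : (x + v) + (y + w) ≈ x + y + (v + w)
    perm = solve 4 (λ a b c d → (a :+ b) :+ (c :+ d) := a :+ c :+ (b :+ d)) refl x v y w

  exp-0 : exp 0# ≈ 1#
  exp-0 =
    *-cancelˡ-≈ (0<exp⁺ ≤-refl) (trans (sym (exp-+ 0# 0#)) (trans (exp-cong (+-identityˡ 0#)) (sym (*-identityʳ _))))

  exp-inverse : ∀ x → exp x * exp (- x) ≈ 1#
  exp-inverse x = trans (sym (exp-+ x (- x))) (trans (exp-cong (-‿inverseʳ x)) exp-0)

  0<exp : ∀ x → 0# < exp x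
  0<exp x with v , 0≤v , 0≤x+v ← shift x = ≰⇒> λ expx≤0 →
    <⇒≱ (0<exp⁺ 0≤x+v) (≤-trans (≤-reflexive (sym (exp-shift x 0≤v 0≤x+v)))
      (≤-trans (*-monoˡ-≤ (0≤exp⁺ 0≤v) expx≤0) (≤-reflexive (zeroˡ _))))

  0≤exp : ∀ x → 0# ≤ exp x
  0≤exp x = proj₁ (0<exp x)

  private
    -- Termwise, x^(k+1)/(k+1)! ≤ x · x^k/k!. Applied to -x, this gives `1+x≤exp` for negative x.
    exp⁺≤1+x*exp : ∀ {x} → 0# ≤ x → exp x ≤ 1# + x * exp x
    exp⁺≤1+x*exp {x} 0≤x = exp-least 0≤x λ where
        zero    → +-nonneg 0≤1 (*-nonneg 0≤x (0≤exp x))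
        (suc n) → +-mono-≤ (≤-reflexive (expTerm-0 x))
          (≤-trans (∑<-mono n term-suc)
            (≤-trans (≤-reflexive (sym (Sum.*-distribˡ-sum {n} x (expTerm x ∘ toℕ))))
              (*-monoʳ-≤ 0≤x (expPartialSum-≤ 0≤x n))))
      where
      term-suc : ∀ k → expTerm x (suc k) ≤ x * expTerm x k
      term-suc k = ≤-trans (≤-from-diff (*-nonneg (fromℕ-nonneg k) (expTerm-nonneg 0≤x (suc k)))
          (solve 2 (λ n a → (con (+ 1) :+ n) :* a := a :+ n :* a) refl (fromℕ k) (expTerm x (suc k))))
        (≤-reflexive (deriv-expTerm x k))

  1+x≤exp : ∀ x → 1# + x ≤ exp x
  1+x≤exp x = case total 0# x of λ where
      (inj₁ 0≤x) → 1+x≤exp⁺ 0≤x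
      (inj₂ x≤0) → *-cancelʳ-≤ (0<exp (- x)) (begin
        (1# + x) * E       ≈⟨ solve 2 (λ x e → (con (+ 1) :+ x) :* e := e :+ :- (:- x :* e)) refl x E ⟩
        E + - (- x * E)    ≤⟨ +-monoˡ-≤ _ (exp⁺≤1+x*exp (neg-nonneg x≤0)) ⟩
        1# + - x * E + - (- x * E)
          ≈⟨ solve 2 (λ x e → con (+ 1) :+ :- x :* e :+ :- (:- x :* e) := con (+ 1)) refl x E ⟩
        1#                 ≈⟨ exp-inverse x ⟨
        exp x * E          ∎)
    where
    open ≤-Reasoning
    E = exp (- x)

  private
    exp-split : ∀ x y → exp y ≈ exp x * exp (y - x)
    exp-split x y = trans (exp-cong (solve 2 (λ x y → y := x :+ (y :- x)) refl x y)) (exp-+ x (y - x))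

  exp-mono : ∀ {x y} → x ≤ y → exp x ≤ exp y
  exp-mono {x} {y} x≤y = begin
    exp x                  ≈⟨ *-identityʳ _ ⟨
    exp x * 1#             ≤⟨ *-monoʳ-≤ (0≤exp x) (≤-from-diff (diff-nonneg x≤y) refl) ⟩
    exp x * (1# + (y - x)) ≤⟨ *-monoʳ-≤ (0≤exp x) (1+x≤exp (y - x)) ⟩
    exp x * exp (y - x)    ≈⟨ exp-split x y ⟨
    exp y                  ∎
    where open ≤-Reasoning

  -- From 1 + (x - y) ≤ exp (x - y) = exp x / exp y ≤ 1.
  exp-reflects-≤ : ∀ {x y} → exp x ≤ exp y → x ≤ y
  exp-reflects-≤ {x} {y} expx≤expy = ≤-from-diff (neg-nonneg x-y≤0)
    (solve 2 (λ x y → y := x :+ :- (x :- y)) refl x y)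
    where
    1+x-y≤1 : 1# + (x - y) ≤ 1#
    1+x-y≤1 = *-cancelˡ-≤ (0<exp y) (≤-trans (*-monoʳ-≤ (0≤exp y) (1+x≤exp (x - y)))
      (≤-resp (exp-split y x) (sym (*-identityʳ _)) expx≤expy))
    x-y≤0 : x - y ≤ 0#
    x-y≤0 = ≤-resp (solve 1 (λ z → :- con (+ 1) :+ (con (+ 1) :+ z) := z) refl (x - y)) (-‿inverseˡ 1#)
      (+-monoʳ-≤ (- 1#) 1+x-y≤1)

  -- The natural logarithm and real powers.

  log-supremum : ∀ {x} → 0# < x → IsSupremum (BelowLog x) (log x)
  log-supremum {x} 0<x with 0<? x
  ... | yes 0<x′ =
    proj₂ (supremum (BelowLog x) (_ , BelowLog-nonempty 0<x′) (x , BelowLog-bounded (proj₁ 0<x′)))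
  ... | no  0≮x  = ⊥-elim (0≮x 0<x)

  -- The inequality 1 + x ≤ exp x replaces continuity. A gap between `exp s` and x, taken relative
  -- to the larger of the two, is an explicit h > 0 for which s - h is still an upper bound of
  -- `BelowLog x`, or s + h still belongs to it. Either contradicts that s is the supremum.
  exp-log : ∀ {x} → 0# < x → exp (log x) ≈ x
  exp-log {x} 0<x = antisym (below (E ≤? x)) (above (x ≤? E))
    where
    open ≤-Reasoning
    s = log x
    E = exp s
    ub = proj₁ (log-supremum 0<x)
    no-shift : ∀ {h} → 0# < h → ¬ s + h ≤ s
    no-shift {h} 0<h s+h≤s = <⇒≱ 0<h (≤-resp
      (solve 2 (λ s h → :- s :+ (s :+ h) := h) refl s h) (-‿inverseˡ s) (+-monoʳ-≤ (- s) s+h≤s))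
    diff-pos : ∀ {a b} → a < b → 0# < b - a
    diff-pos (a≤b , a≉b) = diff-nonneg a≤b , λ 0≈b-a → a≉b
      (trans (sym (+-identityʳ _)) (trans (+-congˡ 0≈b-a) (solve 2 (λ a b → a :+ (b :- a) := b) refl _ _)))
    -- b (1 - h) = a, while exp (- h) ≥ 1 - h.
    scale : ∀ a {b} → 0# < b → b * (1# + - ((b - a) / b)) ≈ a
    scale a {b} 0<b = trans (solve 3 (λ a b q → b :* (con (+ 1) :+ :- q) := b :+ :- (q :* b)) refl a b _)
      (trans (+-congˡ (-‿cong (/-cancel (b - a) 0<b))) (solve 2 (λ a b → b :+ :- (b :- a) := a) refl a b))
    below : Dec (E ≤ x) → E ≤ x
    below (yes E≤x) = E≤x
    below (no  E≰x) = ⊥-elim (no-shift 0<h (≤-trans (+-monoˡ-≤ h s≤s-h)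
        (≤-reflexive (solve 2 (λ s h → s :+ :- h :+ h := s) refl s h))))
      where
      h = (E - x) / E
      0<h : 0# < h
      0<h = /-pos (diff-pos (≰⇒> E≰x)) (0<exp s)
      x≤exp : x ≤ exp (s + - h)
      x≤exp = begin
        x                 ≈⟨ scale x (0<exp s) ⟨
        E * (1# + - h)    ≤⟨ *-monoʳ-≤ (0≤exp s) (1+x≤exp (- h)) ⟩
        E * exp (- h)     ≈⟨ exp-+ s (- h) ⟨
        exp (s + - h)     ∎
      s≤s-h : s ≤ s + - h
      s≤s-h = proj₂ (log-supremum 0<x) λ expy≤x → exp-reflects-≤ (≤-trans expy≤x x≤exp)
    above : Dec (x ≤ E) → x ≤ E
    above (yes x≤E) = x≤E
    above (no  x≰E) = ⊥-elim (no-shift 0<h (ub (*-cancelʳ-≤ 0<1-h (begin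
        exp (s + h) * (1# + - h)     ≤⟨ *-monoʳ-≤ (0≤exp _) (1+x≤exp (- h)) ⟩
        exp (s + h) * exp (- h)      ≈⟨ exp-+ _ _ ⟨
        exp (s + h + - h)            ≈⟨ exp-cong (solve 2 (λ s h → s :+ h :+ :- h := s) refl s h) ⟩
        E                            ≈⟨ scale E 0<x ⟨
        x * (1# + - h)               ∎))))
      where
      h = (x - E) / x
      0<h : 0# < h
      0<h = /-pos (diff-pos (≰⇒> x≰E)) 0<x
      0<1-h : 0# < 1# + - h
      0<1-h = ≰⇒> λ 1-h≤0 → <⇒≱ (0<exp s) (≤-resp (scale E 0<x) (zeroʳ x) (*-monoʳ-≤ (proj₁ 0<x) 1-h≤0))

  log-≤ : ∀ {x y} → 0# < x → x ≤ exp y → log x ≤ y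
  log-≤ 0<x x≤expy = exp-reflects-≤ (≤-trans (≤-reflexive (exp-log 0<x)) x≤expy)

  ≤-log : ∀ {x y} → 0# < x → exp y ≤ x → y ≤ log x
  ≤-log 0<x expy≤x = exp-reflects-≤ (≤-trans expy≤x (≤-reflexive (sym (exp-log 0<x))))

  ^ʳ-def : ∀ {x} → 0# < x → ∀ a → x ^ʳ a ≈ exp (a * log x)
  ^ʳ-def {x} 0<x a with 0<? x
  ... | yes p = exp-cong (*-congˡ (supremum-unique (log-supremum 0<x)
    (proj₂ (supremum (BelowLog x) (_ , BelowLog-nonempty p) (x , BelowLog-bounded (proj₁ p))))))
  ... | no 0≮x = ⊥-elim (0≮x 0<x)

  ^ʳ-junk : ∀ {x} → ¬ 0# < x → ∀ a → x ^ʳ a ≈ 0#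
  ^ʳ-junk {x} 0≮x a with 0<? x
  ... | yes 0<x = ⊥-elim (0≮x 0<x)
  ... | no _ = refl

-- Finite sums, and finite-dimensional Euclidean spaces as Hilbert spaces.

module HilbertSpaces (𝓡 : RealNumbers) where
  open Real 𝓡 hiding (zero)
  open OrderedField 𝓡
  open Exponential 𝓡

  private
    module Sum = Algebra.Properties.Semiring.Sum semiring

  sum-cong : ∀ {n} {f g : Fin n → ℝ} → (∀ i → f i ≈ g i) → sum f ≈ sum g
  sum-cong = Sum.sum-cong-≋

  sum-mono : ∀ {n} {f g : Fin n → ℝ} → (∀ i → f i ≤ g i) → sum f ≤ sum g
  sum-mono {zero}  f≤g = ≤-refl
  sum-mono {suc n} f≤g = +-mono-≤ (f≤g zero) (sum-mono (f≤g ∘ suc))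

  sum-nonneg : ∀ {n} {f : Fin n → ℝ} → (∀ i → 0# ≤ f i) → 0# ≤ sum f
  sum-nonneg {zero}  0≤f = ≤-refl
  sum-nonneg {suc n} 0≤f = +-nonneg (0≤f zero) (sum-nonneg (0≤f ∘ suc))

  sum-const : ∀ n x → sum {n} (λ _ → x) ≈ fromℕ n * x
  sum-const zero x = sym (zeroˡ x)
  sum-const (suc n) x = trans (+-congˡ (sum-const n x))
    (solve 2 (λ n x → x :+ n :* x := (con (+ 1) :+ n) :* x) refl (fromℕ n) x)

  term≤sum : ∀ {n} {f : Fin n → ℝ} → (∀ i → 0# ≤ f i) → ∀ i → f i ≤ sum f
  term≤sum 0≤f zero = ≤-from-diff (sum-nonneg (0≤f ∘ suc)) refl
  term≤sum 0≤f (suc i) = ≤-trans (term≤sum (0≤f ∘ suc) i) (≤-from-diff (0≤f zero) (+-comm _ _))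

  sum-+ : ∀ {n} (f g : Fin n → ℝ) → sum (λ i → f i + g i) ≈ sum f + sum g
  sum-+ = Sum.∑-distrib-+

  sum-* : ∀ {n} x (f : Fin n → ℝ) → sum (λ i → x * f i) ≈ x * sum f
  sum-* x f = sym (Sum.*-distribˡ-sum x f)

  -- The limit is the lower limit, the supremum of all eventual lower bounds. A one-sided Cauchy
  -- condition suffices because m and n can be exchanged, and the limit inherits every pair of η and
  -- N for which it holds.
  limit : (s : ℕ → ℝ) → (∀ η → 0# < η → ∃[ N ] ∀ m n → N ℕ.≤ m → N ℕ.≤ n → s m ≤ s n + η) →
    ∃[ l ] ∀ {η N} → (∀ m n → N ℕ.≤ m → N ℕ.≤ n → s m ≤ s n + η) →
      ∀ n → N ℕ.≤ n → s n ≤ l + η × l ≤ s n + η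
  limit s cauchy = l , λ {η} {N} close n N≤n →
      ≤-resp (solve 2 (λ s η → s :- η :+ η := s) refl (s n) η) refl
        (+-monoˡ-≤ η (proj₁ (proj₂ supremal) (eventually close n N≤n))) ,
      proj₂ (proj₂ supremal) (upper close n N≤n)
    where
    Eventually≥ : ℝ → Set
    Eventually≥ a = ∃[ N ] ∀ n → N ℕ.≤ n → a ≤ s n
    eventually : ∀ {η N} → (∀ m n → N ℕ.≤ m → N ℕ.≤ n → s m ≤ s n + η) → ∀ n → N ℕ.≤ n → Eventually≥ (s n - η)
    eventually {η} {N} close n N≤n = N , λ m N≤m →
      ≤-resp refl (solve 2 (λ s η → s :+ η :- η := s) refl (s m) η) (+-monoˡ-≤ (- η) (close n m N≤n N≤m))
    upper : ∀ {η N} → (∀ m n → N ℕ.≤ m → N ℕ.≤ n → s m ≤ s n + η) → ∀ n → N ℕ.≤ n → IsUpperBound Eventually≥ (s n + η)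
    upper {N = N} close n N≤n (N′ , a≤s) =
      ≤-trans (a≤s (N ℕ.⊔ N′) (ℕₚ.m≤n⊔m N N′)) (close (N ℕ.⊔ N′) n (ℕₚ.m≤m⊔n N N′) N≤n)
    N₁ = proj₁ (cauchy 1# 0<1)
    close₁ = proj₂ (cauchy 1# 0<1)
    supremal =
      supremum Eventually≥ (_ , eventually close₁ N₁ ℕₚ.≤-refl) (_ , λ {x} → upper close₁ N₁ ℕₚ.≤-refl {x})
    l = proj₁ supremal

  square-mono : ∀ {x y} → - y ≤ x → x ≤ y → x * x ≤ y * y
  square-mono {x} {y} -y≤x x≤y = ≤-from-diff (*-nonneg (diff-nonneg x≤y) (diff-nonneg -y≤x))
    (solve 2 (λ x y → y :* y := x :* x :+ (y :- x) :* (x :- :- y)) refl x y)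

  square-cancel-≤ : ∀ {x y} → 0# < y → x * x ≤ y * y → x ≤ y
  square-cancel-≤ {x} {y} 0<y xx≤yy = case x ≤? y of λ where
    (yes x≤y) → x≤y
    (no  x≰y) → let y<x = ≰⇒> x≰y in
      *-cancelʳ-≤ {z = x} (≤-<-trans (proj₁ 0<y) y<x) (≤-trans xx≤yy (*-monoʳ-≤ (proj₁ 0<y) (proj₁ y<x)))

  sum-zero : ∀ {n} {f : Fin n → ℝ} → (∀ i → 0# ≤ f i) → sum f ≈ 0# → ∀ i → f i ≈ 0#
  sum-zero 0≤f Σ≈0 i = antisym (≤-trans (term≤sum 0≤f i) (≤-reflexive Σ≈0)) (0≤f i)

  square-zero : ∀ x → x * x ≈ 0# → x ≈ 0#
  square-zero x xx≈0 = case x ≈? 0# of λ where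
    (yes x≈0) → x≈0
    (no  x≉0) → trans (solve 1 (λ x → x := con (+ 1) :* x) refl x) (trans (*-congʳ (sym (⁻¹-inverse x≉0)))
      (trans (solve 2 (λ x i → x :* i :* x := x :* x :* i) refl x (x ⁻¹)) (trans (*-congʳ xx≈0) (zeroˡ _))))

  ∃η≤1∧Kη≤ε : ∀ {K ε} → 0# < K → 0# < ε → ∃[ η ] (0# < η × η ≤ 1# × K * η ≤ ε)
  ∃η≤1∧Kη≤ε {K} {ε} 0<K 0<ε with ε / K ≤? 1#
  ... | yes ε/K≤1 = ε / K , /-pos 0<ε 0<K , ε/K≤1 , ≤-reflexive (trans (*-comm K _) (/-cancel ε 0<K))
  ... | no  ε/K≰1 = 1# , 0<1 , ≤-refl , ≤-trans (*-monoʳ-≤ (proj₁ 0<K) (≰⇒≥ ε/K≰1))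
        (≤-reflexive (trans (*-comm K _) (/-cancel ε 0<K)))

  -- Scaling the inner product avoids square roots.
  module _ (k : ℕ) (c : ℝ) (0<c : 0# < c) where

    private
      V : Set
      V = Fin k → ℝ

      dot : V → V → ℝ
      dot u v = c * sum (λ i → u i * v i)

      d² : V → V → ℝ
      d² u v = dot (λ i → u i - v i) (λ i → u i - v i)


      euclideanModule : LeftModule ring _ _
      euclideanModule = record
        { Carrierᴹ = V
        ; _≈ᴹ_ = λ u v → ∀ i → u i ≈ v i
        ; _+ᴹ_ = λ u v i → u i + v i
        ; _*ₗ_ = λ a v i → a * v i
        ; 0ᴹ = λ _ → 0#
        ; -ᴹ_ = λ v i → - v i
        ; isLeftModule = record
          { isLeftSemimodule = record
            { +ᴹ-isCommutativeMonoid = Pointwise.isCommutativeMonoid (Fin k) +-isCommutativeMonoid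
            ; isPreleftSemimodule = record
              { *ₗ-cong = λ a≈b u≈v i → *-cong a≈b (u≈v i)
              ; *ₗ-zeroˡ = λ v i → zeroˡ (v i)
              ; *ₗ-distribʳ = λ v a b i → distribʳ (v i) a b
              ; *ₗ-identityˡ = λ v i → *-identityˡ (v i)
              ; *ₗ-assoc = λ a b v i → *-assoc a b (v i)
              ; *ₗ-zeroʳ = λ a i → zeroʳ a
              ; *ₗ-distribˡ = λ a u v i → distribˡ a (u i) (v i)
              }
            }
          ; -ᴹ‿cong = λ u≈v i → -‿cong (u≈v i)
          ; -ᴹ‿inverse = (λ v i → -‿inverseˡ (v i)) , (λ v i → -‿inverseʳ (v i))
          }
        }

      coordinate-close : ∀ {η} u v → 0# < η → d² u v < c * (η * η) → ∀ i → u i ≤ v i + η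
      coordinate-close {η} u v 0<η d²<cη² i =
        ≤-resp (solve 2 (λ u v → v :+ (u :- v) := u) refl (u i) (v i)) refl
        (+-monoʳ-≤ (v i) (square-cancel-≤ 0<η
          (≤-trans (term≤sum (λ j → square-nonneg (u j - v j)) i) (*-cancelˡ-≤ 0<c (proj₁ d²<cη²)))))

      module _ (s : ℕ → V) where

        Cauchy : Set
        Cauchy = ∀ ε → 0# < ε → ∃[ N ] ∀ m n → N ℕ.≤ m → N ℕ.≤ n → d² (s m) (s n) < ε

        CloseAfter : ℝ → ℕ → Fin k → Set
        CloseAfter η N i = ∀ m n → N ℕ.≤ m → N ℕ.≤ n → s m i ≤ s n i + η

        coordinates-cauchy : Cauchy → ∀ η → 0# < η → ∃[ N ] ∀ i → CloseAfter η N i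
        coordinates-cauchy cauchy η 0<η = proj₁ bound , λ i m n N≤m N≤n →
            coordinate-close (s m) (s n) 0<η (proj₂ bound m n N≤m N≤n) i
          where
          bound = cauchy (c * (η * η)) (*-pos 0<c (*-pos 0<η 0<η))

        coordinate-limits : Cauchy → ∃[ v ] ∀ i {η N} → CloseAfter η N i →
          ∀ n → N ℕ.≤ n → s n i ≤ v i + η × v i ≤ s n i + η
        coordinate-limits cauchy = (λ i → proj₁ (lim i)) , (λ i → proj₂ (lim i))
          where
          lim : ∀ i → ∃[ l ] ∀ {η N} → CloseAfter η N i → ∀ n → N ℕ.≤ n → s n i ≤ l + η × l ≤ s n i + η
          lim i = limit (λ n → s n i) λ η 0<η →
            proj₁ (coordinates-cauchy cauchy η 0<η) , proj₂ (coordinates-cauchy cauchy η 0<η) i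

      small : ∀ {ε} → 0# < ε → ∃[ η ] (0# < η × c * (fromℕ k * (η * η)) < ε)
      small {ε} 0<ε = let η , 0<η , η≤1 , Kη≤ε = ∃η≤1∧Kη≤ε 0<K 0<ε in η , 0<η , bound 0<η η≤1 Kη≤ε
        where
        -- With η ≤ 1 the quantity c k η² is at most c k η. The successor supplies the summand c η
        -- that makes the inequality strict, and keeps `K` positive in dimension 0.
        K = c * fromℕ (suc k)
        0<K : 0# < K
        0<K = *-pos 0<c (fromℕ-pos {suc k} (ℕ.s≤s ℕ.z≤n))
        bound : ∀ {η} → 0# < η → η ≤ 1# → K * η ≤ ε → c * (fromℕ k * (η * η)) < ε
        bound {η} 0<η η≤1 Kη≤ε = ≤-<-trans
          (*-monoʳ-≤ (proj₁ 0<c) (*-monoʳ-≤ (fromℕ-nonneg k)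
            (≤-trans (*-monoʳ-≤ (proj₁ 0<η) η≤1) (≤-reflexive (*-identityʳ η)))))
          (<-≤-trans (x<x+y (*-pos 0<c 0<η)) (≤-trans (≤-reflexive
            (solve 3 (λ c k η → c :* (k :* η) :+ c :* η := c :* (con (+ 1) :+ k) :* η) refl c (fromℕ k) η)) Kη≤ε))

      close⇒d²<ε : ∀ {η ε} u v → c * (fromℕ k * (η * η)) < ε →
        (∀ i → u i ≤ v i + η × v i ≤ u i + η) → d² u v < ε
      close⇒d²<ε {η} u v ckη²<ε close = ≤-<-trans (*-monoʳ-≤ (proj₁ 0<c) (≤-trans
          (sum-mono square-≤) (≤-reflexive (sum-const k (η * η))))) ckη²<ε
        where
        square-≤ : ∀ i → (u i - v i) * (u i - v i) ≤ η * η
        square-≤ i = square-mono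
          (≤-resp (solve 2 (λ l η → l :+ (:- l :- η) := :- η) refl (v i) η)
            (solve 3 (λ l s η → s :+ η :+ (:- l :- η) := s :- l) refl (v i) (u i) η)
            (+-monoˡ-≤ (- v i - η) (proj₂ (close i))))
          (≤-resp refl (solve 2 (λ l η → l :+ η :- l := η) refl (v i) η) (+-monoˡ-≤ (- v i) (proj₁ (close i))))

      completeness : ∀ s → Cauchy s → ∃[ v ] ∀ ε → 0# < ε → ∃[ N ] ∀ n → N ℕ.≤ n → d² (s n) v < ε
      completeness s cauchy = v , converges
        where
        v : V
        v = proj₁ (coordinate-limits s cauchy)
        converges : ∀ ε → 0# < ε → ∃[ N ] ∀ n → N ℕ.≤ n → d² (s n) v < ε
        converges ε 0<ε = N , d²<ε
          where
          η = proj₁ (small 0<ε)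
          N = proj₁ (coordinates-cauchy s cauchy η (proj₁ (proj₂ (small 0<ε))))
          d²<ε : ∀ n → N ℕ.≤ n → d² (s n) v < ε
          d²<ε n N≤n = close⇒d²<ε {η} {ε} (s n) v (proj₂ (proj₂ (small 0<ε))) λ i →
            proj₂ (coordinate-limits s cauchy) i {η} {N} (proj₂ (coordinates-cauchy s cauchy η (proj₁ (proj₂ (small 0<ε)))) i) n N≤n

    scaledEuclidean : HilbertSpace
    scaledEuclidean = record
      { vectorSpace = euclideanModule
      ; ⟨_,_⟩ = dot
      ; ⟨⟩-cong = λ u≈u′ v≈v′ → *-congˡ (sum-cong λ i → *-cong (u≈u′ i) (v≈v′ i))
      ; ⟨⟩-sym = λ u v → *-congˡ (sum-cong λ i → *-comm (u i) (v i))
      ; ⟨⟩-additive = λ u v w → trans (*-congˡ (trans (sum-cong λ i → distribʳ (w i) (u i) (v i)) (sum-+ (λ i → u i * w i) (λ i → v i * w i))))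
          (distribˡ c _ _)
      ; ⟨⟩-homogeneous = λ a u v → trans (*-congˡ (trans (sum-cong λ i → *-assoc a (u i) (v i)) (sum-* a (λ i → u i * v i))))
          (solve 3 (λ c a s → c :* (a :* s) := a :* (c :* s)) refl c a _)
      ; ⟨⟩-nonneg = λ u → *-nonneg (proj₁ 0<c) (sum-nonneg λ i → square-nonneg (u i))
      ; ⟨⟩-definite = λ u ⟨u,u⟩≈0 i → square-zero (u i) (sum-zero (λ j → square-nonneg (u j))
          (*-cancelˡ-≈ 0<c (trans ⟨u,u⟩≈0 (sym (zeroʳ c)))) i)
      ; complete = completeness
      }

-- From property 𝒢 to a vertex with many correlated partners.

module GeometricLemma (𝓡 : RealNumbers) where
  open Real 𝓡 hiding (zero)
  open OrderedField 𝓡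
  open Exponential 𝓡
  open HilbertSpaces 𝓡

  size : ∀ {n} → Subset n → ℝ
  size S = fromℕ ∣ S ∣

  indicator : ∀ {n} → Subset n → Fin n → ℝ
  indicator S v = if lookup S v then 1# else 0#

  indicator-nonneg : ∀ {n} (S : Subset n) v → 0# ≤ indicator S v
  indicator-nonneg S v with lookup S v
  ... | true  = 0≤1
  ... | false = ≤-refl

  indicator-∈ : ∀ {n} {S : Subset n} {v} → v ∈ S → indicator S v ≈ 1#
  indicator-∈ {S = S} {v} v∈S rewrite Vecₚ.[]=⇒lookup v∈S = refl

  sum-indicator : ∀ {n} (S : Subset n) → sum (indicator S) ≈ size S
  sum-indicator [] = refl
  sum-indicator (inside ∷ S)  = +-congˡ (sum-indicator S)
  sum-indicator (outside ∷ S) = trans (+-identityˡ _) (sum-indicator S)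

  indicator-∩ : ∀ {n} (S T : Subset n) v → indicator (S ∩ T) v ≈ indicator S v * indicator T v
  indicator-∩ S T v rewrite Vecₚ.lookup-zipWith _∧_ v S T with lookup S v | lookup T v
  ... | true  | true  = sym (*-identityˡ 1#)
  ... | true  | false = sym (zeroʳ 1#)
  ... | false | b     = sym (zeroˡ _)

  indicator-⊆ : ∀ {n} {S T : Subset n} → S ⊆ T → ∀ v → indicator S v * indicator T v ≈ indicator S v
  indicator-⊆ {S =
    S} {T} S⊆T v = trans (sym (indicator-∩ S T v)) (reflexive (≡.cong (λ U → indicator U v) S∩T≡S))
    where
    S∩T≡S : S ∩ T ≡ S
    S∩T≡S = Sub.⊆-antisym (Sub.p∩q⊆p S T) λ x∈S → Sub.x∈p∩q⁺ (x∈S , S⊆T x∈S)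

  -- As A and B lie in Y, multiplying their indicators by that of Y changes nothing, and bilinear
  -- expansion leaves only cardinalities.
  sum-indicator-product : ∀ {n} {A B Y : Subset n} (a : ℝ) → A ⊆ Y → B ⊆ Y →
    sum (λ v → (indicator A v - a * indicator Y v) * (indicator B v - a * indicator Y v))
      ≈ size (A ∩ B) - a * size A - a * size B + a * a * size Y
  sum-indicator-product {A = A} {B} {Y} a A⊆Y B⊆Y = begin
    sum (λ v → (indicator A v - a * indicator Y v) * (indicator B v - a * indicator Y v))
      ≈⟨ sum-cong pointwise ⟩
    sum (λ v → (indicator (A ∩ B) v + - a * indicator A v) + (- a * indicator B v + a * a * indicator Y v))
      ≈⟨ trans (sum-+ (λ v → indicator (A ∩ B) v + - a * indicator A v) (λ v → - a * indicator B v + a * a * indicator Y v))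
           (+-cong (sum-+ (indicator (A ∩ B)) (λ v → - a * indicator A v))
             (sum-+ (λ v → - a * indicator B v) (λ v → a * a * indicator Y v))) ⟩
    (sum (indicator (A ∩ B)) + sum (λ v → - a * indicator A v)) + (sum (λ v → - a * indicator B v) + sum (λ v → a * a * indicator Y v))
      ≈⟨ +-cong (+-cong (sum-indicator (A ∩ B)) (scaled (- a) A)) (+-cong (scaled (- a) B) (scaled (a * a) Y)) ⟩
    (size (A ∩ B) + - a * size A) + (- a * size B + a * a * size Y)
      ≈⟨ solve 5 (λ a x y z w → (x :+ :- a :* y) :+ (:- a :* z :+ a :* a :* w) := x :- a :* y :- a :* z :+ a :* a :* w) refl a _ _ _ _ ⟩
    size (A ∩ B) - a * size A - a * size B + a * a * size Y ∎
    where
    open import Relation.Binary.Reasoning.Setoid setoid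
    scaled : ∀ x S → sum (λ v → x * indicator S v) ≈ x * size S
    scaled x S = trans (sum-* x (indicator S)) (*-congˡ (sum-indicator S))
    pointwise : ∀ v → (indicator A v - a * indicator Y v) * (indicator B v - a * indicator Y v) ≈
      (indicator (A ∩ B) v + - a * indicator A v) + (- a * indicator B v + a * a * indicator Y v)
    pointwise v = trans
      (solve 4 (λ a x y z → (x :- a :* z) :* (y :- a :* z) :=
        (x :* y :+ :- a :* (x :* z)) :+ (:- a :* (y :* z) :+ a :* a :* (z :* z))) refl a (indicator A v) (indicator B v) (indicator Y v))
      (+-cong (+-cong (sym (indicator-∩ A B v)) (*-congˡ (indicator-⊆ A⊆Y v)))
        (+-cong (*-congˡ (indicator-⊆ B⊆Y v)) (*-congˡ (indicator-⊆ {S = Y} (λ v∈Y → v∈Y) v))))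

  ∈⇒1≤size : ∀ {n} {S : Subset n} {x} → x ∈ S → 1 ℕ.≤ ∣ S ∣
  ∈⇒1≤size {S = S} {x} x∈S = ≡.subst (ℕ._≤ ∣ S ∣) (Sub.∣⁅x⁆∣≡1 x)
    (Sub.p⊆q⇒∣p∣≤∣q∣ λ y∈⁅x⁆ → ≡.subst (_∈ S) (≡.sym (Sub.x∈⁅y⁆⇒x≡y x y∈⁅x⁆)) x∈S)

  module _ {n} (X : Subset n) {x₀ : Fin n} (x₀∈X : x₀ ∈ X) where

    private
      N = size X

      0<N : 0# < N
      0<N = fromℕ-pos (∈⇒1≤size x₀∈X)

      w = N ⁻¹

      0<w : 0# < w
      0<w = ⁻¹-pos 0<N

    uniform : Distribution n
    uniform = record
      { mass        = λ u → w * indicator X u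
      ; mass-nonneg = λ u → *-nonneg (proj₁ 0<w) (indicator-nonneg X u)
      ; mass-total  = trans (sum-* w (indicator X)) (trans (*-congˡ (sum-indicator X))
                        (trans (*-comm w N) (*-⁻¹ 0<N)))
      }

    module _ {E : Fin n → Fin n → Set} (E? : ∀ u u′ → Dec (E u u′)) where

      satisfying : Fin n → Subset n
      satisfying u = X ∩ tabulate (does ∘ E? u)

      private
        μ = Distribution.mass uniform

        row : ∀ u → sum (λ u′ → if does (E? u u′) then μ u * μ u′ else 0#) ≈ μ u * (w * size (satisfying u))
        row u =
          trans (sum-cong entry) (trans (sum-* (μ u) (λ u′ → w * indicator (satisfying u) u′)) (*-congˡ (trans (sum-* w (indicator (satisfying u)))
            (*-congˡ (sum-indicator (satisfying u))))))
          where
          entry : ∀ u′ → (if does (E? u u′) then μ u * μ u′ else 0#) ≈ μ u * (w * indicator (satisfying u) u′)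
          entry u′ rewrite Vecₚ.lookup-zipWith _∧_ u′ X (tabulate (does ∘ E? u)) | Vecₚ.lookup∘tabulate (does ∘ E? u) u′
            with does (E? u u′) | lookup X u′
          ... | true  | true  = refl
          ... | true  | false = refl
          ... | false | true  = sym (trans (*-congˡ (zeroʳ w)) (zeroʳ _))
          ... | false | false = sym (trans (*-congˡ (zeroʳ w)) (zeroʳ _))

      -- The probability is the average over u in X of the proportion of X that satisfies `E u`, so
      -- some u reaches it. Otherwise the deficits below have a positive term, no negative term, and
      -- a sum of at most 0.
      large-section : ∀ {c} → c ≤ ℙ[ uniform ] E? → ∃[ u ] (u ∈ X × c * N ≤ size (satisfying u))
      large-section {c} c≤ℙ with any? (λ u → (u Sub.∈? X) ×-dec (c * N ≤? size (satisfying u)))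
      ... | yes found = found
      ... | no ∄u = ⊥-elim (<⇒≱ positive (≤-trans (term≤sum deficit-nonneg x₀) Σ≤0))
        where
        R : Fin n → ℝ
        R u = w * size (satisfying u)
        R<c : ∀ {u} → u ∈ X → R u < c
        R<c {u} u∈X = ≰⇒> λ c≤R → ∄u (u , u∈X , ≤-trans (*-monoˡ-≤ (proj₁ 0<N) c≤R)
          (≤-reflexive (trans (solve 3 (λ w s N → w :* s :* N := s :* w :* N) refl w _ N) (/-cancel _ 0<N))))
        deficit : Fin n → ℝ
        deficit u = μ u * (c - R u)
        deficit-nonneg : ∀ u → 0# ≤ deficit u
        deficit-nonneg u with u Sub.∈? X
        ... | yes u∈X = *-nonneg (Distribution.mass-nonneg uniform u) (diff-nonneg (proj₁ (R<c u∈X)))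
        ... | no  u∉X = ≤-reflexive (sym (trans (*-congʳ (trans (*-congˡ (ind≈0 u∉X)) (zeroʳ w))) (zeroˡ _)))
          where
          ind≈0 : u ∉ X → indicator X u ≈ 0#
          ind≈0 u∉X with lookup X u in eq
          ... | true  = ⊥-elim (u∉X (Vecₚ.lookup⇒[]= u X eq))
          ... | false = refl
        positive : 0# < deficit x₀
        positive = *-pos (<-≤-trans (*-pos 0<w 0<1) (≤-reflexive (*-congˡ (sym (indicator-∈ x₀∈X)))))
          (diff-nonneg (proj₁ (R<c x₀∈X)) , λ 0≈c-R → proj₂ (R<c x₀∈X)
            (trans (sym (+-identityʳ _)) (trans (+-congˡ 0≈c-R) (solve 2 (λ r c → r :+ (c :- r) := c) refl (R x₀) c))))
        Σ≤0 : sum deficit ≤ 0#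
        Σ≤0 = begin
          sum deficit
            ≈⟨ sum-cong (λ u → solve 3 (λ m c r → m :* (c :- r) := c :* m :+ :- con (+ 1) :* (m :* r)) refl (μ u) c (R u)) ⟩
          sum (λ u → c * μ u + - 1# * (μ u * R u))
            ≈⟨ trans (sum-+ (λ u → c * μ u) (λ u → - 1# * (μ u * R u))) (+-cong (sum-* c μ) (sum-* (- 1#) (λ u → μ u * R u))) ⟩
          c * sum μ + - 1# * sum (λ u → μ u * R u)
            ≈⟨ +-cong (*-congˡ (Distribution.mass-total uniform)) (*-congˡ (sym (sum-cong row))) ⟩
          c * 1# + - 1# * ℙ[ uniform ] E?
            ≈⟨ solve 2 (λ c p → c :* con (+ 1) :+ :- con (+ 1) :* p := c :- p) refl c _ ⟩
          c - ℙ[ uniform ] E?                              ≤⟨ +-monoˡ-≤ _ c≤ℙ ⟩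
          ℙ[ uniform ] E? - ℙ[ uniform ] E?                ≈⟨ -‿inverseʳ _ ⟩
          0#                                               ∎
          where open ≤-Reasoning

  ∈-tabulate-does : ∀ {n} {P : Fin n → Set} (P? : ∀ v → Dec (P v)) {v} → v ∈ tabulate (does ∘ P?) → P v
  ∈-tabulate-does P? {v} v∈ with P? v | ≡.trans (≡.sym (Vecₚ.lookup∘tabulate (does ∘ P?) v)) (Vecₚ.[]=⇒lookup v∈)
  ... | yes Pv | _ = Pv
  ... | no _ | ()

  ∈-tabulate-does⁺ : ∀ {n} {P : Fin n → Set} (P? : ∀ v → Dec (P v)) {v} → P v → v ∈ tabulate (does ∘ P?)
  ∈-tabulate-does⁺ P? {v} Pv =
    Vecₚ.lookup⇒[]= v _ (≡.trans (Vecₚ.lookup∘tabulate (does ∘ P?) v) (does-true (P? v)))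
    where
    does-true : (d : Dec _) → does d ≡ true
    does-true (yes _) = ≡.refl
    does-true (no ¬p) = ⊥-elim (¬p Pv)

  -- All that the algorithm takes from 𝒢, with the probability bound abstracted to `factor`.
  -- `Correlated i ℓ x y` says that `M i y` has density at least q/|Y| + ℓ α inside `M i x`.
  GeometricProperty : ℕ → (ℝ → ℝ) → Set
  GeometricProperty r factor =
    ∀ {n} {X : Subset n} {x₀} → x₀ ∈ X →
    (Y : Fin r → Subset n) (M : Fin r → Fin n → Subset n) (q : Fin r → ℕ) (α : Fin r → ℝ) →
    (∀ i → 1 ℕ.≤ q i) → (∀ i → 0# < α i) →
    (∀ i {x} → x ∈ X → M i x ⊆ Y i × ∣ M i x ∣ ≡ q i) →
    let Correlated : Fin r → ℝ → Fin n → Fin n → Set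
        Correlated i ℓ x y = (fromℕ (q i) / size (Y i) + ℓ * α i) * fromℕ (q i) ≤ size (M i x ∩ M i y)
    in Σ[ x ∈ Fin n ] Σ[ X′ ∈ Subset n ] Σ[ i ∈ Fin r ] Σ[ ℓ ∈ ℝ ]
       x ∈ X × X′ ⊆ X × - 1# ≤ ℓ × factor ℓ * size X ≤ size X′ ×
       (∀ {y} → y ∈ X′ → Correlated i ℓ x y × (∀ j → j ≢ i → Correlated j (- 1#) x y))

  module _ {r d : ℕ} {β C : ℝ} (𝒢rd : 𝒢 r d β C) where

    -- With a the exact density q/|Y|, the vectors `σ i x` are orthogonal to the indicator of Y, so
    -- their inner products are |M x ∩ M y| - a q. Dividing by α q turns Z ≥ ℓ into correlation with
    -- parameter ℓ, and Z ≥ -1 into a loss of at most α. A large section of the event then fixes one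
    -- of the two vertices.
    geometric-lemma : GeometricProperty r (λ ℓ → β * exp (- (C * (ℓ + 1#) ^ʳ (1# / fromℕ d))))
    geometric-lemma {n} {X} {x₀} x₀∈X Y M q α 1≤q 0<α M-ok =
        x , satisfying X x₀∈X good? x , i , ℓ , proj₁ (proj₂ section) , Sub.p∩q⊆p X _ ,
        proj₁ (proj₂ (proj₂ 𝒢-instance)) , proj₂ (proj₂ section) , λ y∈X′ →
        let y∈X , y∈E = Sub.x∈p∩q⁻ X _ y∈X′
            ℓ≤Z , -1≤Z = ∈-tabulate-does (good? x) y∈E
        in correlated i (proj₁ (proj₂ section)) y∈X ℓ≤Z , λ j j≢i → correlated j (proj₁ (proj₂ section)) y∈X (-1≤Z j j≢i)
      where
      open ≤-Reasoning
      Q : Fin r → ℝ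
      Q i = fromℕ (q i)
      a : Fin r → ℝ
      a i = Q i / size (Y i)
      0<αQ : ∀ i → 0# < α i * Q i
      0<αQ i = *-pos (0<α i) (fromℕ-pos (1≤q i))
      H : Fin r → HilbertSpace
      H i = scaledEuclidean n ((α i * Q i) ⁻¹) (⁻¹-pos (0<αQ i))
      σ : ∀ i → Fin n → HilbertSpace.Carrierᴹ (H i)
      σ i x v = indicator (M i x) v - a i * indicator (Y i) v
      Z : Fin r → Fin n → Fin n → ℝ
      Z i u u′ = HilbertSpace.⟨_,_⟩ (H i) (σ i u) (σ i u′)
      𝒢-instance = 𝒢rd n (uniform X x₀∈X) H σ
      i = proj₁ 𝒢-instance
      ℓ = proj₁ (proj₂ 𝒢-instance)
      good? = goodEvent? Z i ℓ
      section = large-section X x₀∈X good? (proj₂ (proj₂ (proj₂ 𝒢-instance)))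
      x = proj₁ section
      aY≈Q : ∀ i → a i * size (Y i) ≈ Q i
      aY≈Q i = /-cancel (Q i) (fromℕ-pos (ℕₚ.≤-trans (1≤q i) (≡.subst (ℕ._≤ ∣ Y i ∣) (proj₂ (M-ok i x₀∈X))
        (Sub.p⊆q⇒∣p∣≤∣q∣ (proj₁ (M-ok i x₀∈X))))))
      inner : ∀ i {x y} → x ∈ X → y ∈ X →
        sum (λ v → σ i x v * σ i y v) ≈ size (M i x ∩ M i y) - a i * Q i
      inner i {x} {y} x∈X y∈X = trans (sum-indicator-product (a i) (proj₁ (M-ok i x∈X)) (proj₁ (M-ok i y∈X)))
        (trans (+-cong (+-cong (+-congˡ (-‿cong (*-congˡ (card x∈X)))) (-‿cong (*-congˡ (card y∈X))))
            (trans (*-assoc _ _ _) (*-congˡ (aY≈Q i))))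
          (solve 2 (λ m p → m :- p :- p :+ p := m :- p) refl _ _))
        where
        card : ∀ {x} → x ∈ X → size (M i x) ≈ Q i
        card x∈X = reflexive (≡.cong fromℕ (proj₂ (M-ok i x∈X)))
      correlated : ∀ i {x y ℓ} → x ∈ X → y ∈ X →
        ℓ ≤ (α i * Q i) ⁻¹ * sum (λ v → σ i x v * σ i y v) → (a i + ℓ * α i) * Q i ≤ size (M i x ∩ M i y)
      correlated i {x} {y} {ℓ} x∈X y∈X ℓ≤Z = begin
        (a i + ℓ * α i) * Q i
          ≈⟨ solve 4 (λ a l α q → (a :+ l :* α) :* q := a :* q :+ l :* (α :* q)) refl (a i) ℓ (α i) (Q i) ⟩
        a i * Q i + ℓ * (α i * Q i)
          ≤⟨ +-monoʳ-≤ _ (≤-/⁻¹ (0<αQ i) (≤-trans ℓ≤Z (≤-reflexive (*-comm _ _)))) ⟩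
        a i * Q i + sum (λ v → σ i x v * σ i y v) ≈⟨ +-congˡ (inner i x∈X y∈X) ⟩
        a i * Q i + (size (M i x ∩ M i y) - a i * Q i) ≈⟨ solve 2 (λ p m → p :+ (m :- p) := m) refl _ _ ⟩
        size (M i x ∩ M i y)         ∎

-- Subsets of prescribed size.

take : ∀ {n} → ℕ → Subset n → Subset n
take q       []            = []
take q       (outside ∷ S) = outside ∷ take q S
take zero    (inside ∷ S)  = outside ∷ take zero S
take (suc q) (inside ∷ S)  = inside ∷ take q S

take-⊆ : ∀ {n} q (S : Subset n) → take q S ⊆ S
take-⊆ q       (outside ∷ S) = Sub.s⊆s (take-⊆ q S)
take-⊆ zero    (inside ∷ S)  = Sub.out⊆ (take-⊆ zero S)
take-⊆ (suc q) (inside ∷ S)  = Sub.s⊆s (take-⊆ q S)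

∣take∣ : ∀ {n} q (S : Subset n) → q ℕ.≤ ∣ S ∣ → ∣ take q S ∣ ≡ q
∣take∣ zero    []            _         = ≡.refl
∣take∣ q       (outside ∷ S) q≤        = ∣take∣ q S q≤
∣take∣ zero    (inside ∷ S)  _         = ∣take∣ zero S ℕ.z≤n
∣take∣ (suc q) (inside ∷ S)  (ℕ.s≤s q≤) = ≡.cong suc (∣take∣ q S q≤)

∣S∪⁅x⁆∣ : ∀ {n} {S : Subset n} {x} → x ∉ S → ∣ S ∪ ⁅ x ⁆ ∣ ≡ suc ∣ S ∣
∣S∪⁅x⁆∣ {S = inside ∷ S}  {zero}  x∉S = ⊥-elim (x∉S here)
∣S∪⁅x⁆∣ {S = outside ∷ S} {zero}  x∉S = ≡.cong (λ U → suc ∣ U ∣) (Sub.∪-identityʳ S)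
∣S∪⁅x⁆∣ {S = inside ∷ S}  {suc x} x∉S = ≡.cong suc (∣S∪⁅x⁆∣ (x∉S ∘ there))
∣S∪⁅x⁆∣ {S = outside ∷ S} {suc x} x∉S = ∣S∪⁅x⁆∣ (x∉S ∘ there)

-- Rounding, updates of sums, and the pigeonhole principle for colours.

module Counting (𝓡 : RealNumbers) where
  open Real 𝓡 hiding (zero)
  open OrderedField 𝓡
  open Exponential 𝓡
  open HilbertSpaces 𝓡
  open GeometricLemma 𝓡

  private
    module Sum = Algebra.Properties.Semiring.Sum semiring

  -- Minimality is what allows trimming: every set with at least z elements has at least q of them,
  -- so sets of different sizes can be cut to the common size q.
  ceiling : ∀ z N → z ≤ fromℕ N → ∃[ q ] (z ≤ fromℕ q × (∀ {m} → z ≤ fromℕ m → q ℕ.≤ m))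
  ceiling z zero    z≤N = zero , z≤N , λ _ → ℕ.z≤n
  ceiling z (suc N) z≤N with z ≤? fromℕ N
  ... | yes z≤N′ = ceiling z N z≤N′
  ... | no  z≰N  = suc N , z≤N , λ {m} z≤m → case m ℕ.≤? N of λ where
    (yes m≤N) → ⊥-elim (z≰N (≤-trans z≤m (fromℕ-mono m≤N)))
    (no  m≰N) → ℕₚ.≰⇒> m≰N

  sum-updateAt : ∀ {r} {A : Set} (g : A → ℝ) (S : Fin r → A) j f {e} →
    g (f (S j)) ≈ g (S j) + e → sum (λ i → g (updateAt S j f i)) ≈ sum (λ i → g (S i)) + e
  sum-updateAt g S zero    f eq =
    trans (+-congʳ eq) (solve 3 (λ a e s → a :+ e :+ s := a :+ s :+ e) refl _ _ _)
  sum-updateAt g S (suc j) f eq = trans (+-congˡ (sum-updateAt g (S ∘ suc) j f eq)) (sym (+-assoc _ _ _))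

  module _ {r n} (G : EdgeColouring r n) where
    open EdgeColouring G

    ∈-neighbourhood⁻ : ∀ {i v w} → w ∈ neighbourhood G i v → v ≢ w × colour v w ≡ i
    ∈-neighbourhood⁻ {i} {v} = ∈-tabulate-does (λ w → ¬? (v ≟ w) ×-dec (colour v w ≟ i))

    ∈-neighbourhood⁺ : ∀ {i v w} → v ≢ w → colour v w ≡ i → w ∈ neighbourhood G i v
    ∈-neighbourhood⁺ {i} {v} v≢w vw≡i =
      ∈-tabulate-does⁺ (λ w → ¬? (v ≟ w) ×-dec (colour v w ≟ i)) (v≢w , vw≡i)

    -- The extra 1 accounts for x itself, which lies in none of its neighbourhoods.
    neighbourhoods-cover : ∀ (X : Subset n) x →
      size X ≤ sum (λ j → size (X ∩ neighbourhood G j x)) + 1#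
    neighbourhoods-cover X x = begin
      size X                                                       ≈⟨ sum-indicator X ⟨
      sum (indicator X)                                            ≤⟨ sum-mono pointwise ⟩
      sum (λ v → sum (λ j → indicator (N j) v) + indicator ⁅ x ⁆ v)
        ≈⟨ sum-+ (λ v → sum (λ j → indicator (N j) v)) (indicator ⁅ x ⁆) ⟩
      sum (λ v → sum (λ j → indicator (N j) v)) + sum (indicator ⁅ x ⁆)
        ≈⟨ +-cong (trans (Sum.∑-comm (λ v j → indicator (N j) v)) (sum-cong λ j → sum-indicator (N j)))
             (trans (sum-indicator ⁅ x ⁆) (trans (reflexive (≡.cong fromℕ (Sub.∣⁅x⁆∣≡1 x))) (+-identityʳ 1#))) ⟩
      sum (λ j → size (N j)) + 1#                                  ∎
      where
      open ≤-Reasoning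
      N : Fin r → Subset n
      N j = X ∩ neighbourhood G j x
      covered : ∀ v → Dec (x ≡ v) → v ∈ X → 1# ≤ sum (λ j → indicator (N j) v) + indicator ⁅ x ⁆ v
      covered v (yes ≡.refl) v∈X = ≤-from-diff (sum-nonneg (λ j → indicator-nonneg (N j) v))
        (trans (+-comm _ _) (+-congʳ (indicator-∈ (Sub.x∈⁅x⁆ v))))
      covered v (no x≢v) v∈X = begin
        1#                                  ≈⟨ indicator-∈ (Sub.x∈p∩q⁺ (v∈X , ∈-neighbourhood⁺ x≢v ≡.refl)) ⟨
        indicator (N (colour x v)) v        ≤⟨ term≤sum (λ j → indicator-nonneg (N j) v) (colour x v) ⟩
        sum (λ j → indicator (N j) v)       ≤⟨ ≤-from-diff (indicator-nonneg ⁅ x ⁆ v) refl ⟩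
        sum (λ j → indicator (N j) v) + indicator ⁅ x ⁆ v ∎
      pointwise : ∀ v → indicator X v ≤ sum (λ j → indicator (N j) v) + indicator ⁅ x ⁆ v
      pointwise v with lookup X v in eq
      ... | true  = covered v (x ≟ v) (Vecₚ.lookup⇒[]= v X eq)
      ... | false = +-nonneg (sum-nonneg (λ j → indicator-nonneg (N j) v)) (indicator-nonneg ⁅ x ⁆ v)

    -- If every colour failed, the deficits would all be positive, although they sum to at most 0;
    -- `j₀` supplies a positive term.
    popular-colour : ∀ (X : Subset n) x → Fin r →
      ∃[ j ] size X ≤ fromℕ r * size (X ∩ neighbourhood G j x) + 1#
    popular-colour X x j₀ with any? (λ j → size X ≤? fromℕ r * size (X ∩ neighbourhood G j x) + 1#)
    ... | yes found = found
    ... | no  ∄j = ⊥-elim (<⇒≱ (deficit-pos j₀) (≤-trans (term≤sum (λ j → proj₁ (deficit-pos j)) j₀) Σ≤0))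
      where
      open ≤-Reasoning
      s : Fin r → ℝ
      s j = size (X ∩ neighbourhood G j x)
      deficit : Fin r → ℝ
      deficit j = size X - 1# + - fromℕ r * s j
      deficit-pos : ∀ j → 0# < deficit j
      deficit-pos j = ≰⇒> λ deficit≤0 → ∄j (j , ≤-resp
        (solve 2 (λ x s → x :- con (+ 1) :+ s :+ (con (+ 1) :- s) := x) refl (size X) (- fromℕ r * s j))
        (solve 2 (λ r s → con (+ 0) :+ (con (+ 1) :- (:- r) :* s) := r :* s :+ con (+ 1)) refl (fromℕ r) (s j))
        (+-monoˡ-≤ (1# - (- fromℕ r * s j)) deficit≤0))
      Σ≤0 : sum deficit ≤ 0#
      Σ≤0 = begin
        sum deficit
          ≈⟨ sum-+ (λ _ → size X - 1#) (λ j → - fromℕ r * s j) ⟩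
        sum {r} (λ _ → size X - 1#) + sum (λ j → - fromℕ r * s j)
          ≈⟨ +-cong (sum-const r (size X - 1#)) (sum-* (- fromℕ r) s) ⟩
        fromℕ r * (size X - 1#) + - fromℕ r * sum s
          ≈⟨ solve 3 (λ r x s → r :* (x :- con (+ 1)) :+ :- r :* s := r :* x :- r :* (s :+ con (+ 1))) refl (fromℕ r) (size X) (sum s) ⟩
        fromℕ r * size X - fromℕ r * (sum s + 1#)
          ≤⟨ +-monoˡ-≤ _ (*-monoʳ-≤ (fromℕ-nonneg r) (neighbourhoods-cover X x)) ⟩
        fromℕ r * (sum s + 1#) - fromℕ r * (sum s + 1#)        ≈⟨ -‿inverseʳ _ ⟩
        0#                                                     ∎

updateAt-all : ∀ {r} {A : Set} (P : Fin r → A → Set) (S : Fin r → A) j f →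
  P j (f (S j)) → (∀ i → P i (S i)) → ∀ i → P i (updateAt S j f i)
updateAt-all P S j f Pj PS i with i ≟ j
... | yes ≡.refl = ≡.subst (P i) (≡.sym (updateAt-updates i S)) Pj
... | no  i≢j    = ≡.subst (P i) (≡.sym (updateAt-minimal i j S i≢j)) (PS i)

-- The book algorithm, for abstract step bounds.

module BookAlgorithm (𝓡 : RealNumbers) where
  open Real 𝓡 hiding (zero)
  open OrderedField 𝓡
  open Exponential 𝓡
  open HilbertSpaces 𝓡
  open GeometricLemma 𝓡
  open Counting 𝓡

  -- Φ accumulates multiplicative costs and τ the vertices lost one at a time. Since `exp (- e)` is
  -- at most 1, a later step does not magnify the earlier additive losses.
  exp-decay-step : ∀ {N x τ Φ Φ′ e σ s} → exp (- Φ) * N ≤ x + τ → 0# ≤ τ →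
    Φ′ ≈ Φ + e → 0# ≤ e → exp (- e) * x ≤ s + σ → exp (- Φ′) * N ≤ s + (τ + σ)
  exp-decay-step {N} {x} {τ} {Φ} {Φ′} {e} {σ} {s} inv 0≤τ Φ′≈ 0≤e x≤ = begin
    exp (- Φ′) * N                ≈⟨ *-congʳ (trans (exp-cong (trans (-‿cong Φ′≈)
                                       (solve 2 (λ f e → :- (f :+ e) := :- e :+ :- f) refl Φ e))) (exp-+ _ _)) ⟩
    exp (- e) * exp (- Φ) * N     ≈⟨ *-assoc _ _ _ ⟩
    exp (- e) * (exp (- Φ) * N)   ≤⟨ *-monoʳ-≤ (0≤exp _) inv ⟩
    exp (- e) * (x + τ)           ≈⟨ distribˡ _ _ _ ⟩
    exp (- e) * x + exp (- e) * τ
      ≤⟨ +-mono-≤ x≤ (≤-trans (*-monoˡ-≤ 0≤τ (≤-trans (exp-mono (-‿antimono-≤ 0≤e))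
                                       (≤-reflexive (trans (exp-cong (solve 0 (:- con (+ 0) := con (+ 0)) refl)) exp-0))))
                                       (≤-reflexive (*-identityˡ τ))) ⟩
    s + σ + τ                     ≈⟨ solve 3 (λ s σ τ → s :+ σ :+ τ := s :+ (τ :+ σ)) refl s σ τ ⟩
    s + (τ + σ)                   ∎
    where open ≤-Reasoning

  -- b stands for p - δ, and factor ℓ for the proportion of X that survives a step with parameter ℓ.
  record StepBounds (r t : ℕ) : Set where
    field
      b δ γ κ κ′ a K λ₀ Bmax : ℝ
      gain factor            : ℝ → ℝ
      1≤r           : 1 ℕ.≤ r
      1≤t           : 1 ℕ.≤ t
      0<b           : 0# < b
      0<δ           : 0# < δ
      0≤λ₀          : 0# ≤ λ₀
      0≤a           : 0# ≤ a
      0≤K           : 0# ≤ K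
      exp-κ≤b       : exp (- κ) ≤ b
      exp-γ≤1-1/t   : exp (- γ) ≤ 1# - fromℕ t ⁻¹
      exp-gain      : ∀ {ℓ} → λ₀ < ℓ → exp (gain ℓ) ≈ 1# + ℓ * fromℕ t ⁻¹
      gain-nonneg   : ∀ {ℓ} → λ₀ < ℓ → 0# ≤ gain ℓ
      -- A boost may shrink Y by a factor `exp (- κ)`; this loss is charged to its gain at rate
      -- `κ′`.
      κ≤κ′*gain     : ∀ {ℓ} → λ₀ < ℓ → κ ≤ κ′ * gain ℓ
      factor-pos    : ∀ ℓ → 0# < factor ℓ
      colour-factor : ∀ {ℓ} → ℓ ≤ λ₀ → fromℕ r * exp (- a) ≤ factor ℓ
      -- The last premise says that the excess after the boost is at most 1, and thereby bounds ℓ.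
      -- In the application the loss exponent grows like a power of ℓ but the gain only like a
      -- logarithm.
      boost-factor  : ∀ {ℓ B c} → λ₀ < ℓ → 0# ≤ B → c ℕ.< t →
                      δ * exp (B + gain ℓ - γ * fromℕ c) ≤ 1# → exp (- (K * gain ℓ)) ≤ factor ℓ
      boost-bound   : ∀ {B c} → 0# ≤ B → c ℕ.< t → δ * exp (B - γ * fromℕ c) ≤ 1# → B ≤ Bmax

  module _ {r t : ℕ} (bounds : StepBounds r t) where
    open StepBounds bounds

    private
      T# : ℝ
      T# = fromℕ t

      0<T# : 0# < T#
      0<T# = fromℕ-pos 1≤t

      0<T#⁻¹ : 0# < T# ⁻¹
      0<T#⁻¹ = ⁻¹-pos 0<T#

    -- State of the algorithm and its invariants.

    module Run {n : ℕ} (geometric : GeometricProperty r factor)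
               (G : EdgeColouring r n) (X₀ : Subset n) (Y₀ : Fin r → Subset n)
               (0<Y₀ : ∀ i → 0# < size (Y₀ i)) where
      open EdgeColouring G

      private
        N : Fin r → Fin n → Subset n
        N = neighbourhood G

      record ColourState : Set where
        field
          Y T : Subset n
          B   : ℝ

      open ColourState

      -- Lower bounds for p_i - p + δ and for |Y_i| / |Y₀ i| when |T_i| = c and the boosts in colour i have
      -- total logarithmic gain B.
      excess : ℝ → ℕ → ℝ
      excess B c = δ * exp (B - γ * fromℕ c)

      decay : ℝ → ℕ → ℝ
      decay B c = exp (- (κ * fromℕ c + κ′ * B))

      -- Membership in `N i u` excludes `u`, so `T-X` and `T-Y` also say that T is disjoint from X
      -- and from Y.
      record Valid (i : Fin r) (X : Subset n) (s : ColourState) : Set where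
        field
          Y⊆Y₀   : Y s ⊆ Y₀ i
          T⊆X₀   : T s ⊆ X₀
          clique : IsClique G i (T s)
          T-X    : ∀ {u v} → u ∈ T s → v ∈ X → v ∈ N i u
          T-Y    : ∀ {u v} → u ∈ T s → v ∈ Y s → v ∈ N i u
          0≤B    : 0# ≤ B s
          dense  : ∀ {x} → x ∈ X → (b + excess (B s) ∣ T s ∣) * size (Y s) ≤ size (N i x ∩ Y s)
          bigY   : decay (B s) ∣ T s ∣ * size (Y₀ i) ≤ size (Y s)

      -- The bound on B is recorded because `boost-bound` speaks only of fewer than t vertices. It
      -- is obtained just before the last vertex is added, which leaves B unchanged.
      Outcome : Set
      Outcome = Σ[ i ∈ Fin r ] Σ[ X ∈ Subset n ] Σ[ s ∈ ColourState ] (Valid i X s × ∣ T s ∣ ≡ t × B s ≤ Bmax)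

      weaken : ∀ {i X X′ s} → X′ ⊆ X → Valid i X s → Valid i X′ s
      weaken X′⊆X v = record
        { Y⊆Y₀ = Y⊆Y₀ ; T⊆X₀ = T⊆X₀ ; clique = clique ; T-X = λ u∈T v∈X′ → T-X u∈T (X′⊆X v∈X′)
        ; T-Y = T-Y ; 0≤B = 0≤B ; dense = λ x∈X′ → dense (X′⊆X x∈X′) ; bigY = bigY }
        where open Valid v

      0<excess : ∀ B c → 0# < excess B c
      0<excess B c = *-pos 0<δ (0<exp _)

      0<sizeY : ∀ {i X s} → Valid i X s → 0# < size (Y s)
      0<sizeY {i} v = <-≤-trans (*-pos (0<exp _) (0<Y₀ i)) (Valid.bigY v)

      -- A vertex of X realises the lower bound by an actual density, which is at most 1.
      excess≤1 : ∀ {i X s x} → Valid i X s → x ∈ X → excess (B s) ∣ T s ∣ ≤ 1#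
      excess≤1 {i} {X} {s} {x} v x∈X = ≤-trans
        (≤-from-diff (proj₁ 0<b) (+-comm b _))
        (*-cancelʳ-≤ (0<sizeY v) (≤-trans (Valid.dense v x∈X)
          (≤-trans (fromℕ-mono (Sub.p⊆q⇒∣p∣≤∣q∣ (Sub.p∩q⊆q (N i x) (Y s)))) (≤-reflexive (sym (*-identityˡ _))))))

      B≤Bmax : ∀ {i X s x} → Valid i X s → x ∈ X → ∣ T s ∣ ℕ.< t → B s ≤ Bmax
      B≤Bmax v x∈X T<t = boost-bound (Valid.0≤B v) T<t (excess≤1 v x∈X)

      cost : ColourState → ℝ
      cost s = a * size (T s) + K * B s

      -- The clique sizes on the right compensate for the chosen vertices, each of which leaves X
      -- when it joins a clique.
      invariant : Subset n → (Fin r → ColourState) → Set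
      invariant X S = exp (- sum (λ i → cost (S i))) * size X₀ ≤ size X + sum (λ i → size (T (S i)))

      -- A single step: trimmed neighbourhoods and the two kinds of update.

      module Step {X : Subset n} {S : Fin r → ColourState} {x₀ : Fin n} (x₀∈X : x₀ ∈ X)
                  (valid : ∀ i → Valid i X (S i)) where

        D : Fin r → ℝ
        D i = excess (B (S i)) ∣ T (S i) ∣

        0<D : ∀ i → 0# < D i
        0<D i = 0<excess (B (S i)) ∣ T (S i) ∣

        z : Fin r → ℝ
        z i = (b + D i) * size (Y (S i))

        z≤N∩Y : ∀ i {x} → x ∈ X → z i ≤ size (N i x ∩ Y (S i))
        z≤N∩Y i = Valid.dense (valid i)

        z≤Y : ∀ i → z i ≤ size (Y (S i))
        z≤Y i = ≤-trans (z≤N∩Y i x₀∈X) (fromℕ-mono (Sub.p⊆q⇒∣p∣≤∣q∣ (Sub.p∩q⊆q (N i x₀) (Y (S i)))))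

        q : Fin r → ℕ
        q i = proj₁ (ceiling (z i) ∣ Y (S i) ∣ (z≤Y i))

        Q : Fin r → ℝ
        Q i = fromℕ (q i)

        z≤Q : ∀ i → z i ≤ Q i
        z≤Q i = proj₁ (proj₂ (ceiling (z i) ∣ Y (S i) ∣ (z≤Y i)))

        q≤N∩Y : ∀ i {x} → x ∈ X → q i ℕ.≤ ∣ N i x ∩ Y (S i) ∣
        q≤N∩Y i x∈X = proj₂ (proj₂ (ceiling (z i) ∣ Y (S i) ∣ (z≤Y i))) (z≤N∩Y i x∈X)

        q≤Y : ∀ i → q i ℕ.≤ ∣ Y (S i) ∣
        q≤Y i = proj₂ (proj₂ (ceiling (z i) ∣ Y (S i) ∣ (z≤Y i))) (z≤Y i)

        0<Y : ∀ i → 0# < size (Y (S i))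
        0<Y i = 0<sizeY (valid i)

        0<Q : ∀ i → 0# < Q i
        0<Q i = <-≤-trans (*-pos (+-pos-nonneg 0<b (proj₁ (0<D i))) (0<Y i)) (z≤Q i)

        P : Fin r → ℝ
        P i = Q i / size (Y (S i))

        b+D≤P : ∀ i → b + D i ≤ P i
        b+D≤P i = ≤-/ (0<Y i) (z≤Q i)

        D≤P-b : ∀ i → D i ≤ P i - b
        D≤P-b i = ≤-resp (solve 2 (λ b d → b :+ d :+ :- b := d) refl b (D i)) refl (+-monoˡ-≤ (- b) (b+D≤P i))

        α : Fin r → ℝ
        α i = (P i - b) * T# ⁻¹

        0<α : ∀ i → 0# < α i
        0<α i = *-pos (<-≤-trans (0<D i) (D≤P-b i)) 0<T#⁻¹

        -- Trimming the neighbourhoods to a common size q makes q / |Y| the exact density of each of them.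
        M : Fin r → Fin n → Subset n
        M i x = take (q i) (N i x ∩ Y (S i))

        M⊆N : ∀ i x → M i x ⊆ N i x
        M⊆N i x = Sub.p∩q⊆p (N i x) _ ∘ take-⊆ (q i) _

        M⊆Y : ∀ i x → M i x ⊆ Y (S i)
        M⊆Y i x = Sub.p∩q⊆q (N i x) _ ∘ take-⊆ (q i) _

        ∣M∣ : ∀ i {x} → x ∈ X → ∣ M i x ∣ ≡ q i
        ∣M∣ i x∈X = ∣take∣ (q i) (N i _ ∩ Y (S i)) (q≤N∩Y i x∈X)

        sizeM : ∀ i {x} → x ∈ X → size (M i x) ≈ Q i
        sizeM i x∈X = reflexive (≡.cong fromℕ (∣M∣ i x∈X))

        M∩M≤N∩M : ∀ i x y → size (M i x ∩ M i y) ≤ size (N i y ∩ M i x)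
        M∩M≤N∩M i x y = fromℕ-mono (Sub.p⊆q⇒∣p∣≤∣q∣ λ v∈ → let v∈Mx , v∈My = Sub.x∈p∩q⁻ (M i x) (M i y) v∈ in
          Sub.x∈p∩q⁺ (M⊆N i y v∈My , v∈Mx))

        b*Y≤Q : ∀ i → b * size (Y (S i)) ≤ Q i
        b*Y≤Q i = ≤-trans (*-monoˡ-≤ (proj₁ (0<Y i)) (≤-from-diff (proj₁ (0<D i)) refl)) (z≤Q i)

        -- Passing from Y to `M i x` costs at most a factor b, which is at least `exp (- κ)`. The
        -- premise says that the new state has paid κ for it, by one more vertex or by the gain of a
        -- boost.
        bigM : ∀ i {x B′ c} → x ∈ X →
          - (κ * fromℕ c + κ′ * B′) ≤ - κ + - (κ * size (T (S i)) + κ′ * B (S i)) →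
          decay B′ c * size (Y₀ i) ≤ size (M i x)
        bigM i {x} {B′} {c} x∈X exponent≤ = begin
          decay B′ c * size (Y₀ i)
            ≤⟨ *-monoˡ-≤ (proj₁ (0<Y₀ i)) (exp-mono exponent≤) ⟩
          exp (- κ + - (κ * size (T (S i)) + κ′ * B (S i))) * size (Y₀ i)
            ≈⟨ trans (*-congʳ (exp-+ _ _)) (*-assoc _ _ _) ⟩
          exp (- κ) * (decay (B (S i)) ∣ T (S i) ∣ * size (Y₀ i))
            ≤⟨ *-monoʳ-≤ (0≤exp _) (Valid.bigY (valid i)) ⟩
          exp (- κ) * size (Y (S i))
            ≤⟨ *-monoˡ-≤ (proj₁ (0<Y i)) exp-κ≤b ⟩
          b * size (Y (S i))
            ≤⟨ b*Y≤Q i ⟩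
          Q i
            ≈⟨ sizeM i x∈X ⟨
          size (M i x) ∎
          where open ≤-Reasoning

        addVertex : Fin r → Fin n → ColourState → ColourState
        addVertex j x s = record { Y = M j x ; T = T s ∪ ⁅ x ⁆ ; B = B s }

        x∉T : ∀ j {x} → x ∈ X → x ∉ T (S j)
        x∉T j x∈X x∈T = proj₁ (∈-neighbourhood⁻ G (Valid.T-X (valid j) x∈T x∈X)) ≡.refl

        -- A loss of α = (P - b)/t multiplies the excess over b by 1 - 1/t, which is at least
        -- `exp (- γ)`, the allowance for one more vertex.
        addVertex-valid : ∀ {j x X″} → x ∈ X → X″ ⊆ X → x ∈ X₀ → X″ ⊆ N j x →
          (∀ {y} → y ∈ X″ → (P j + - 1# * α j) * Q j ≤ size (M j x ∩ M j y)) →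
          Valid j X″ (addVertex j x (S j))
        addVertex-valid {j} {x} {X″} x∈X X″⊆X x∈X₀ X″⊆N correlated = record
          { Y⊆Y₀   = Valid.Y⊆Y₀ v ∘ M⊆Y j x
          ; T⊆X₀   = λ u∈ → by-cases (Valid.T⊆X₀ v) x∈X₀ u∈
          ; clique = λ u∈ w∈ u≢w → clique′ u≢w (Sub.x∈p∪q⁻ (T (S j)) ⁅ x ⁆ u∈) (Sub.x∈p∪q⁻ (T (S j)) ⁅ x ⁆ w∈)
          ; T-X    = λ u∈ w∈X″ → by-cases {λ u → _ ∈ N j u} (λ u∈T → Valid.T-X v u∈T (X″⊆X w∈X″)) (X″⊆N w∈X″) u∈
          ; T-Y    = λ u∈ w∈M → by-cases {λ u → _ ∈ N j u} (λ u∈T → Valid.T-Y v u∈T (M⊆Y j x w∈M)) (M⊆N j x w∈M) u∈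
          ; 0≤B    = Valid.0≤B v
          ; dense  = dense′
          ; bigY   = bigM j {c = ∣ T (S j) ∪ ⁅ x ⁆ ∣} x∈X (≤-reflexive (trans (-‿cong (+-congʳ (*-congˡ c+1)))
              (solve 3 (λ k c e → :- (k :* (con (+ 1) :+ c) :+ e) := :- k :+ :- (k :* c :+ e)) refl κ _ _)))
          }
          where
          open ≤-Reasoning
          v = valid j
          by-cases : ∀ {R : Fin n → Set} {u} → (∀ {u} → u ∈ T (S j) → R u) → R x → u ∈ T (S j) ∪ ⁅ x ⁆ → R u
          by-cases {R} {u} old new u∈ = case Sub.x∈p∪q⁻ (T (S j)) ⁅ x ⁆ u∈ of λ where
            (inj₁ u∈T) → old u∈T
            (inj₂ u∈x) → ≡.subst R (≡.sym (Sub.x∈⁅y⁆⇒x≡y x u∈x)) new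
          coloured : ∀ {u} → u ∈ T (S j) → colour u x ≡ j
          coloured u∈T = proj₂ (∈-neighbourhood⁻ G (Valid.T-X v u∈T x∈X))
          clique′ : ∀ {u w} → u ≢ w → u ∈ T (S j) ⊎ u ∈ ⁅ x ⁆ → w ∈ T (S j) ⊎ w ∈ ⁅ x ⁆ → colour u w ≡ j
          clique′ u≢w (inj₁ u∈T) (inj₁ w∈T) = Valid.clique v u∈T w∈T u≢w
          clique′ {u} u≢w (inj₁ u∈T) (inj₂ w∈x) = ≡.subst (λ w → colour u w ≡ j) (≡.sym (Sub.x∈⁅y⁆⇒x≡y x w∈x)) (coloured u∈T)
          clique′ {u} {w} u≢w (inj₂ u∈x) (inj₁ w∈T) = ≡.subst (λ u → colour u w ≡ j) (≡.sym (Sub.x∈⁅y⁆⇒x≡y x u∈x))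
            (≡.trans (colour-sym x w) (coloured w∈T))
          clique′ u≢w (inj₂ u∈x) (inj₂ w∈x) = ⊥-elim (u≢w (≡.trans (Sub.x∈⁅y⁆⇒x≡y x u∈x) (≡.sym (Sub.x∈⁅y⁆⇒x≡y x w∈x))))
          c+1 : size (T (S j) ∪ ⁅ x ⁆) ≈ 1# + size (T (S j))
          c+1 = reflexive (≡.cong fromℕ (∣S∪⁅x⁆∣ (x∉T j x∈X)))
          excess′ : excess (B (S j)) ∣ T (S j) ∪ ⁅ x ⁆ ∣ ≈ D j * exp (- γ)
          excess′ = trans (*-congˡ (trans (exp-cong (trans (+-congˡ (-‿cong (*-congˡ c+1)))
              (solve 3 (λ b g c → b :- g :* (con (+ 1) :+ c) := (b :- g :* c) :+ :- g) refl (B (S j)) γ (size (T (S j))))))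
            (exp-+ _ _))) (sym (*-assoc _ _ _))
          dense′ : ∀ {y} → y ∈ X″ → (b + excess (B (S j)) ∣ T (S j) ∪ ⁅ x ⁆ ∣) * size (M j x) ≤ size (N j y ∩ M j x)
          dense′ {y} y∈X″ = begin
            (b + excess (B (S j)) ∣ T (S j) ∪ ⁅ x ⁆ ∣) * size (M j x)
              ≈⟨ *-cong (+-congˡ excess′) (sizeM j x∈X) ⟩
            (b + D j * exp (- γ)) * Q j
              ≤⟨ *-monoˡ-≤ (proj₁ (0<Q j)) (+-monoʳ-≤ b (*-mono-≤
                   (≤-trans (proj₁ (0<D j)) (D≤P-b j)) (0≤exp _) (D≤P-b j) exp-γ≤1-1/t)) ⟩
            (b + (P j - b) * (1# - T# ⁻¹)) * Q j
              ≈⟨ *-congʳ (solve 3 (λ b p i → b :+ (p :- b) :* (con (+ 1) :- i) := p :+ :- con (+ 1) :* ((p :- b) :* i)) refl b (P j) (T# ⁻¹)) ⟩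
            (P j + - 1# * α j) * Q j
              ≤⟨ correlated y∈X″ ⟩
            size (M j x ∩ M j y)
              ≤⟨ M∩M≤N∩M j x y ⟩
            size (N j y ∩ M j x) ∎

        boost : Fin r → Fin n → ℝ → ColourState → ColourState
        boost i x ℓ s = record { Y = M i x ; T = T s ; B = B s + gain ℓ }

        -- A gain of ℓ α multiplies the excess over b by 1 + ℓ/t, which is `exp (gain ℓ)`.
        boost-valid : ∀ {i x X′ ℓ} → x ∈ X → X′ ⊆ X → λ₀ < ℓ →
          (∀ {y} → y ∈ X′ → (P i + ℓ * α i) * Q i ≤ size (M i x ∩ M i y)) →
          Valid i X′ (boost i x ℓ (S i))
        boost-valid {i} {x} {X′} {ℓ} x∈X X′⊆X λ₀<ℓ correlated = record
          { Y⊆Y₀   = Valid.Y⊆Y₀ v ∘ M⊆Y i x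
          ; T⊆X₀   = Valid.T⊆X₀ v
          ; clique = Valid.clique v
          ; T-X    = λ u∈T w∈X′ → Valid.T-X v u∈T (X′⊆X w∈X′)
          ; T-Y    = λ u∈T w∈M → Valid.T-Y v u∈T (M⊆Y i x w∈M)
          ; 0≤B    = +-nonneg (Valid.0≤B v) (gain-nonneg λ₀<ℓ)
          ; dense  = dense′
          ; bigY   = bigM i {c = ∣ T (S i) ∣} x∈X (≤-from-diff (diff-nonneg (κ≤κ′*gain λ₀<ℓ))
              (solve 5 (λ k k′ c b g → :- k :+ :- (k :* c :+ k′ :* b) := :- (k :* c :+ k′ :* (b :+ g)) :+ (k′ :* g :- k)) refl
                κ κ′ (size (T (S i))) (B (S i)) (gain ℓ)))
          }
          where
          open ≤-Reasoning
          v = valid i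
          excess′ : excess (B (S i) + gain ℓ) ∣ T (S i) ∣ ≈ D i * (1# + ℓ * T# ⁻¹)
          excess′ = trans (*-congˡ (trans (exp-cong
              (solve 3 (λ b g c → b :+ g :- c := (b :- c) :+ g) refl (B (S i)) (gain ℓ) (γ * size (T (S i)))))
            (trans (exp-+ _ _) (*-congˡ (exp-gain λ₀<ℓ))))) (sym (*-assoc _ _ _))
          dense′ : ∀ {y} → y ∈ X′ → (b + excess (B (S i) + gain ℓ) ∣ T (S i) ∣) * size (M i x) ≤ size (N i y ∩ M i x)
          dense′ {y} y∈X′ = begin
            (b + excess (B (S i) + gain ℓ) ∣ T (S i) ∣) * size (M i x)
              ≈⟨ *-cong (+-congˡ excess′) (sizeM i x∈X) ⟩
            (b + D i * (1# + ℓ * T# ⁻¹)) * Q i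
              ≤⟨ *-monoˡ-≤ (proj₁ (0<Q i)) (+-monoʳ-≤ b (*-monoˡ-≤
                   (+-nonneg 0≤1 (*-nonneg (≤-trans 0≤λ₀ (proj₁ λ₀<ℓ)) (proj₁ 0<T#⁻¹))) (D≤P-b i))) ⟩
            (b + (P i - b) * (1# + ℓ * T# ⁻¹)) * Q i
              ≈⟨ *-congʳ (solve 4 (λ b p i l → b :+ (p :- b) :* (con (+ 1) :+ l :* i) := p :+ l :* ((p :- b) :* i)) refl b (P i) (T# ⁻¹) ℓ) ⟩
            (P i + ℓ * α i) * Q i
              ≤⟨ correlated y∈X′ ⟩
            size (M i x ∩ M i y)
              ≤⟨ M∩M≤N∩M i x y ⟩
            size (N i y ∩ M i x) ∎

        -- At density 1 a boost is impossible, since it would need an intersection larger than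
        -- `M i x`. This makes Y shrink strictly even when X does not.
        q<Y : ∀ {i x y ℓ} → x ∈ X → λ₀ < ℓ → (P i + ℓ * α i) * Q i ≤ size (M i x ∩ M i y) → q i ℕ.< ∣ Y (S i) ∣
        q<Y {i} {x} {y} {ℓ} x∈X λ₀<ℓ correlated = ℕₚ.≰⇒> λ Y≤q → <⇒≱ (≤-<-trans
            (≤-/ (0<Y i) (≤-trans (≤-reflexive (*-identityˡ _)) (fromℕ-mono Y≤q))) (x<x+y (*-pos (≤-<-trans 0≤λ₀ λ₀<ℓ) (0<α i))))
          (*-cancelʳ-≤ (0<Q i) (≤-trans correlated (≤-trans
            (fromℕ-mono (Sub.p⊆q⇒∣p∣≤∣q∣ (Sub.p∩q⊆p (M i x) (M i y))))
            (≤-reflexive (trans (sizeM i x∈X) (sym (*-identityˡ _)))))))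

      -- Running the algorithm to the end.

      module _ (large : fromℕ r * T# < exp (- (fromℕ r * (a * T# + K * Bmax))) * size X₀) where

        -- For empty X the invariant would bound its left side by the total clique size, at most rt,
        -- against `large`.
        invariant⇒nonempty : ∀ {X S} → (∀ i → ∣ T (S i) ∣ ℕ.≤ t) → (∀ i → B (S i) ≤ Bmax) →
          invariant X S → Nonempty X
        invariant⇒nonempty {X} {S} T≤t B≤ inv = case Sub.nonempty? X of λ where
            (yes nonempty) → nonempty
            (no  empty)    → ⊥-elim (<⇒≱ large (≤-trans large≤ (≤-trans inv (τ≤ empty))))
          where
          open ≤-Reasoning
          cost≤ : ∀ i → cost (S i) ≤ a * T# + K * Bmax
          cost≤ i = +-mono-≤ (*-monoʳ-≤ 0≤a (fromℕ-mono (T≤t i))) (*-monoʳ-≤ 0≤K (B≤ i))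
          large≤ : exp (- (fromℕ r * (a * T# + K * Bmax))) * size X₀ ≤ exp (- sum (λ i → cost (S i))) * size X₀
          large≤ = *-monoˡ-≤ (fromℕ-nonneg ∣ X₀ ∣) (exp-mono (-‿antimono-≤
            (≤-trans (sum-mono cost≤) (≤-reflexive (sum-const r (a * T# + K * Bmax))))))
          τ≤ : ¬ Nonempty X → size X + sum (λ i → size (T (S i))) ≤ fromℕ r * T#
          τ≤ empty = begin
            size X + sum (λ i → size (T (S i)))
              ≤⟨ +-mono-≤ (≤-reflexive (reflexive (≡.cong fromℕ (≡.trans (≡.cong ∣_∣ (Sub.Empty-unique empty)) (Sub.∣⊥∣≡0 n)))))
                   (sum-mono λ i → fromℕ-mono (T≤t i)) ⟩
            0# + sum {r} (λ _ → T#)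
              ≈⟨ trans (+-identityˡ _) (sum-const r T#) ⟩
            fromℕ r * T# ∎

        size-pos⇒nonempty : ∀ {X : Subset n} → 0# < size X → Nonempty X
        size-pos⇒nonempty {X} 0<X = case Sub.nonempty? X of λ where
          (yes nonempty) → nonempty
          (no  empty)    → ⊥-elim (<⇒≱ 0<X (≤-reflexive (reflexive (≡.cong fromℕ
            (≡.trans (≡.cong ∣_∣ (Sub.Empty-unique empty)) (Sub.∣⊥∣≡0 n))))))

        -- A vertex step removes x from X and a boost shrinks one of the Y, so the sum drops by at
        -- least 1 in every step.
        measure : Subset n → (Fin r → ColourState) → ℝ
        measure X S = size X + sum (λ i → size (Y (S i)))

        run : ∀ fuel {X S x₀} → x₀ ∈ X → X ⊆ X₀ → (∀ i → Valid i X (S i)) → (∀ i → ∣ T (S i) ∣ ℕ.< t) →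
          invariant X S → measure X S ≤ fromℕ fuel → Outcome
        run zero {X} {S} x₀∈X _ _ _ _ measure≤0 = ⊥-elim (<⇒≱ (fromℕ-pos (∈⇒1≤size x₀∈X))
          (≤-trans (≤-from-diff (sum-nonneg λ i → fromℕ-nonneg ∣ Y (S i) ∣) refl) measure≤0))
        run (suc fuel) {X} {S} {x₀} x₀∈X X⊆X₀ valid T<t inv measure≤ = case ℓ ≤? λ₀ of λ where
            (yes ℓ≤λ₀) → colourStep ℓ≤λ₀
            (no  ℓ≰λ₀) → boostStep (≰⇒> ℓ≰λ₀)
          where
          open ≤-Reasoning
          open Step {X} {S} x₀∈X valid
          found = geometric x₀∈X (λ i → Y (S i)) M q α (λ i → fromℕ-reflects-< (0<Q i)) 0<α
            (λ i {x} x∈X → M⊆Y i x , ∣M∣ i x∈X)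
          x : Fin n
          x = proj₁ found
          X′ : Subset n
          X′ = proj₁ (proj₂ found)
          i* : Fin r
          i* = proj₁ (proj₂ (proj₂ found))
          ℓ : ℝ
          ℓ = proj₁ (proj₂ (proj₂ (proj₂ found)))
          facts = proj₂ (proj₂ (proj₂ (proj₂ found)))
          x∈X : x ∈ X
          x∈X = proj₁ facts
          X′⊆X : X′ ⊆ X
          X′⊆X = proj₁ (proj₂ facts)
          -1≤ℓ : - 1# ≤ ℓ
          -1≤ℓ = proj₁ (proj₂ (proj₂ facts))
          X′-large : factor ℓ * size X ≤ size X′
          X′-large = proj₁ (proj₂ (proj₂ (proj₂ facts)))
          correlated : ∀ {y} → y ∈ X′ → (P i* + ℓ * α i*) * Q i* ≤ size (M i* x ∩ M i* y)
          correlated y∈X′ = proj₁ (proj₂ (proj₂ (proj₂ (proj₂ facts))) y∈X′)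
          -- The vertex may be added in any colour, including `i*`, where the bound with -1 follows
          -- from `-1≤ℓ`.
          correlated≥-1 : ∀ j {y} → y ∈ X′ → (P j + - 1# * α j) * Q j ≤ size (M j x ∩ M j y)
          correlated≥-1 j y∈X′ = case j ≟ i* of λ where
            (yes ≡.refl) → ≤-trans (*-monoˡ-≤ (proj₁ (0<Q i*)) (+-monoʳ-≤ (P i*) (*-monoˡ-≤ (proj₁ (0<α i*)) -1≤ℓ)))
                             (correlated y∈X′)
            (no  j≢i)    → proj₂ (proj₂ (proj₂ (proj₂ (proj₂ facts))) y∈X′) j j≢i

          Φ τ : ℝ
          Φ = sum (λ i → cost (S i))
          τ = sum (λ i → size (T (S i)))

          0≤τ : 0# ≤ τ
          0≤τ = sum-nonneg λ i → fromℕ-nonneg ∣ T (S i) ∣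

          invariant-step : ∀ {Φ′ e σ s} → Φ′ ≈ Φ + e → 0# ≤ e → exp (- e) * size X ≤ s + σ →
            exp (- Φ′) * size X₀ ≤ s + (τ + σ)
          invariant-step = exp-decay-step inv 0≤τ

          measure-step : ∀ X₁ j f → ∣ X₁ ∣ ℕ.+ ∣ Y (f (S j)) ∣ ℕ.< ∣ X ∣ ℕ.+ ∣ Y (S j) ∣ →
            measure X₁ (updateAt S j f) ≤ fromℕ fuel
          measure-step X₁ j f decrease = begin
            size X₁ + sum (λ i → size (Y (updateAt S j f i)))
              ≈⟨ +-congˡ (sum-updateAt (λ s → size (Y s)) S j f (solve 2 (λ u v → u := v :+ (u :- v)) refl _ _)) ⟩
            size X₁ + (Σ + (y′ - y))
              ≈⟨ solve 4 (λ x s y′ y → x :+ (s :+ (y′ :- y)) := (con (+ 1) :+ (x :+ y′)) :+ (s :- y :- con (+ 1))) refl (size X₁) Σ y′ y ⟩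
            (1# + (size X₁ + y′)) + (Σ - y - 1#)
              ≤⟨ +-monoˡ-≤ _ (≤-resp (+-congˡ (fromℕ-+ ∣ X₁ ∣ ∣ Y (f (S j)) ∣)) (fromℕ-+ ∣ X ∣ ∣ Y (S j) ∣) (fromℕ-mono decrease)) ⟩
            (size X + y) + (Σ - y - 1#)
              ≈⟨ solve 3 (λ x y s → (x :+ y) :+ (s :- y :- con (+ 1)) := (x :+ s) :- con (+ 1)) refl (size X) y Σ ⟩
            measure X S - 1#
              ≤⟨ +-monoˡ-≤ (- 1#) measure≤ ⟩
            1# + fromℕ fuel - 1#
              ≈⟨ solve 1 (λ f → con (+ 1) :+ f :- con (+ 1) := f) refl (fromℕ fuel) ⟩
            fromℕ fuel ∎
            where
            Σ y y′ : ℝ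
            Σ = sum (λ i → size (Y (S i)))
            y = size (Y (S j))
            y′ = size (Y (f (S j)))

          colourStep : ℓ ≤ λ₀ → Outcome
          colourStep ℓ≤λ₀ = case suc ∣ T (S j) ∣ ℕ.≟ t of λ where
              (yes T+1≡t) → finished T+1≡t
              (no  T+1≢t) → continue T+1≢t
            where
            j : Fin r
            j = proj₁ (popular-colour G X′ x i*)
            X″ : Subset n
            X″ = X′ ∩ N j x
            X′≤ : size X′ ≤ fromℕ r * size X″ + 1#
            X′≤ = proj₂ (popular-colour G X′ x i*)
            X″⊆X : X″ ⊆ X
            X″⊆X = X′⊆X ∘ Sub.p∩q⊆p X′ (N j x)
            s′ : ColourState
            s′ = addVertex j x (S j)
            S′ : Fin r → ColourState
            S′ = updateAt S j (addVertex j x)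
            ∣T′∣ : ∣ T s′ ∣ ≡ suc ∣ T (S j) ∣
            ∣T′∣ = ∣S∪⁅x⁆∣ (x∉T j x∈X)
            valid′ : Valid j X″ s′
            valid′ = addVertex-valid x∈X X″⊆X (X⊆X₀ x∈X) (Sub.p∩q⊆q X′ (N j x))
              (λ y∈X″ → correlated≥-1 j (Sub.p∩q⊆p X′ (N j x) y∈X″))
            validS′ : ∀ i → Valid i X″ (S′ i)
            validS′ = updateAt-all (λ i → Valid i X″) S j (addVertex j x) valid′ (λ i → weaken X″⊆X (valid i))
            -- The 1 for x itself is weakened to r, so that after division by r exactly the one
            -- vertex gained by T remains.
            X″≥ : exp (- a) * size X ≤ size X″ + 1#
            X″≥ = *-cancelˡ-≤ (fromℕ-pos 1≤r) (begin
              fromℕ r * (exp (- a) * size X)   ≈⟨ *-assoc _ _ _ ⟨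
              fromℕ r * exp (- a) * size X     ≤⟨ *-monoˡ-≤ (fromℕ-nonneg ∣ X ∣) (colour-factor ℓ≤λ₀) ⟩
              factor ℓ * size X                ≤⟨ X′-large ⟩
              size X′                          ≤⟨ X′≤ ⟩
              fromℕ r * size X″ + 1#
                ≤⟨ +-monoʳ-≤ _ (≤-trans (≤-reflexive (sym (+-identityʳ 1#))) (fromℕ-mono 1≤r)) ⟩
              fromℕ r * size X″ + fromℕ r
                ≈⟨ solve 2 (λ r x → r :* x :+ r := r :* (x :+ con (+ 1))) refl (fromℕ r) (size X″) ⟩
              fromℕ r * (size X″ + 1#)         ∎)
            inv′ : invariant X″ S′
            inv′ = ≤-trans (invariant-step (sum-updateAt cost S j (addVertex j x)
                (trans (+-congʳ (*-congˡ (reflexive (≡.cong fromℕ ∣T′∣))))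
                  (solve 3 (λ a c k → a :* (con (+ 1) :+ c) :+ k := a :* c :+ k :+ a) refl a (size (T (S j))) (K * B (S j)))))
                0≤a X″≥)
              (≤-reflexive (+-congˡ (sym (sum-updateAt (size ∘ T) S j (addVertex j x)
                (trans (reflexive (≡.cong fromℕ ∣T′∣)) (+-comm _ _))))))
            nonempty : Nonempty X″
            nonempty = invariant⇒nonempty {X″} {S′}
              (updateAt-all (λ _ s → ∣ T s ∣ ℕ.≤ t) S j (addVertex j x)
                (≡.subst (ℕ._≤ t) (≡.sym ∣T′∣) (T<t j)) (λ i → ℕₚ.<⇒≤ (T<t i)))
              (updateAt-all (λ _ s → B s ≤ Bmax) S j (addVertex j x)
                (B≤Bmax (valid j) x₀∈X (T<t j)) (λ i → B≤Bmax (valid i) x₀∈X (T<t i)))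
              inv′
            X″<X : ∣ X″ ∣ ℕ.< ∣ X ∣
            X″<X = Sub.p⊂q⇒∣p∣<∣q∣ (X″⊆X , x , x∈X , λ x∈X″ →
              proj₁ (∈-neighbourhood⁻ G (Sub.p∩q⊆q X′ (N j x) x∈X″)) ≡.refl)
            measure′ : measure X″ S′ ≤ fromℕ fuel
            measure′ =
              measure-step X″ j (addVertex j x) (ℕₚ.+-mono-<-≤ X″<X (≡.subst (ℕ._≤ ∣ Y (S j) ∣) (≡.sym (∣M∣ j x∈X)) (q≤Y j)))
            B≤ : ∀ i → B (S i) ≤ Bmax
            B≤ i = B≤Bmax (valid i) x₀∈X (T<t i)
            finished : suc ∣ T (S j) ∣ ≡ t → Outcome
            finished T+1≡t = j , X″ , s′ , valid′ , ≡.trans ∣T′∣ T+1≡t , B≤ j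
            T′<t : suc ∣ T (S j) ∣ ≢ t → ∀ i → ∣ T (S′ i) ∣ ℕ.< t
            T′<t T+1≢t = updateAt-all (λ _ s → ∣ T s ∣ ℕ.< t) S j (addVertex j x)
              (≡.subst (ℕ._< t) (≡.sym ∣T′∣) (ℕₚ.≤∧≢⇒< (T<t j) T+1≢t)) T<t
            continue : suc ∣ T (S j) ∣ ≢ t → Outcome
            continue T+1≢t =
              run fuel {X″} {S′} (proj₂ nonempty) (X⊆X₀ ∘ X″⊆X) validS′ (T′<t T+1≢t) inv′ measure′

          boostStep : λ₀ < ℓ → Outcome
          boostStep λ₀<ℓ = run fuel {X′} {S′} (proj₂ nonempty) (X⊆X₀ ∘ X′⊆X) validS′ T′<t inv′ measure′
            where
            s′ : ColourState
            s′ = boost i* x ℓ (S i*)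
            S′ : Fin r → ColourState
            S′ = updateAt S i* (boost i* x ℓ)
            -- Nonemptiness has to precede the invariant here: a vertex left in `X′` shows that the
            -- boosted excess is at most 1, and this is the premise of `boost-factor` used for
            -- `X′≥`.
            nonempty : Nonempty X′
            nonempty =
              size-pos⇒nonempty (<-≤-trans (*-pos (factor-pos ℓ) (fromℕ-pos (∈⇒1≤size x∈X))) X′-large)
            valid′ : Valid i* X′ s′
            valid′ = boost-valid x∈X X′⊆X λ₀<ℓ correlated
            validS′ : ∀ i → Valid i X′ (S′ i)
            validS′ = updateAt-all (λ i → Valid i X′) S i* (boost i* x ℓ) valid′ (λ i → weaken X′⊆X (valid i))
            T′<t : ∀ i → ∣ T (S′ i) ∣ ℕ.< t
            T′<t = updateAt-all (λ _ s → ∣ T s ∣ ℕ.< t) S i* (boost i* x ℓ) (T<t i*) T<t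
            X′≥ : exp (- (K * gain ℓ)) * size X ≤ size X′ + 0#
            X′≥ = ≤-trans (*-monoˡ-≤ (fromℕ-nonneg ∣ X ∣)
                (boost-factor λ₀<ℓ (Valid.0≤B (valid i*)) (T<t i*) (excess≤1 valid′ (proj₂ nonempty))))
              (≤-trans X′-large (≤-reflexive (sym (+-identityʳ _))))
            inv′ : invariant X′ S′
            inv′ = ≤-trans (invariant-step (sum-updateAt cost S i* (boost i* x ℓ)
                (solve 4 (λ c k b g → c :+ k :* (b :+ g) := c :+ k :* b :+ k :* g) refl (a * size (T (S i*))) K (B (S i*)) (gain ℓ)))
                (*-nonneg 0≤K (gain-nonneg λ₀<ℓ)) X′≥)
              (≤-reflexive (+-congˡ (sym (sum-updateAt (λ s → size (T s)) S i* (boost i* x ℓ) (sym (+-identityʳ _))))))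
            measure′ : measure X′ S′ ≤ fromℕ fuel
            measure′ = measure-step X′ i* (boost i* x ℓ) (ℕₚ.+-mono-≤-< (Sub.p⊆q⇒∣p∣≤∣q∣ X′⊆X)
              (≡.subst (ℕ._< ∣ Y (S i*) ∣) (≡.sym (∣M∣ i* x∈X)) (q<Y x∈X λ₀<ℓ (correlated (proj₂ nonempty)))))

        module _ (dense₀ : ∀ {x} → x ∈ X₀ → ∀ i → (b + δ) * size (Y₀ i) ≤ size (N i x ∩ Y₀ i))
                 {x₀ : Fin n} (x₀∈X₀ : x₀ ∈ X₀) where

          private
            S₀ : Fin r → ColourState
            S₀ i = record { Y = Y₀ i ; T = ⊥ ; B = 0# }

            ∣⊥∣≡0 : ∣ ⊥ {n} ∣ ≡ 0
            ∣⊥∣≡0 = Sub.∣⊥∣≡0 n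

            exp≈1 : ∀ {x} → x ≈ 0# → exp x ≈ 1#
            exp≈1 x≈0 = trans (exp-cong x≈0) exp-0

            zero-cost : ∀ u v → u * size (⊥ {n}) + v * 0# ≈ 0#
            zero-cost u v = trans (+-congʳ (*-congˡ (reflexive (≡.cong fromℕ ∣⊥∣≡0))))
              (solve 2 (λ u v → u :* con (+ 0) :+ v :* con (+ 0) := con (+ 0)) refl u v)

            excess₀ : excess 0# ∣ ⊥ {n} ∣ ≈ δ
            excess₀ =
              trans (*-congˡ (exp≈1 (trans (+-congˡ (-‿cong (*-congˡ (reflexive (≡.cong fromℕ ∣⊥∣≡0)))))
              (solve 1 (λ g → con (+ 0) :- g :* con (+ 0) := con (+ 0)) refl γ)))) (*-identityʳ δ)

            decay₀ : decay 0# ∣ ⊥ {n} ∣ ≈ 1#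
            decay₀ = exp≈1 (trans (-‿cong (zero-cost κ κ′)) (solve 0 (:- con (+ 0) := con (+ 0)) refl))

            valid₀ : ∀ i → Valid i X₀ (S₀ i)
            valid₀ i = record
              { Y⊆Y₀   = λ v∈Y → v∈Y
              ; T⊆X₀   = λ u∈⊥ → ⊥-elim (Sub.∉⊥ u∈⊥)
              ; clique = λ u∈⊥ → ⊥-elim (Sub.∉⊥ u∈⊥)
              ; T-X    = λ u∈⊥ → ⊥-elim (Sub.∉⊥ u∈⊥)
              ; T-Y    = λ u∈⊥ → ⊥-elim (Sub.∉⊥ u∈⊥)
              ; 0≤B    = ≤-refl
              ; dense  = λ x∈X₀ → ≤-trans (≤-reflexive (*-congʳ (+-congˡ excess₀))) (dense₀ x∈X₀ i)
              ; bigY   = ≤-reflexive (trans (*-congʳ decay₀) (*-identityˡ _))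
              }

            invariant₀ : invariant X₀ S₀
            invariant₀ = ≤-trans
              (≤-reflexive (trans (*-congʳ (exp≈1 (trans (-‿cong (trans (sum-cong {r} λ _ → zero-cost a K)
                (trans (sum-const r 0#) (zeroʳ _)))) (solve 0 (:- con (+ 0) := con (+ 0)) refl)))) (*-identityˡ _)))
              (≤-from-diff (sum-nonneg {r} λ _ → fromℕ-nonneg ∣ ⊥ {n} ∣) refl)

          outcome : Outcome
          outcome = run (proj₁ fuel) x₀∈X₀ (λ x∈X₀ → x∈X₀) valid₀
              (λ _ → ≡.subst (ℕ._< t) (≡.sym ∣⊥∣≡0) 1≤t) invariant₀ (proj₂ fuel)
            where
            fuel : ∃[ k ] measure X₀ S₀ ≤ fromℕ k
            fuel = archimedean (measure X₀ S₀)

-- Numerical estimates and the choice of the parameters.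

module Estimates (𝓡 : RealNumbers) where
  open Real 𝓡 hiding (zero)
  open OrderedField 𝓡
  open Exponential 𝓡
  open BookAlgorithm 𝓡

  0<2 : 0# < 2#
  0<2 = fromℕ-pos {2} (ℕ.s≤s ℕ.z≤n)

  0<4 : 0# < 4#
  0<4 = fromℕ-pos {4} (ℕ.s≤s ℕ.z≤n)

  ½ : ℝ
  ½ = 2# ⁻¹

  0<½ : 0# < ½
  0<½ = ⁻¹-pos 0<2

  ½+½≈1 : ½ + ½ ≈ 1#
  ½+½≈1 = trans (solve 1 (λ h → h :+ h := con (+ 2) :* h) refl ½) (*-⁻¹ 0<2)

  -- From 1 - x ≤ exp (- x). It yields upper bounds for `exp` below 1: at 1/2 it gives the bound 2,
  -- whose square bounds e by 4.
  exp-*-≤1 : ∀ x → exp x * (1# - x) ≤ 1#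
  exp-*-≤1 x = ≤-trans (*-monoʳ-≤ (0≤exp x) (1+x≤exp (- x))) (≤-reflexive (exp-inverse x))

  exp-neg-≤ : ∀ {x y} → 0# ≤ x → 1# ≤ y * (1# + x) → exp (- x) ≤ y
  exp-neg-≤ {x} {y} 0≤x 1≤y[1+x] = *-cancelʳ-≤ (+-pos-nonneg 0<1 0≤x) (begin
    exp (- x) * (1# + x)     ≈⟨ *-congˡ (solve 1 (λ x → con (+ 1) :+ x := con (+ 1) :- :- x) refl x) ⟩
    exp (- x) * (1# - (- x)) ≤⟨ exp-*-≤1 (- x) ⟩
    1#                       ≤⟨ 1≤y[1+x] ⟩
    y * (1# + x)             ∎)
    where open ≤-Reasoning

  exp-½≤2 : exp ½ ≤ 2#
  exp-½≤2 = *-cancelʳ-≤ 0<½ (begin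
    exp ½ * ½           ≈⟨ *-congˡ (trans (solve 1 (λ h → h := h :+ h :- h) refl ½) (+-congʳ ½+½≈1)) ⟩
    exp ½ * (1# - ½)    ≤⟨ exp-*-≤1 ½ ⟩
    1#                  ≈⟨ *-⁻¹ 0<2 ⟨
    2# * ½              ∎)
    where open ≤-Reasoning

  exp-1≤4 : exp 1# ≤ 4#
  exp-1≤4 = begin
    exp 1#          ≈⟨ trans (exp-cong (sym ½+½≈1)) (exp-+ ½ ½) ⟩
    exp ½ * exp ½   ≤⟨ *-mono-≤ (proj₁ 0<2) (0≤exp ½) exp-½≤2 exp-½≤2 ⟩
    2# * 2#         ≈⟨ solve 0 (con (+ 2) :* con (+ 2) := con (+ 4)) refl ⟩
    4#              ∎
    where open ≤-Reasoning

  -- This is log(1 + x) ≥ x/2 on [0, 1], from exp (x/2) ≤ 1/(1 - x/2) ≤ 1 + x.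
  x≤2g : ∀ {x g} → 0# ≤ x → x ≤ 1# → exp g ≈ 1# + x → x ≤ 2# * g
  x≤2g {x} {g} 0≤x x≤1 expg = ≤-resp
      (trans (solve 2 (λ x h → con (+ 2) :* (x :* h) := con (+ 2) :* h :* x) refl x ½) (trans (*-congʳ (*-⁻¹ 0<2)) (*-identityˡ x)))
      refl (*-monoʳ-≤ (proj₁ 0<2) (exp-reflects-≤ {x * ½} {g}
        (≤-trans (*-cancelʳ-≤ 0<1-xh (≤-trans (exp-*-≤1 (x * ½)) 1≤)) (≤-reflexive (sym expg)))))
    where
    0<1-xh : 0# < 1# - x * ½
    0<1-xh = <-≤-trans 0<½ (≤-from-diff (*-nonneg (diff-nonneg x≤1) (proj₁ 0<½))
      (trans (+-congʳ (sym ½+½≈1)) (solve 2 (λ x h → h :+ h :- x :* h := h :+ (con (+ 1) :- x) :* h) refl x ½)))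
    1≤ : 1# ≤ (1# + x) * (1# - x * ½)
    1≤ = ≤-from-diff (*-nonneg (*-nonneg 0≤x (proj₁ 0<½)) (diff-nonneg x≤1))
      (trans (solve 2 (λ x h → (con (+ 1) :+ x) :* (con (+ 1) :- x :* h) := con (+ 1) :+ (con (+ 1) :* x :- x :* h :- x :* x :* h)) refl x ½)
        (+-congˡ (trans (+-congʳ (+-congʳ (*-congʳ (sym ½+½≈1))))
          (solve 2 (λ x h → (h :+ h) :* x :- x :* h :- x :* x :* h := x :* h :* (con (+ 1) :- x)) refl x ½))))

  1≤2g : ∀ {x g} → 1# ≤ x → exp g ≈ 1# + x → 1# ≤ 2# * g
  1≤2g {x} {g} 1≤x expg = ≤-resp (*-⁻¹ 0<2) refl (*-monoʳ-≤ (proj₁ 0<2) (exp-reflects-≤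
    (≤-trans exp-½≤2 (≤-trans (≤-trans (≤-reflexive (+-congˡ (+-identityʳ 1#))) (+-monoʳ-≤ 1# 1≤x)) (≤-reflexive (sym expg))))))

  -- For θ ≤ 1/2 the factor 4^θ is at most 2. A base that is not positive has power 0, as happens
  -- for ℓ + 1 at ℓ = -1.
  ^ʳ-≤ : ∀ {u w θ} → 0# ≤ θ → θ + θ ≤ 1# → u ≤ 4# * exp w → u ^ʳ θ ≤ 2# * exp (θ * w)
  ^ʳ-≤ {u} {w} {θ} 0≤θ 2θ≤1 u≤ = case 0<? u of λ where
      (yes 0<u) → begin
        u ^ʳ θ                    ≈⟨ ^ʳ-def 0<u θ ⟩
        exp (θ * log u)
          ≤⟨ exp-mono (*-monoʳ-≤ 0≤θ (log-≤ 0<u (≤-trans u≤ (≤-reflexive (sym 4expw))))) ⟩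
        exp (θ * (g + g + w))
          ≈⟨ exp-cong (solve 3 (λ θ g w → θ :* (g :+ g :+ w) := (θ :+ θ) :* g :+ θ :* w) refl θ g w) ⟩
        exp ((θ + θ) * g + θ * w)
          ≤⟨ exp-mono (+-monoˡ-≤ (θ * w) (≤-trans (*-monoˡ-≤ 0≤g 2θ≤1) (≤-reflexive (*-identityˡ g)))) ⟩
        exp (g + θ * w)           ≈⟨ trans (exp-+ g (θ * w)) (*-congʳ (exp-log 0<2)) ⟩
        2# * exp (θ * w)          ∎
      (no  0≮u) → ≤-trans (≤-reflexive (^ʳ-junk 0≮u θ)) (*-nonneg (proj₁ 0<2) (0≤exp _))
    where
    open ≤-Reasoning
    g : ℝ
    g = log 2#
    0≤g : 0# ≤ g
    0≤g =
      ≤-log 0<2 (≤-trans (≤-reflexive exp-0) (≤-from-diff (≤-trans 0≤1 (≤-reflexive (sym (+-identityʳ 1#)))) refl))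
    4expw : exp (g + g + w) ≈ 4# * exp w
    4expw = trans (trans (exp-+ (g + g) w) (*-congʳ (trans (exp-+ g g) (*-cong (exp-log 0<2) (exp-log 0<2)))))
      (*-congʳ (solve 0 (con (+ 2) :* con (+ 2) := con (+ 4)) refl))

  -- Here `l₀` and `lₜ` are log λ₀ and log t, and θ, θ′ stand for 1/d and (d-1)/d, so estimates
  -- between powers become linear inequalities between exponents. `exponents` is the assumption t ≥
  -- λ₀ δ^(-1/(d-1)) in this form.
  module Bounds
    {r t : ℕ} (1≤r : 1 ℕ.≤ r) (1≤t : 1 ℕ.≤ t)
    {β C p δ λ₀ L Lₚ ρ l₀ lₜ θ θ′ : ℝ}
    (0<β : 0# < β) (0<C : 0# < C) (0<p : 0# < p) (0<δ : 0# < δ)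
    (expL : exp L * δ ≈ 1#) (expLₚ : exp Lₚ * p ≈ 1#) (expρ : exp ρ * β ≈ fromℕ r)
    (expl₀ : exp l₀ ≈ λ₀) (explₜ : exp lₜ ≈ fromℕ t)
    (0≤Lₚ : 0# ≤ Lₚ) (0≤ρ : 0# ≤ ρ) (1≤L : 1# ≤ L)
    (0≤θ : 0# ≤ θ) (2θ≤1 : θ + θ ≤ 1#) (0≤θ′ : 0# ≤ θ′) (θ+θ′≈1 : θ + θ′ ≈ 1#)
    (4δ≤p : 4# * δ ≤ p) (2≤λ₀ : 2# ≤ λ₀) (6L≤λ₀ : 6# * L ≤ λ₀) (λ₀≤t : λ₀ ≤ fromℕ t)
    (exponents : θ * L + θ′ * l₀ ≤ θ′ * lₜ)
    where

    open ≤-Reasoning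

    private
      T : ℝ
      T = fromℕ t

      0<T : 0# < T
      0<T = fromℕ-pos 1≤t

      0<λ₀ : 0# < λ₀
      0<λ₀ = <-≤-trans 0<2 2≤λ₀

      0≤L : 0# ≤ L
      0≤L = ≤-trans 0≤1 1≤L

    -- `γ` is chosen so that t - 1 vertices cost exactly 1 in the exponent of the excess. The two
    -- terms of `K` pay for the power of ℓ + 1 and for the constant ρ of each boost.
    Λ Λ′ i₀ iΛ iT x y γ κ a K : ℝ
    Λ  = exp (θ * l₀)
    Λ′ = exp (θ′ * l₀)
    i₀ = λ₀ ⁻¹
    iΛ = Λ′ ⁻¹
    iT = T ⁻¹
    x  = δ / p
    y  = 3# * x * ½
    γ  = (T - 1#) ⁻¹
    κ  = Lₚ + y
    a  = ρ + C * (2# * Λ)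
    K  = 4# * C * T * iΛ + 2# * ρ * T * i₀

    κ′ : ℝ
    κ′ = κ * (2# * T * i₀)

    factor : ℝ → ℝ
    factor ℓ = β * exp (- (C * (ℓ + 1#) ^ʳ θ))

    gain : ℝ → ℝ
    gain ℓ = log (1# + ℓ * iT)

    0≤i₀ : 0# ≤ i₀
    0≤i₀ = proj₁ (⁻¹-pos 0<λ₀)

    0≤iΛ : 0# ≤ iΛ
    0≤iΛ = proj₁ (⁻¹-pos (0<exp _))

    0≤iT : 0# ≤ iT
    0≤iT = proj₁ (⁻¹-pos 0<T)

    -- Fixed costs per boost are charged to the gain at rate 2t/λ₀, and the total gain is at most
    -- 2L. So boosts add at most the proportion 4L/λ₀ to what t vertices cost, and hence at most
    -- double it.
    4Li₀≤1 : 4# * L * i₀ ≤ 1#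
    4Li₀≤1 = /-≤ 0<λ₀ (≤-trans (≤-from-diff (+-nonneg 0≤L 0≤L)
      (solve 1 (λ l → con (+ 6) :* l := con (+ 4) :* l :+ (l :+ l)) refl L))
      (≤-trans 6L≤λ₀ (≤-reflexive (sym (*-identityˡ λ₀)))))

    private
      0≤x : 0# ≤ x
      0≤x = proj₁ (/-pos 0<δ 0<p)

      4x≤1 : 4# * x ≤ 1#
      4x≤1 = ≤-trans (≤-reflexive (solve 3 (λ f d i → f :* (d :* i) := f :* d :* i) refl 4# δ (p ⁻¹)))
        (/-≤ 0<p (≤-trans 4δ≤p (≤-reflexive (sym (*-identityˡ p)))))

      0≤y : 0# ≤ y
      0≤y = *-nonneg (*-nonneg (fromℕ-nonneg 3) 0≤x) (proj₁ 0<½)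

      2y≈3x : y + y ≈ 3# * x
      2y≈3x = trans (solve 3 (λ f x h → f :* x :* h :+ f :* x :* h := f :* x :* (h :+ h)) refl 3# x ½)
        (trans (*-congˡ ½+½≈1) (*-identityʳ _))

      xp≈δ : x * p ≈ δ
      xp≈δ = /-cancel δ 0<p

    -- (1 - x)(1 + y) ≥ 1 for y = 3x/2 and x ≤ 1/3.
    exp-y≤1-x : exp (- y) ≤ 1# - x
    exp-y≤1-x = exp-neg-≤ 0≤y (*-cancelˡ-≤ 0<2 (≤-from-diff
      (*-nonneg 0≤x (+-nonneg 0≤x (diff-nonneg 4x≤1)))
      (trans (solve 2 (λ x y → con (+ 2) :* ((con (+ 1) :- x) :* (con (+ 1) :+ y)) :=
          con (+ 2) :* con (+ 1) :+ ((con (+ 1) :- x) :* (y :+ y) :- con (+ 2) :* x)) refl x y)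
        (+-congˡ (trans (+-congʳ (*-congˡ 2y≈3x))
          (solve 1 (λ x → (con (+ 1) :- x) :* (con (+ 3) :* x) :- con (+ 2) :* x :=
            x :* (x :+ (con (+ 1) :- con (+ 4) :* x))) refl x))))))

    exp-κ≤p-δ : exp (- κ) ≤ p - δ
    exp-κ≤p-δ = begin
      exp (- κ)
        ≈⟨ trans (exp-cong (solve 2 (λ l y → :- (l :+ y) := :- l :+ :- y) refl Lₚ y)) (exp-+ _ _) ⟩
      exp (- Lₚ) * exp (- y)  ≈⟨ *-congʳ exp-Lₚ ⟩
      p * exp (- y)           ≤⟨ *-monoʳ-≤ (proj₁ 0<p) exp-y≤1-x ⟩
      p * (1# - x)
        ≈⟨ trans (solve 2 (λ p x → p :* (con (+ 1) :- x) := p :- x :* p) refl p x) (+-congˡ (-‿cong xp≈δ)) ⟩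
      p - δ                   ∎
      where
      exp-Lₚ : exp (- Lₚ) ≈ p
      exp-Lₚ = *-cancelˡ-≈ (0<exp Lₚ) (trans (exp-inverse Lₚ) (sym expLₚ))

    0≤κ : 0# ≤ κ
    0≤κ = +-nonneg 0≤Lₚ 0≤y

    private
      1≤T-1 : 1# ≤ T - 1#
      1≤T-1 = ≤-resp (solve 0 (con (+ 2) :- con (+ 1) := con (+ 1)) refl) refl
        (+-monoˡ-≤ (- 1#) (≤-trans 2≤λ₀ λ₀≤t))

      0<T-1 : 0# < T - 1#
      0<T-1 = <-≤-trans 0<1 1≤T-1

      0≤γ : 0# ≤ γ
      0≤γ = proj₁ (⁻¹-pos 0<T-1)

      γc≤1 : ∀ {c} → c ℕ.< t → γ * fromℕ c ≤ 1#
      γc≤1 {c} c<t = ≤-trans (*-monoʳ-≤ 0≤γ (≤-resp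
          (solve 1 (λ c → con (+ 1) :+ c :- con (+ 1) := c) refl (fromℕ c)) refl (+-monoˡ-≤ (- 1#) (fromℕ-mono c<t))))
        (≤-reflexive (trans (*-comm γ _) (*-⁻¹ 0<T-1)))

    -- Because (1 - 1/t)(1 + 1/(t-1)) = 1.
    exp-γ≤ : exp (- γ) ≤ 1# - iT
    exp-γ≤ = exp-neg-≤ 0≤γ (≤-reflexive (sym (trans
      (solve 2 (λ i g → (con (+ 1) :- i) :* (con (+ 1) :+ g) := con (+ 1) :+ (con (+ 1) :* g :- i :- i :* g)) refl iT γ)
      (trans (+-congˡ (trans (+-congʳ (+-congʳ (*-congʳ (sym (*-⁻¹ 0<T)))))
        (trans (solve 3 (λ t i g → t :* i :* g :- i :- i :* g := i :* ((t :- con (+ 1)) :* g) :- i) refl T iT γ)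
        (trans (+-congʳ (trans (*-congˡ (*-⁻¹ 0<T-1)) (*-identityʳ iT))) (-‿inverseʳ iT)))))
        (+-identityʳ 1#)))))

    private
      log-bound : ∀ {u w} → δ * exp u ≤ exp w → u ≤ L + w
      log-bound {u} {w} δexp≤ = exp-reflects-≤ (begin
        exp u               ≈⟨ *-identityˡ _ ⟨
        1# * exp u          ≈⟨ *-congʳ expL ⟨
        exp L * δ * exp u   ≈⟨ *-assoc _ _ _ ⟩
        exp L * (δ * exp u) ≤⟨ *-monoʳ-≤ (0≤exp L) δexp≤ ⟩
        exp L * exp w       ≈⟨ exp-+ L w ⟨
        exp (L + w)         ∎)

    -- Fewer than t vertices reduce the excess by at most a factor e, so B ≤ L + 1, and L ≥ 1.
    boost-bound : ∀ {B c} → 0# ≤ B → c ℕ.< t → δ * exp (B - γ * fromℕ c) ≤ 1# → B ≤ L + L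
    boost-bound {B} {c} 0≤B c<t excess≤1 = begin
      B                                  ≈⟨ solve 2 (λ b g → b := b :- g :+ g) refl B (γ * fromℕ c) ⟩
      B - γ * fromℕ c + γ * fromℕ c
        ≤⟨ +-mono-≤ (log-bound (≤-trans excess≤1 (≤-reflexive (sym exp-0)))) (≤-trans (γc≤1 c<t) 1≤L) ⟩
      L + 0# + L                         ≈⟨ +-congʳ (+-identityʳ L) ⟩
      L + L                              ∎

    module _ {ℓ : ℝ} (λ₀<ℓ : λ₀ < ℓ) where

      private
        g : ℝ
        g = gain ℓ

        0<ℓ : 0# < ℓ
        0<ℓ = ≤-<-trans (proj₁ 0<λ₀) λ₀<ℓ

        0≤ℓ/T : 0# ≤ ℓ * iT
        0≤ℓ/T = *-nonneg (proj₁ 0<ℓ) 0≤iT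

        1≤ℓ : 1# ≤ ℓ
        1≤ℓ =
          ≤-trans (≤-from-diff (≤-trans 0≤1 (≤-reflexive (sym (+-identityʳ 1#)))) refl) (≤-trans 2≤λ₀ (proj₁ λ₀<ℓ))

        ℓ/T*T : ℓ * iT * T ≈ ℓ
        ℓ/T*T = /-cancel ℓ 0<T

      exp-gain : exp (gain ℓ) ≈ 1# + ℓ * iT
      exp-gain = exp-log (+-pos-nonneg 0<1 0≤ℓ/T)

      gain-nonneg : 0# ≤ gain ℓ
      gain-nonneg =
        exp-reflects-≤ (≤-trans (≤-reflexive exp-0) (≤-trans (≤-from-diff 0≤ℓ/T refl) (≤-reflexive (sym exp-gain))))

      -- The logarithm is compared with ℓ/t up to ℓ = t, and beyond that only with the constant 1/2.
      gain-cases : (ℓ ≤ 2# * T * gain ℓ) ⊎ (1# ≤ 2# * gain ℓ)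
      gain-cases = case ℓ * iT ≤? 1# of λ where
        (yes ℓ/T≤1) → inj₁ (≤-resp ℓ/T*T (solve 3 (λ f g t → f :* g :* t := f :* t :* g) refl 2# g T)
                        (*-monoˡ-≤ (proj₁ 0<T) (x≤2g 0≤ℓ/T ℓ/T≤1 exp-gain)))
        (no  ℓ/T≰1) → inj₂ (1≤2g (≰⇒≥ ℓ/T≰1) exp-gain)

      -- Every boost gains at least λ₀/(2t), which sets the rate 2t/λ₀ for costs that do not depend
      -- on ℓ.
      λ₀≤2Tg : λ₀ ≤ 2# * T * gain ℓ
      λ₀≤2Tg = case gain-cases of λ where
        (inj₁ ℓ≤)   → ≤-trans (proj₁ λ₀<ℓ) ℓ≤
        (inj₂ 1≤2g) → begin
          λ₀             ≤⟨ λ₀≤t ⟩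
          T              ≈⟨ *-identityʳ T ⟨
          T * 1#         ≤⟨ *-monoʳ-≤ (proj₁ 0<T) 1≤2g ⟩
          T * (2# * g)   ≈⟨ solve 3 (λ f g t → t :* (f :* g) := f :* t :* g) refl 2# g T ⟩
          2# * T * g     ∎

      1≤2Ti₀g : 1# ≤ 2# * T * i₀ * gain ℓ
      1≤2Ti₀g = ≤-trans (≤-/ 0<λ₀ (≤-trans (≤-reflexive (*-identityˡ λ₀)) λ₀≤2Tg))
        (≤-reflexive (solve 4 (λ f t g i → f :* t :* g :* i := f :* t :* i :* g) refl 2# T g i₀))

      κ≤κ′*gain : κ ≤ κ′ * gain ℓ
      κ≤κ′*gain = ≤-trans (≤-reflexive (sym (*-identityʳ κ)))
        (≤-trans (*-monoʳ-≤ 0≤κ 1≤2Ti₀g) (≤-reflexive (sym (*-assoc κ _ _))))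

      -- Both regimes of (ℓ + 1)^(1/d) / log (1 + ℓ/t) are governed by its value near λ₀;
      -- for ℓ > t this is the hypothesis t ≥ λ₀ δ^(-1/(d-1)).
      power*Λ′≤4Tg : ∀ {B c} → 0# ≤ B → c ℕ.< t → δ * exp (B + gain ℓ - γ * fromℕ c) ≤ 1# →
        (ℓ + 1#) ^ʳ θ * Λ′ ≤ 4# * T * gain ℓ
      power*Λ′≤4Tg {B} {c} 0≤B c<t excess≤1 = case gain-cases of λ where
          (inj₁ ℓ≤) → begin
            (ℓ + 1#) ^ʳ θ * Λ′
              ≤⟨ *-monoˡ-≤ (0≤exp _) (^ʳ-≤ 0≤θ 2θ≤1 (≤-trans ℓ+1≤4ℓ (≤-reflexive (*-congˡ (sym (exp-log 0<ℓ)))))) ⟩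
            2# * exp (θ * log ℓ) * Λ′     ≤⟨ small ⟩
            2# * ℓ                        ≤⟨ *-monoʳ-≤ (proj₁ 0<2) ℓ≤ ⟩
            2# * (2# * T * g)
              ≈⟨ solve 2 (λ t g → con (+ 2) :* (con (+ 2) :* t :* g) := con (+ 4) :* t :* g) refl T g ⟩
            4# * T * g                    ∎
          (inj₂ 1≤2g) → begin
            (ℓ + 1#) ^ʳ θ * Λ′            ≤⟨ *-monoˡ-≤ (0≤exp _) (^ʳ-≤ 0≤θ 2θ≤1 ℓ+1≤4T/δ) ⟩
            2# * exp (θ * (lₜ + L)) * Λ′  ≤⟨ large ⟩
            2# * T                        ≈⟨ *-identityʳ _ ⟨
            2# * T * 1#                   ≤⟨ *-monoʳ-≤ (*-nonneg (proj₁ 0<2) (proj₁ 0<T)) 1≤2g ⟩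
            2# * T * (2# * g)
              ≈⟨ solve 2 (λ t g → con (+ 2) :* t :* (con (+ 2) :* g) := con (+ 4) :* t :* g) refl T g ⟩
            4# * T * g                    ∎
        where
        ℓ+1≤4ℓ : ℓ + 1# ≤ 4# * ℓ
        ℓ+1≤4ℓ = ≤-from-diff (+-nonneg (diff-nonneg 1≤ℓ) (+-nonneg (proj₁ 0<ℓ) (proj₁ 0<ℓ)))
          (solve 1 (λ l → con (+ 4) :* l := l :+ con (+ 1) :+ ((l :- con (+ 1)) :+ (l :+ l))) refl ℓ)
        small : 2# * exp (θ * log ℓ) * Λ′ ≤ 2# * ℓ
        small = ≤-trans (≤-reflexive (*-assoc _ _ _)) (*-monoʳ-≤ (proj₁ 0<2) (begin
          exp (θ * log ℓ) * Λ′         ≈⟨ exp-+ _ _ ⟨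
          exp (θ * log ℓ + θ′ * l₀)
            ≤⟨ exp-mono (+-monoʳ-≤ _ (*-monoʳ-≤ 0≤θ′ (≤-log 0<ℓ (≤-trans (≤-reflexive expl₀) (proj₁ λ₀<ℓ))))) ⟩
          exp (θ * log ℓ + θ′ * log ℓ)
            ≈⟨ exp-cong (trans (sym (distribʳ _ _ _)) (trans (*-congʳ θ+θ′≈1) (*-identityˡ _))) ⟩
          exp (log ℓ)                  ≈⟨ exp-log 0<ℓ ⟩
          ℓ                            ∎))
        large : 2# * exp (θ * (lₜ + L)) * Λ′ ≤ 2# * T
        large = ≤-trans (≤-reflexive (*-assoc _ _ _)) (*-monoʳ-≤ (proj₁ 0<2) (begin
          exp (θ * (lₜ + L)) * Λ′          ≈⟨ exp-+ _ _ ⟨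
          exp (θ * (lₜ + L) + θ′ * l₀)
            ≈⟨ exp-cong (solve 5 (λ θ t l θ′ m → θ :* (t :+ l) :+ θ′ :* m := θ :* t :+ (θ :* l :+ θ′ :* m)) refl θ lₜ L θ′ l₀) ⟩
          exp (θ * lₜ + (θ * L + θ′ * l₀)) ≤⟨ exp-mono (+-monoʳ-≤ _ exponents) ⟩
          exp (θ * lₜ + θ′ * lₜ)
            ≈⟨ exp-cong (trans (sym (distribʳ _ _ _)) (trans (*-congʳ θ+θ′≈1) (*-identityˡ _))) ⟩
          exp lₜ                           ≈⟨ explₜ ⟩
          T                                ∎))
        -- The boosted excess is at most 1 and vertices have cost it at most a factor e, so a single
        -- boost multiplies it by at most e/δ, and e ≤ 4.
        1+ℓ/T≤4expL : 1# + ℓ * iT ≤ 4# * exp L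
        1+ℓ/T≤4expL = begin
          1# + ℓ * iT          ≈⟨ exp-gain ⟨
          exp g                ≤⟨ exp-mono (≤-trans (≤-from-diff 0≤B (+-comm B g)) B+g≤) ⟩
          exp (L + 1#)         ≈⟨ exp-+ L 1# ⟩
          exp L * exp 1#       ≤⟨ *-monoʳ-≤ (0≤exp L) exp-1≤4 ⟩
          exp L * 4#           ≈⟨ *-comm _ _ ⟩
          4# * exp L           ∎
          where
          B+g≤ : B + g ≤ L + 1#
          B+g≤ = begin
            B + g
              ≈⟨ solve 2 (λ b g → b := b :- g :+ g) refl (B + g) (γ * fromℕ c) ⟩
            B + g - γ * fromℕ c + γ * fromℕ c
              ≤⟨ +-mono-≤ (log-bound (≤-trans excess≤1 (≤-reflexive (sym exp-0)))) (γc≤1 c<t) ⟩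
            L + 0# + 1#                            ≈⟨ +-congʳ (+-identityʳ L) ⟩
            L + 1#                                 ∎
        ℓ+1≤4T/δ : ℓ + 1# ≤ 4# * exp (lₜ + L)
        ℓ+1≤4T/δ = begin
          ℓ + 1#
            ≤⟨ +-monoʳ-≤ ℓ (≤-trans (≤-reflexive (sym (+-identityʳ 1#))) (fromℕ-mono 1≤t)) ⟩
          ℓ + T
            ≈⟨ trans (+-congʳ (sym ℓ/T*T)) (solve 2 (λ q t → q :* t :+ t := t :* (con (+ 1) :+ q)) refl (ℓ * iT) T) ⟩
          T * (1# + ℓ * iT)       ≤⟨ *-monoʳ-≤ (proj₁ 0<T) 1+ℓ/T≤4expL ⟩
          T * (4# * exp L)
            ≈⟨ trans (*-congʳ (sym explₜ)) (solve 3 (λ t f l → t :* (f :* l) := f :* (t :* l)) refl (exp lₜ) 4# (exp L)) ⟩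
          4# * (exp lₜ * exp L)   ≈⟨ *-congˡ (exp-+ lₜ L) ⟨
          4# * exp (lₜ + L)       ∎

      boost-factor : ∀ {B c} → 0# ≤ B → c ℕ.< t → δ * exp (B + gain ℓ - γ * fromℕ c) ≤ 1# →
        exp (- (K * gain ℓ)) ≤ factor ℓ
      boost-factor 0≤B c<t excess≤1 = begin
        exp (- (K * g))                              ≤⟨ exp-mono (-‿antimono-≤ exponent) ⟩
        exp (- (ρ + C * (ℓ + 1#) ^ʳ θ))
          ≈⟨ trans (exp-cong (solve 2 (λ u v → :- (u :+ v) := :- u :+ :- v) refl ρ _)) (exp-+ _ _) ⟩
        exp (- ρ) * exp (- (C * (ℓ + 1#) ^ʳ θ))      ≤⟨ *-monoˡ-≤ (0≤exp _) exp-ρ≤β ⟩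
        factor ℓ                                     ∎
        where
        exp-ρ≤β : exp (- ρ) ≤ β
        exp-ρ≤β = *-cancelˡ-≤ (0<exp ρ) (≤-trans (≤-reflexive (exp-inverse ρ))
          (≤-trans (≤-trans (≤-reflexive (sym (+-identityʳ 1#))) (fromℕ-mono 1≤r)) (≤-reflexive (sym expρ))))
        power≤ : (ℓ + 1#) ^ʳ θ ≤ 4# * T * g * iΛ
        power≤ = ≤-/ (0<exp _) (power*Λ′≤4Tg 0≤B c<t excess≤1)
        exponent : ρ + C * (ℓ + 1#) ^ʳ θ ≤ K * g
        exponent = begin
          ρ + C * (ℓ + 1#) ^ʳ θ
            ≤⟨ +-mono-≤ (≤-trans (≤-reflexive (sym (*-identityʳ ρ))) (*-monoʳ-≤ 0≤ρ 1≤2Ti₀g)) (*-monoʳ-≤ (proj₁ 0<C) power≤) ⟩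
          ρ * (2# * T * i₀ * g) + C * (4# * T * g * iΛ)
            ≈⟨ solve 6 (λ ρ t i g c j → ρ :* (con (+ 2) :* t :* i :* g) :+ c :* (con (+ 4) :* t :* g :* j) :=
                                                           (con (+ 4) :* c :* t :* j :+ con (+ 2) :* ρ :* t :* i) :* g) refl ρ T i₀ g C iΛ ⟩
          K * g                                        ∎

    -- `exp (- ρ)` is β/r, which covers both the constant β and the pigeonhole over r colours. The 2
    -- in `a` comes from (λ₀ + 1)^θ ≤ 2 λ₀^θ.
    colour-factor : ∀ {ℓ} → ℓ ≤ λ₀ → fromℕ r * exp (- a) ≤ factor ℓ
    colour-factor {ℓ} ℓ≤λ₀ = begin
      fromℕ r * exp (- a)
        ≈⟨ *-congˡ (trans (exp-cong (solve 2 (λ u v → :- (u :+ v) := :- u :+ :- v) refl ρ _)) (exp-+ _ _)) ⟩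
      fromℕ r * (exp (- ρ) * exp (- (C * (2# * Λ)))) ≈⟨ trans (sym (*-assoc _ _ _)) (*-congʳ r*exp-ρ≈β) ⟩
      β * exp (- (C * (2# * Λ)))
        ≤⟨ *-monoʳ-≤ (proj₁ 0<β) (exp-mono (-‿antimono-≤ (*-monoʳ-≤ (proj₁ 0<C) (^ʳ-≤ 0≤θ 2θ≤1 ℓ+1≤4λ₀)))) ⟩
      factor ℓ                                     ∎
      where
      r*exp-ρ≈β : fromℕ r * exp (- ρ) ≈ β
      r*exp-ρ≈β =
        trans (*-congʳ (sym expρ)) (trans (solve 3 (λ e b n → e :* b :* n := e :* n :* b) refl (exp ρ) β (exp (- ρ)))
        (trans (*-congʳ (exp-inverse ρ)) (*-identityˡ β)))
      ℓ+1≤4λ₀ : ℓ + 1# ≤ 4# * exp l₀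
      ℓ+1≤4λ₀ = ≤-trans (≤-from-diff (+-nonneg (diff-nonneg ℓ≤λ₀) (+-nonneg (diff-nonneg 2≤λ₀)
          (+-nonneg 0≤1 (+-nonneg (proj₁ 0<λ₀) (proj₁ 0<λ₀)))))
        (solve 2 (λ l m → con (+ 4) :* m := l :+ con (+ 1) :+ ((m :- l) :+ ((m :- con (+ 2)) :+ (con (+ 1) :+ (m :+ m))))) refl ℓ λ₀))
        (≤-reflexive (*-congˡ (sym expl₀)))

    stepBounds : StepBounds r t
    stepBounds = record
      { b = p - δ ; δ = δ ; γ = γ ; κ = κ ; κ′ = κ′ ; a = a ; K = K ; λ₀ = λ₀ ; Bmax = L + L
      ; gain = gain ; factor = factor
      ; 1≤r = 1≤r ; 1≤t = 1≤t
      ; 0<b = <-≤-trans (0<exp _) exp-κ≤p-δ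
      ; 0<δ = 0<δ
      ; 0≤λ₀ = proj₁ 0<λ₀
      ; 0≤a = +-nonneg 0≤ρ (*-nonneg (proj₁ 0<C) (*-nonneg (proj₁ 0<2) (0≤exp _)))
      ; 0≤K = +-nonneg (*-nonneg (*-nonneg (*-nonneg (proj₁ 0<4) (proj₁ 0<C)) (proj₁ 0<T)) 0≤iΛ)
                (*-nonneg (*-nonneg (*-nonneg (proj₁ 0<2) 0≤ρ) (proj₁ 0<T)) 0≤i₀)
      ; exp-κ≤b = exp-κ≤p-δ
      ; exp-γ≤1-1/t = exp-γ≤
      ; exp-gain = exp-gain
      ; gain-nonneg = gain-nonneg
      ; κ≤κ′*gain = κ≤κ′*gain
      ; factor-pos = λ ℓ → *-pos 0<β (0<exp _)
      ; colour-factor = colour-factor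
      ; boost-factor = λ λ₀<ℓ → boost-factor λ₀<ℓ
      ; boost-bound = boost-bound
      }

    -- The ρ terms add up to ρt(1 + 4L/λ₀) ≤ 2ρt. The C terms are 2CΛt and 8CLt/Λ′, within the
    -- constants 4 and 12 of Ξ.
    total-cost : a * T + K * (L + L) ≤ T * (2# * ρ + 4# * C * Λ + fromℕ 12 * C * L * iΛ)
    total-cost = ≤-from-diff (*-nonneg (proj₁ 0<T) (+-nonneg (*-nonneg 0≤ρ (diff-nonneg 4Li₀≤1))
        (+-nonneg (*-nonneg (proj₁ 0<C) (*-nonneg (proj₁ 0<2) (0≤exp _)))
          (*-nonneg (*-nonneg (proj₁ 0<4) (proj₁ 0<C)) (*-nonneg 0≤L 0≤iΛ)))))
      (solve 7 (λ ρ c m t l i j →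
        t :* (con (+ 2) :* ρ :+ con (+ 4) :* c :* m :+ con (+ 12) :* c :* l :* j) :=
        (ρ :+ c :* (con (+ 2) :* m)) :* t :+ (con (+ 4) :* c :* t :* j :+ con (+ 2) :* ρ :* t :* i) :* (l :+ l)
          :+ t :* (ρ :* (con (+ 1) :- con (+ 4) :* l :* i) :+ (c :* (con (+ 2) :* m) :+ con (+ 4) :* c :* (l :* j)))) refl
        ρ C Λ T L i₀ iΛ)

    -- The part y of κ is at most doubled, and 2y = 3δ/p is the first term of Π; the part Lₚ adds 4L
    -- Lₚ/λ₀ per vertex, within the constant 6.
    total-decay : κ * T + κ′ * (L + L) ≤ T * Lₚ + (3# * δ / p + 6# * L * Lₚ * i₀) * T
    total-decay = ≤-from-diff (*-nonneg (proj₁ 0<T) (+-nonneg (*-nonneg 0≤y (diff-nonneg 4Li₀≤1))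
        (*-nonneg (*-nonneg (proj₁ 0<2) 0≤L) (*-nonneg 0≤Lₚ 0≤i₀))))
      (trans (+-congˡ (*-congʳ (+-congʳ (trans (*-assoc 3# δ (p ⁻¹)) (sym 2y≈3x)))))
        (solve 5 (λ t m y l i → t :* m :+ ((y :+ y) :+ con (+ 6) :* l :* m :* i) :* t :=
          (m :+ y) :* t :+ (m :+ y) :* (con (+ 2) :* t :* i) :* (l :+ l) :+
            t :* (y :* (con (+ 1) :- con (+ 4) :* l :* i) :+ con (+ 2) :* l :* (m :* i))) refl T Lₚ y L i₀))

-- Logarithms of reciprocals.

module Logarithms (𝓡 : RealNumbers) where
  open Real 𝓡 hiding (zero)
  open OrderedField 𝓡
  open Exponential 𝓡

  exp-injective : ∀ {x y} → exp x ≈ exp y → x ≈ y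
  exp-injective ex≈ey =
    antisym (exp-reflects-≤ (≤-reflexive ex≈ey)) (exp-reflects-≤ (≤-reflexive (sym ex≈ey)))

  ⁻¹-cong : ∀ {x y} → 0# < x → x ≈ y → x ⁻¹ ≈ y ⁻¹
  ⁻¹-cong 0<x x≈y = ⁻¹-unique 0<x (trans (*-congʳ x≈y) (*-⁻¹ (<-≤-trans 0<x (≤-reflexive x≈y))))

  exp-log-1/ : ∀ {x} → 0# < x → exp (log (1# / x)) * x ≈ 1#
  exp-log-1/ 0<x = trans (*-congʳ (exp-log (/-pos 0<1 0<x))) (/-cancel 1# 0<x)

  log≈-log-1/ : ∀ {x} → 0# < x → log x ≈ - log (1# / x)
  log≈-log-1/ {x} 0<x = exp-injective (*-cancelˡ-≈ (0<exp (log (1# / x)))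
    (trans (*-congˡ (exp-log 0<x)) (trans (exp-log-1/ 0<x) (sym (exp-inverse _)))))

-- Verification of the parameters and extraction of the book.

module MainTheorem (𝓡 : RealNumbers) where
  open Real 𝓡 hiding (zero)
  open OrderedField 𝓡
  open Exponential 𝓡
  open HilbertSpaces 𝓡
  open GeometricLemma 𝓡
  open Counting 𝓡
  open Estimates 𝓡
  open Logarithms 𝓡

  module _
    {r d : ℕ} (r≥2 : r ℕ.≥ 2) (d≥3 : d ℕ.≥ 3)
    {β C : ℝ} (0<β : 0# < β) (β≤1 : β ≤ 1#) (0<C : 0# < C)
    (𝒢rd : 𝒢 r d β C)
    {t m : ℕ} (t≥1 : t ℕ.≥ 1)
    {p : ℝ} (0<p : 0# < p) (p≤1 : p ≤ 1#)
    {δ λ₀ : ℝ} (0<δ : 0# < δ) (0<λ₀ : 0# < λ₀)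
    where

    private
      L Lₚ ρ d⁻ Π Ξ T : ℝ
      L  = log (1# / δ)
      Lₚ = log (1# / p)
      ρ  = log (fromℕ r / β)
      d⁻ = fromℕ (d ∸ 1)
      Π  = 3# * δ / p + 6# * L * Lₚ / λ₀
      Ξ  = 2# * ρ + 4# * C * λ₀ ^ʳ (1# / fromℕ d) + fromℕ 12 * C * L / λ₀ ^ʳ (d⁻ / fromℕ d)
      T  = fromℕ t

    module _
      (δ≤p/4 : δ ≤ p / 4#) (δ≤1/4 : δ ≤ 1# / 4#) (2≤λ₀ : 2# ≤ λ₀) (6L≤λ₀ : 6# * L ≤ λ₀)
      (t-large : λ₀ * δ ^ʳ (- (1# / d⁻)) ≤ T)
      where

      private
        θ θ′ i l₀ lₜ : ℝ
        θ  = 1# / fromℕ d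
        θ′ = d⁻ / fromℕ d
        i  = 1# / d⁻
        l₀ = log λ₀
        lₜ = log T

        0<d : 0# < fromℕ d
        0<d = fromℕ-pos (ℕₚ.≤-trans (ℕ.s≤s ℕ.z≤n) d≥3)

        0<d⁻ : 0# < d⁻
        0<d⁻ = fromℕ-pos (ℕₚ.∸-monoˡ-≤ 1 (ℕₚ.≤-trans (ℕ.s≤s (ℕ.s≤s ℕ.z≤n)) d≥3))

        0<T : 0# < T
        0<T = fromℕ-pos t≥1

        1≤r : 1 ℕ.≤ r
        1≤r = ℕₚ.≤-trans (ℕ.s≤s ℕ.z≤n) r≥2

        0<r : 0# < fromℕ r
        0<r = fromℕ-pos 1≤r

        1≤fromℕ : ∀ {k} → 1 ℕ.≤ k → 1# ≤ fromℕ k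
        1≤fromℕ 1≤k = ≤-trans (≤-reflexive (sym (+-identityʳ 1#))) (fromℕ-mono 1≤k)

        d≈1+d⁻ : fromℕ d ≈ 1# + d⁻
        d≈1+d⁻ = reflexive (≡.cong fromℕ (≡.sym (ℕₚ.m+[n∸m]≡n (ℕₚ.≤-trans (ℕ.s≤s ℕ.z≤n) d≥3))))

        θ+θ′≈1 : θ + θ′ ≈ 1#
        θ+θ′≈1 = trans (sym (distribʳ _ _ _)) (trans (*-congʳ (sym d≈1+d⁻)) (*-⁻¹ 0<d))

        2θ≤1 : θ + θ ≤ 1#
        2θ≤1 = ≤-trans (≤-reflexive (sym (distribʳ _ _ _))) (/-≤ 0<d (≤-trans
          (≤-trans (≤-reflexive (solve 0 (con (+ 1) :+ con (+ 1) := con (+ 2)) refl))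
            (fromℕ-mono (ℕₚ.≤-trans (ℕ.s≤s (ℕ.s≤s ℕ.z≤n)) d≥3)))
          (≤-reflexive (sym (*-identityˡ _)))))

        θ′i≈θ : θ′ * i ≈ θ
        θ′i≈θ =
          trans (solve 3 (λ e c j → e :* c :* (con (+ 1) :* j) := e :* j :* c) refl d⁻ (fromℕ d ⁻¹) (d⁻ ⁻¹))
          (*-congʳ (*-⁻¹ 0<d⁻))

        0≤log : ∀ {u v} → 0# < u → 0# < v → v ≤ u → 0# ≤ log (u / v)
        0≤log 0<u 0<v v≤u = ≤-log (/-pos 0<u 0<v) (≤-trans (≤-reflexive exp-0)
          (≤-/ 0<v (≤-trans (≤-reflexive (*-identityˡ _)) v≤u)))

        0≤Lₚ : 0# ≤ Lₚ
        0≤Lₚ = 0≤log 0<1 0<p p≤1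

        0≤ρ : 0# ≤ ρ
        0≤ρ = 0≤log 0<r 0<β (≤-trans β≤1 (1≤fromℕ 1≤r))

        -- From δ ≤ 1/4 and e ≤ 4.
        1≤L : 1# ≤ L
        1≤L =
          ≤-log (/-pos 0<1 0<δ) (≤-trans exp-1≤4 (≤-/ 0<δ (≤-trans (≤-reflexive (*-comm _ _)) (≤-/⁻¹ 0<4 δ≤1/4))))

        l₀+iL≤lₜ : l₀ + i * L ≤ lₜ
        l₀+iL≤lₜ = exp-reflects-≤ (begin
          exp (l₀ + i * L)             ≈⟨ exp-+ _ _ ⟩
          exp l₀ * exp (i * L)
            ≈⟨ *-cong (exp-log 0<λ₀) (exp-cong (trans (solve 2 (λ i l → i :* l := :- i :* :- l) refl i L)
                                           (*-congˡ (sym (log≈-log-1/ 0<δ))))) ⟩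
          λ₀ * exp (- i * log δ)       ≈⟨ *-congˡ (^ʳ-def 0<δ (- i)) ⟨
          λ₀ * δ ^ʳ (- i)              ≤⟨ t-large ⟩
          T                            ≈⟨ exp-log 0<T ⟨
          exp lₜ                       ∎)
          where open ≤-Reasoning

        λ₀≤T : λ₀ ≤ T
        λ₀≤T = ≤-resp (exp-log 0<λ₀) (exp-log 0<T) (exp-mono (≤-trans
          (≤-from-diff (*-nonneg (proj₁ (/-pos 0<1 0<d⁻)) (≤-trans 0≤1 1≤L)) refl) l₀+iL≤lₜ))

        0≤θ′ : 0# ≤ θ′
        0≤θ′ = proj₁ (/-pos 0<d⁻ 0<d)

        -- The logarithm of the assumption on t, multiplied by (d-1)/d; this turns the exponent
        -- 1/(d-1) into 1/d.
        exponents : θ * L + θ′ * l₀ ≤ θ′ * lₜ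
        exponents = ≤-trans (≤-reflexive (trans (+-congʳ (*-congʳ (sym θ′i≈θ)))
            (solve 4 (λ a i l m → a :* i :* l :+ a :* m := a :* (m :+ i :* l)) refl θ′ i L l₀)))
          (*-monoʳ-≤ 0≤θ′ l₀+iL≤lₜ)

        module B = Bounds {r} {t} 1≤r t≥1 {β} {C} {p} {δ} {λ₀} {L} {Lₚ} {ρ} {l₀} {lₜ} {θ} {θ′}
          0<β 0<C 0<p 0<δ (exp-log-1/ 0<δ) (exp-log-1/ 0<p)
          (trans (*-congʳ (exp-log (/-pos 0<r 0<β))) (/-cancel _ 0<β))
          (exp-log 0<λ₀) (exp-log 0<T) 0≤Lₚ 0≤ρ 1≤L (proj₁ (/-pos 0<1 0<d)) 2θ≤1 0≤θ′ θ+θ′≈1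
          (≤-trans (≤-reflexive (*-comm _ _)) (≤-/⁻¹ 0<4 δ≤p/4)) 2≤λ₀ 6L≤λ₀ λ₀≤T exponents

        c : ℝ
        c = B.a * T + B.K * (L + L)

        c≤TΞ : c ≤ T * Ξ
        c≤TΞ = ≤-trans B.total-cost (≤-reflexive (*-congˡ (+-cong (+-congˡ (*-congˡ (sym (^ʳ-def 0<λ₀ θ))))
          (*-congˡ (⁻¹-cong (0<exp _) (sym (^ʳ-def 0<λ₀ θ′)))))))

      module _
        {n : ℕ} (G : EdgeColouring r n) (X : Subset n) (Y : Fin r → Subset n)
        (X≠∅ : Nonempty X) (Y≠∅ : ∀ i → Nonempty (Y i))
        (dense : ∀ x → x ∈ X → ∀ i → p * size (Y i) ≤ size (neighbourhood G i x ∩ Y i))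
        (Y-large : ∀ i → p ^ʳ (- T) * exp (Π * T) * fromℕ m ≤ size (Y i))
        (X-large : 2# * fromℕ r * T * exp (fromℕ r * T * Ξ) ≤ size X)
        where

        private
          open ≤-Reasoning

          -- The exponential in the assumption on |X| absorbs the cost, as c ≤ tΞ; the factor 2 in
          -- front makes the inequality strict.
          large : fromℕ r * T < exp (- (fromℕ r * c)) * size X
          large = <-≤-trans (x<x+y (*-pos 0<r 0<T)) (begin
            fromℕ r * T + fromℕ r * T
              ≈⟨ solve 2 (λ r t → r :* t :+ r :* t := con (+ 2) :* r :* t :* con (+ 1)) refl (fromℕ r) T ⟩
            2# * fromℕ r * T * 1#
              ≤⟨ *-monoʳ-≤ (*-nonneg (*-nonneg (proj₁ 0<2) (proj₁ 0<r)) (proj₁ 0<T))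
                                              (≤-trans (≤-reflexive (sym exp-0)) (exp-mono (≤-trans (diff-nonneg (*-monoʳ-≤ (proj₁ 0<r) c≤TΞ))
                                                (≤-reflexive (trans (+-comm _ _) (+-congˡ (sym (*-assoc _ _ _)))))))) ⟩
            2# * fromℕ r * T * exp (- (fromℕ r * c) + fromℕ r * T * Ξ)
              ≈⟨ *-congˡ (exp-+ _ _) ⟩
            2# * fromℕ r * T * (exp (- (fromℕ r * c)) * exp (fromℕ r * T * Ξ))
              ≈⟨ solve 3 (λ u v w → u :* (v :* w) := v :* (u :* w)) refl (2# * fromℕ r * T) _ _ ⟩
            exp (- (fromℕ r * c)) * (2# * fromℕ r * T * exp (fromℕ r * T * Ξ))
              ≤⟨ *-monoʳ-≤ (0≤exp _) X-large ⟩
            exp (- (fromℕ r * c)) * size X ∎)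

          0<Y : ∀ i → 0# < size (Y i)
          0<Y i = fromℕ-pos (∈⇒1≤size (proj₂ (Y≠∅ i)))

          module R = BookAlgorithm.Run 𝓡 B.stepBounds (geometric-lemma {r} {d} {β} {C} 𝒢rd) G X Y 0<Y

          outcome : R.Outcome
          outcome = R.outcome large (λ x∈X i → ≤-trans
            (≤-reflexive (*-congʳ (solve 2 (λ p d → p :- d :+ d := p) refl p δ))) (dense _ x∈X i)) (proj₂ X≠∅)

          -- The factor p^(-t) exp(Πt) in the assumption on |Y_i| is `exp E`, where `E` bounds the
          -- total decay exponent of Y.
          m≤ : ∀ {i X s} → R.Valid i X s → ∣ R.ColourState.T s ∣ ≡ t → R.ColourState.B s ≤ L + L →
            m ℕ.≤ ∣ R.ColourState.Y s ∣
          m≤ {i} {_} {s} valid ∣T∣≡t B≤2L = fromℕ-reflects-≤ (begin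
            fromℕ m                                  ≈⟨ *-identityˡ _ ⟨
            1# * fromℕ m                             ≈⟨ *-congʳ (exp-inverse E) ⟨
            exp E * exp (- E) * fromℕ m
              ≈⟨ solve 3 (λ u v w → u :* v :* w := v :* (u :* w)) refl _ _ _ ⟩
            exp (- E) * (exp E * fromℕ m)            ≈⟨ *-congˡ (*-congʳ (trans (exp-+ _ _) (*-congʳ p^-T))) ⟩
            exp (- E) * (p ^ʳ (- T) * exp (Π * T) * fromℕ m) ≤⟨ *-monoʳ-≤ (0≤exp _) (Y-large i) ⟩
            exp (- E) * size (Y i)
              ≤⟨ *-monoˡ-≤ (proj₁ (0<Y i)) (exp-mono (-‿antimono-≤ exponent)) ⟩
            R.decay (R.ColourState.B s) ∣ R.ColourState.T s ∣ * size (Y i) ≤⟨ R.Valid.bigY valid ⟩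
            size (R.ColourState.Y s)                 ∎)
            where
            E : ℝ
            E = T * Lₚ + Π * T
            p^-T : exp (T * Lₚ) ≈ p ^ʳ (- T)
            p^-T = sym (trans (^ʳ-def 0<p (- T)) (exp-cong (trans (*-congˡ (log≈-log-1/ 0<p))
              (solve 2 (λ t l → :- t :* :- l := t :* l) refl T Lₚ))))
            exponent : B.κ * size (R.ColourState.T s) + B.κ′ * R.ColourState.B s ≤ E
            exponent = ≤-trans (+-mono-≤ (≤-reflexive (*-congˡ (reflexive (≡.cong fromℕ ∣T∣≡t))))
                (*-monoʳ-≤ (*-nonneg B.0≤κ (*-nonneg (*-nonneg (proj₁ 0<2) (proj₁ 0<T)) B.0≤i₀)) B≤2L))
              B.total-decay

        Conclusion : Set
        Conclusion = Σ[ i ∈ Fin r ] Σ[ T ∈ Subset n ] Σ[ P ∈ Subset n ]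
          T ⊆ X × IsClique G i T × ∣ T ∣ ≡ t ×
          P ⊆ Y i ─ T × ∣ P ∣ ≡ m × AllEdgesColoured G i T P ×
          IsSizedBook G i t m T P

        private
          extractBook : R.Outcome → Conclusion
          extractBook (i , _ , s , valid , ∣T∣≡t , B≤2L) =
              i , T₁ , P , T⊆X₀ , clique , ∣T∣≡t , P⊆Y─T , ∣P∣≡m , edges ,
              ((λ (v , v∈T∩P) → let v∈T , v∈P = Sub.x∈p∩q⁻ T₁ P v∈T∩P in disjoint v∈P v∈T) , clique , edges) ,
              ∣T∣≡t , ℕₚ.≤-reflexive (≡.sym ∣P∣≡m)
            where
            open R.Valid valid
            T₁ Y₁ P : Subset n
            T₁ = R.ColourState.T s
            Y₁ = R.ColourState.Y s
            P = take m Y₁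
            ∣P∣≡m : ∣ P ∣ ≡ m
            ∣P∣≡m = ∣take∣ m Y₁ (m≤ valid ∣T∣≡t B≤2L)
            adjacent : ∀ {u v} → u ∈ T₁ → v ∈ P → v ∈ neighbourhood G i u
            adjacent u∈T v∈P = T-Y u∈T (take-⊆ m Y₁ v∈P)
            disjoint : ∀ {v} → v ∈ P → ¬ v ∈ T₁
            disjoint v∈P v∈T = proj₁ (∈-neighbourhood⁻ G (adjacent v∈T v∈P)) ≡.refl
            edges : AllEdgesColoured G i T₁ P
            edges u∈T v∈P _ = proj₂ (∈-neighbourhood⁻ G (adjacent u∈T v∈P))
            P⊆Y─T : P ⊆ Y i ─ T₁
            P⊆Y─T v∈P = Sub.x∈p∧x∉q⇒x∈p─q (Y⊆Y₀ (take-⊆ m Y₁ v∈P)) (disjoint v∈P)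

        conclusion : Conclusion
        conclusion = extractBook outcome

theorem4p2 : (𝓡 : RealNumbers) →
  let open Real 𝓡 in
  (r d : ℕ) → r ℕ.≥ 2 → d ℕ.≥ 3 →
  (β C : ℝ) → 0# < β → β ≤ 1# → 0# < C →
  𝒢 r d β C →
  (t m : ℕ) → t ℕ.≥ 1 → m ℕ.≥ 1 →
  (p : ℝ) → 0# < p → p ≤ 1# →
  (δ λ₀ : ℝ) → 0# < δ → 0# < λ₀ →
  let L  = log (1# / δ)
      Lₚ = log (1# / p)
      ρ  = log (fromℕ r / β)
      d⁻ = fromℕ (d ∸ 1)
      Π  = fromℕ 3 * δ / p + fromℕ 6 * L * Lₚ / λ₀
      Ξ  = fromℕ 2 * ρ + fromℕ 4 * C * λ₀ ^ʳ (1# / fromℕ d)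
             + fromℕ 12 * C * L / λ₀ ^ʳ (d⁻ / fromℕ d)
      T′ = fromℕ t
  in
  δ ≤ p / fromℕ 4 → δ ≤ 1# / fromℕ 4 →
  fromℕ 2 ≤ λ₀ → fromℕ 6 * L ≤ λ₀ →
  λ₀ * δ ^ʳ (- (1# / d⁻)) ≤ T′ →
  (n : ℕ) (G : EdgeColouring r n) (X : Subset n) (Y : Fin r → Subset n) →
  Nonempty X → (∀ i → Nonempty (Y i)) →
  (∀ x → x ∈ X → ∀ i → p * fromℕ ∣ Y i ∣ ≤ fromℕ ∣ neighbourhood G i x ∩ Y i ∣) →
  (∀ i → p ^ʳ (- T′) * exp (Π * T′) * fromℕ m ≤ fromℕ ∣ Y i ∣) →
  fromℕ 2 * fromℕ r * T′ * exp (fromℕ r * T′ * Ξ) ≤ fromℕ ∣ X ∣ →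
  Σ[ i ∈ Fin r ] Σ[ T ∈ Subset n ] Σ[ P ∈ Subset n ]
    T ⊆ X × IsClique G i T × ∣ T ∣ ≡ t ×
    P ⊆ Y i ─ T × ∣ P ∣ ≡ m × AllEdgesColoured G i T P ×
    IsSizedBook G i t m T P
theorem4p2 𝓡 r d r≥2 d≥3 β C 0<β β≤1 0<C 𝒢rd t m t≥1 _ p 0<p p≤1 δ λ₀ 0<δ 0<λ₀
  δ≤p/4 δ≤1/4 2≤λ₀ 6L≤λ₀ t-large n G X Y X≠∅ Y≠∅ dense Y-large X-large =
  MainTheorem.conclusion 𝓡 {r} {d} r≥2 d≥3 0<β β≤1 0<C 𝒢rd {t} {m} t≥1 0<p p≤1 0<δ 0<λ₀
    δ≤p/4 δ≤1/4 2≤λ₀ 6L≤λ₀ t-large G X Y X≠∅ Y≠∅ dense Y-large X-large
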